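{- Let $k,d$ be positive integers with $k<d$. Then, as $n\to\infty$ along $\mathcal{N}_{d,k}$, asymptotically almost surely $\mathcal{G}_{n,d}$ has a $k$-star decomposition in each of the following cases: (i) $k=2$, or $d$ is an even multiple of $k$; (ii) $d\ge 2k^2+k$; (iii) $k$ is odd and $3\le k<d/2$.
   Context: $\mathcal{G}_{n,d}$ denotes the uniformly random (simple) $d$-regular graph on vertex set $[n]$. A $k$-star is the complete bipartite graph $K_{1,k}$; a $k$-star decomposition of a graph $G$ is a partition of $E(G)$ into edge-disjoint copies of $K_{1,k}$. Let $\mathcal{N}_{d,k}=\{n\in\mathbb{Z}^+ : 2k \text{ divides } dn\}$. An event holds asymptotically almost surely (a.a.s.) if its probability tends to $1$ as $n\to\infty$ (here along $\mathcal{N}_{d,k}$). -}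

module Defs where

open import Data.Bool using (true; false)
open import Data.Fin using (Fin; toℕ; fromℕ<; combine)
import Data.Fin.Properties as Fin
open import Data.Fin.Subset using (Subset; _∈_; _∉_; ∣_∣; Nonempty)
open import Data.Fin.Subset.Properties using (_∈?_; nonempty?; Empty-unique; ∣⊥∣≡0)
open import Data.Integer using (+_)
open import Data.List using (List; []; _∷_; [_]; length; filter; allFin; cartesianProductWith)
import Data.List.Membership.Propositional as List
open import Data.List.Membership.Propositional.Properties using (∈-cartesianProductWith⁺; ∈-allFin)
import Data.List.Relation.Unary.All as All
import Data.List.Relation.Unary.AllPairs as AllPairs
open import Data.List.Relation.Unary.Any as Any using (here; there)
open import Data.List.Relation.Unary.Unique.Propositional using (Unique)
import Data.List.Relation.Unary.Unique.Propositional.Properties as Unique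
open import Data.Nat using (ℕ; zero; suc; _*_; _≤_; _<_; NonZero; s≤s; ≢-nonZero⁻¹)
open import Data.Nat.Divisibility using (_∣_)
import Data.Nat.Properties as ℕ
open import Data.Product using (_×_; _,_; ∃; ∃₂; ∃!; proj₁; proj₂)
open import Data.Rational as ℚ using (ℚ; 0ℚ; 1ℚ)
open import Data.Sum using (_⊎_; inj₁; inj₂)
open import Data.Vec using (Vec; []; _∷_; lookup)
open import Data.Vec.Properties using (∷-injective)
open import Level using (Level)
open import Relation.Binary.PropositionalEquality using (_≡_; refl; sym; trans; cong; subst)
open import Relation.Nullary using (¬_; Dec; yes; no; contradiction)
open import Relation.Nullary.Decidable using (map′; ¬?; _×-dec_; _⊎-dec_; _→-dec_)
open import Relation.Unary using (Pred; Decidable)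

private
  variable
    a p : Level
    A : Set a
    k d m n : ℕ

vectors : List A → (n : ℕ) → List (Vec A n)
vectors xs zero    = [ [] ]
vectors xs (suc n) = cartesianProductWith _∷_ xs (vectors xs n)

vectors-complete : {xs : List A} → (∀ x → x List.∈ xs) → (v : Vec A n) → v List.∈ vectors xs n
vectors-complete ∈xs []      = here refl
vectors-complete ∈xs (x ∷ v) = ∈-cartesianProductWith⁺ _∷_ (∈xs x) (vectors-complete ∈xs v)

vectors-unique : {xs : List A} → Unique xs → (n : ℕ) → Unique (vectors xs n)
vectors-unique uniq zero    = All.[] AllPairs.∷ AllPairs.[]
vectors-unique uniq (suc n) = Unique.cartesianProductWith⁺ _∷_ ∷-injective uniq (vectors-unique uniq n)

subsets : (n : ℕ) → List (Subset n)
subsets = vectors (true ∷ false ∷ [])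

subsets-complete : (s : Subset n) → s List.∈ subsets n
subsets-complete = vectors-complete λ { true → here refl ; false → there (here refl) }

subsets-unique : (n : ℕ) → Unique (subsets n)
subsets-unique = vectors-unique (((λ ()) All.∷ All.[]) AllPairs.∷ (All.[] AllPairs.∷ AllPairs.[]))

any-list? : {P : Pred A p} {xs : List A} → (∀ x → x List.∈ xs) → Decidable P → Dec (∃ P)
any-list? {xs = xs} ∈xs P? =
  map′ Any.satisfied (λ { (x , px) → Any.map (λ { refl → px }) (∈xs x) }) (Any.any? P? xs)

-- Entry i is the neighbourhood of vertex i. Such a digraph is a simple graph
-- when it satisfies IsSimple; since the representation is first-order data,
-- distinct labelled graphs are exactly the propositionally distinct ones.
Digraph : ℕ → Set
Digraph n = Vec (Subset n) n

Adj : Digraph n → Fin n → Fin n → Set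
Adj G i j = j ∈ lookup G i

adj? : (G : Digraph n) (i j : Fin n) → Dec (Adj G i j)
adj? G i j = j ∈? lookup G i

record IsSimple (G : Digraph n) : Set where
  field
    irreflexive : ∀ i → ¬ Adj G i i
    symmetric   : ∀ i j → Adj G i j → Adj G j i

IsRegular : ℕ → Digraph n → Set
IsRegular d G = ∀ i → ∣ lookup G i ∣ ≡ d

IsRegularGraph : ℕ → Digraph n → Set
IsRegularGraph d G = IsSimple G × IsRegular d G

isSimple? : Decidable (IsSimple {n})
isSimple? G = map′
  (λ (irr , symm) → record { irreflexive = irr ; symmetric = symm })
  (λ s → IsSimple.irreflexive s , IsSimple.symmetric s)
  (Fin.all? (λ i → ¬? (adj? G i i)) ×-dec
   Fin.all? λ i → Fin.all? λ j → adj? G i j →-dec adj? G j i)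

isRegularGraph? : (d : ℕ) → Decidable (IsRegularGraph {n} d)
isRegularGraph? d G = isSimple? G ×-dec Fin.all? λ i → ∣ lookup G i ∣ ℕ.≟ d

regularGraphs : (n d : ℕ) → List (Digraph n)
regularGraphs n d = filter (isRegularGraph? d) (vectors (subsets n) n)

regularGraphs-unique : (n d : ℕ) → Unique (regularGraphs n d)
regularGraphs-unique n d = Unique.filter⁺ (isRegularGraph? d) (vectors-unique (subsets-unique n) n)

record Star (n : ℕ) : Set where
  constructor star
  field
    centre : Fin n
    leaves : Subset n

open Star public

IsKStar : ℕ → Star n → Set
IsKStar k s = centre s ∉ leaves s × ∣ leaves s ∣ ≡ k

StarEdge : Star n → Fin n → Fin n → Set
StarEdge s i j = (i ≡ centre s × j ∈ leaves s) ⊎ (j ≡ centre s × i ∈ leaves s)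

record IsStarDecomposition (k : ℕ) (G : Digraph n) (S : Vec (Star n) m) : Set where
  field
    isKStar  : ∀ a → IsKStar k (lookup S a)
    subgraph : ∀ a i j → StarEdge (lookup S a) i j → Adj G i j
    covered  : ∀ i j → Adj G i j → ∃! _≡_ λ a → StarEdge (lookup S a) i j

HasStarDecomposition : ℕ → Digraph n → Set
HasStarDecomposition {n} k G = ∃₂ λ m (S : Vec (Star n) m) → IsStarDecomposition k G S

starEdge? : (s : Star n) (i j : Fin n) → Dec (StarEdge s i j)
starEdge? s i j = (i Fin.≟ centre s ×-dec j ∈? leaves s) ⊎-dec (j Fin.≟ centre s ×-dec i ∈? leaves s)

∃!-fin? : {P : Pred (Fin m) p} → Decidable P → Dec (∃! _≡_ P)
∃!-fin? P? = map′
  (λ (x , px , u) → x , px , λ {y} → u y)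
  (λ (x , px , u) → x , px , λ y → u {y})
  (Fin.any? λ x → P? x ×-dec Fin.all? λ y → P? y →-dec x Fin.≟ y)

isStarDecomposition? : (k : ℕ) (G : Digraph n) (S : Vec (Star n) m) → Dec (IsStarDecomposition k G S)
isStarDecomposition? k G S = map′
  (λ (x , y , z) → record { isKStar = x ; subgraph = y ; covered = z })
  (λ D → let open IsStarDecomposition D in isKStar , subgraph , covered)
  (Fin.all? (λ a → ¬? (centre (lookup S a) ∈? leaves (lookup S a)) ×-dec ∣ leaves (lookup S a) ∣ ℕ.≟ k) ×-dec
   Fin.all? (λ a → Fin.all? λ i → Fin.all? λ j → starEdge? (lookup S a) i j →-dec adj? G i j) ×-dec
   Fin.all? (λ i → Fin.all? λ j → adj? G i j →-dec ∃!-fin? (λ a → starEdge? (lookup S a) i j)))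

stars : (n : ℕ) → List (Star n)
stars n = cartesianProductWith star (allFin n) (subsets n)

stars-complete : (s : Star n) → s List.∈ stars n
stars-complete (star c l) = ∈-cartesianProductWith⁺ star (∈-allFin c) (subsets-complete l)

-- Sending each star to one of its (directed) edges is injective.
decomposition-size : .{{NonZero k}} → {G : Digraph n} {S : Vec (Star n) m} →
                     IsStarDecomposition k G S → m ≤ n * n
decomposition-size {k} {n} {m} {G} {S} D = Fin.injective⇒≤ {f = code} code-injective
  where
  open IsStarDecomposition D

  c : Fin m → Fin n
  c a = centre (lookup S a)

  leaf : ∀ a → Nonempty (leaves (lookup S a))
  leaf a with nonempty? (leaves (lookup S a))
  ... | yes ne = ne
  ... | no ¬ne = contradiction
    (trans (sym (proj₂ (isKStar a))) (trans (cong ∣_∣ (Empty-unique ¬ne)) (∣⊥∣≡0 n)))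
    (≢-nonZero⁻¹ k)

  l : Fin m → Fin n
  l a = proj₁ (leaf a)

  code : Fin m → Fin (n * n)
  code a = combine (c a) (l a)

  code-injective : ∀ {a b} → code a ≡ code b → a ≡ b
  code-injective {a} {b} eq
    with c≡ , l≡ ← Fin.combine-injective (c a) (l a) (c b) (l b) eq
    with _ , _ , unique ← covered (c a) (l a) (subgraph a _ _ (inj₁ (refl , proj₂ (leaf a))))
    = trans (sym (unique (inj₁ (refl , proj₂ (leaf a)))))
            (unique (inj₁ (c≡ , subst (_∈ leaves (lookup S b)) (sym l≡) (proj₂ (leaf b)))))

hasStarDecomposition? : (k : ℕ) .{{_ : NonZero k}} → Decidable (HasStarDecomposition {n} k)
hasStarDecomposition? {n} k G = map′
  (λ (m , S , D) → toℕ m , S , D)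
  (λ (m , S , D) → let m<1+n² = s≤s (decomposition-size D) in
     fromℕ< m<1+n² ,
     subst (λ x → ∃ λ (T : Vec (Star n) x) → IsStarDecomposition k G T)
           (sym (Fin.toℕ-fromℕ< m<1+n²)) (S , D))
  (Fin.any? {n = suc (n * n)} λ m →
     any-list? (vectors-complete {n = toℕ m} stars-complete) (isStarDecomposition? k G))

-- There is no uniform distribution on an empty sample space; the value is then
-- set to 0, so that a limit of 1 entails that the space is eventually nonempty.
ratio : ℕ → ℕ → ℚ
ratio a zero      = 0ℚ
ratio a b@(suc _) = + a ℚ./ b

uniformProbability : (Ω : List A) {P : Pred A p} → Decidable P → ℚ
uniformProbability Ω P? = ratio (length (filter P? Ω)) (length Ω)

probStarDecomposition : (n d k : ℕ) .{{_ : NonZero k}} → ℚ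
probStarDecomposition n d k = uniformProbability (regularGraphs n d) (hasStarDecomposition? k)

TendsToAlong : (ℕ → Set) → (ℕ → ℚ) → ℚ → Set
TendsToAlong N f L = ∀ ε → 0ℚ ℚ.< ε → ∃ λ n₀ → ∀ n → n₀ ≤ n → N n → ℚ.∣ f n ℚ.- L ∣ ℚ.< ε

Admissible : (d k : ℕ) → ℕ → Set
Admissible d k n = 0 < n × 2 * k ∣ d * n

AasStarDecomposition : (d k : ℕ) .{{_ : NonZero k}} → Set
AasStarDecomposition d k = TendsToAlong (Admissible d k) (λ n → probStarDecomposition n d k) 1ℚ

-- A k-star decomposition is an orientation in which k divides every in-degree: the in-edges of a
-- vertex are then cut into stars. With L = 2k and net = in − out, this means net v ≡ −d (mod L).
--
-- Put tokens on the vertices and let Φ B be the size of the edge cut of B plus the residue mod L of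
-- the number of tokens in B. If Φ B ≥ 2L − 2 for all nonempty proper B, then there is an orientation
-- with net v ≡ tokens at v and net v ≤ L − 1. The statement proved by induction allows some edges to
-- be directed already (those to a root outside V) and one vertex of residue 0 to be exempt.
--  * A set of at least two vertices with Φ ≤ 2L − 2 is contracted; one solves outside, then inside.
--    Otherwise, by parity, Φ ≥ 2L on such sets, and edges at a vertex of residue 0 can be split off
--    in pairs until it is isolated. A vertex of residue at most that of V is brought to residue 0
--    by dummy edges.
--  * Otherwise an edge leaving V (or, if there is none, an edge of the graph, which is directed
--    first) is redirected from the root, adding a token. Only sets of residue L − 1 lose Φ, and a
--    maximal such set is contracted before and treated recursively after.
--
-- For d > 2k the tokens at each vertex are −d mod L and the density condition follows once every
-- edge cut with at least two vertices on both sides has at least 2d − 4 edges; when complements of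
-- vertices violate it, one vertex serves as the root and receives k edges. The case d = 2k is the
-- case L = 2 (an Eulerian orientation), and for d = 3, k = 2 connectivity suffices.
--
-- The cut condition holds a.a.s.: for a fixed set of s vertices, let N c be the number of graphs with
-- c cut edges. Switching an inner and an outer edge into two cut edges gives
-- N c (ds − c) (d(n − s) − c − 2d²) ≤ N (c + 2) (c + 2)². Iterating i + t times and summing over i,
-- Vandermonde's identity produces the factor binom n s, which pays for the choice of the set, and the
-- additional t switchings give the decay. Circulant graphs show that the sample space is nonempty.
module Submission where

open import Defs
open import Data.Bool using (Bool; true; false; _∧_; _∨_; not; if_then_else_; _xor_)
open import Data.Bool.Properties using (xor-comm; xor-same; xor-identityʳ; ∧-comm; ∧-zeroʳ; ∨-comm) renaming (_≟_ to _≟ᵇ_)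
open import Data.Empty using (⊥; ⊥-elim)
open import Data.Fin using (Fin; zero; suc; toℕ)
import Data.Fin.Properties as Fin
open import Data.Fin.Subset using (Subset; _∈_; ∣_∣)
open import Data.Fin.Subset.Properties using (anySubset?)
open import Data.Integer using (ℤ) renaming (+_ to pos; _+_ to _+ᶻ_; _-_ to _-ᶻ_; -_ to neg; _*_ to _*ᶻ_; _≤_ to _≤ᶻ_)
import Data.Integer as ℤ
import Data.Integer.Properties as ℤ
import Data.Integer.Tactic.RingSolver as ℤ-Solver
open import Data.List using (List; []; _∷_; _++_; map; length; filter; replicate)
open import Data.List.Membership.Propositional using () renaming (_∈_ to _∈ᴸ_)
open import Data.List.Membership.Propositional.Properties using (∈-filter⁺; ∈-filter⁻; ∈-map⁻)
open import Data.List.Properties using (length-++; length-map; length-filter; map-++; ++-identityʳ)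
open import Data.List.Relation.Unary.All as All using (All; []; _∷_)
import Data.List.Relation.Unary.All.Properties as All
open import Data.List.Relation.Unary.AllPairs using ([]; _∷_)
open import Data.List.Relation.Unary.Any using (here; there)
open import Data.List.Relation.Unary.Unique.Propositional using (Unique)
import Data.List.Relation.Unary.Unique.Propositional.Properties as Unique
open import Data.Nat using (ℕ; zero; suc; _+_; _*_; _∸_; _^_; _/_; _%_; _≤_; _<_; z≤n; s≤s; NonZero; >-nonZero; ∣_-_∣; _≤?_; _<?_)
open import Data.Nat.DivMod using (m≡m%n+[m/n]*n; m%n<n; m<n⇒m%n≡m; [m+kn]%n≡m%n; m%n≤m; [m+n]%n≡m%n; %-remove-+ʳ; m/n*n≤m)
open import Data.Nat.Divisibility using (_∣_; divides; 1∣_; _∣?_; ∣-refl; ∣-trans; ∣⇒≤; ∣m∣n⇒∣m+n; ∣m+n∣m⇒∣n; ∣m⇒∣m*n; n∣m*n; m∣m*n; m%n≡0⇒n∣m; n∣m⇒m%n≡0; *-cancelˡ-∣)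
open import Data.Nat.Primality using (euclidsLemma; prime[2])
import Data.Nat.Properties as ℕ
import Data.Nat.Tactic.RingSolver as ℕ-Solver
open import Data.Product using (_×_; _,_; ∃; ∃₂; ∃!; proj₁; proj₂)
open import Data.Rational as ℚ using (ℚ; 0ℚ; 1ℚ; mkℚ; toℚᵘ)
import Data.Rational.Properties as ℚ
open import Data.Rational.Unnormalised as ℚᵘ using (ℚᵘ; mkℚᵘ; *<*)
import Data.Rational.Unnormalised.Properties as ℚᵘ
open import Data.Sum as Sum using (_⊎_; inj₁; inj₂)
open import Data.Vec using (Vec; []; _∷_; lookup; tabulate)
open import Data.Vec.Properties using (lookup∘tabulate; tabulate∘lookup; tabulate-cong; []=⇒lookup; lookup⇒[]=)
open import Function using (_∘_; id)
open import Relation.Binary.PropositionalEquality using (_≡_; _≢_; refl; sym; trans; cong; cong₂; subst; subst₂; module ≡-Reasoning)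
open import Relation.Nullary using (¬_; Dec; yes; no)
open import Relation.Nullary.Decidable using (⌊_⌋; _×-dec_; _→-dec_; ¬?; decidable-stable)
open import Relation.Unary using (Pred; Decidable)

-- Cases (i) to (iii) all give 2k ≤ d, apart from k = 2, d = 3; for k = 1 every orientation serves.
-- A congruence alone does not survive contraction, since the net degree imposed on a contracted set
-- must be realised inside it. The induction therefore carries the bound net ≤ L - 1. It is
-- one-sided, and two consequences are used throughout: a vertex of residue 0 has net at most 0, so
-- dummy edges can be withdrawn again, and if all boundary edges of V enter it, their number is
-- exactly the residue of V. The threshold is 2 (L - 1) because two quantities below L compete with
-- the undirected edges: the residue of a set, and the number of boundary edges once they all enter
-- V. Together they stay below the threshold, so every nonempty proper subset has an undirected edge
-- leaving it. At d = 2k + 1 the threshold equals 2d - 4, the cut size that random regular graphs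
-- are shown to have. The exempt vertex comes from contracting a maximal set of residue L - 1: the
-- added token turns its residue into 0, and it is the only set of the contracted instance that may
-- have become too sparse.

bit : Bool → ℕ
bit true  = 1
bit false = 0

bit≤1 : ∀ b → bit b ≤ 1
bit≤1 true  = s≤s z≤n
bit≤1 false = z≤n

bit-not : ∀ b → bit b + bit (not b) ≡ 1
bit-not true  = refl
bit-not false = refl

bit-∧ : ∀ x y → bit (x ∧ y) ≡ bit x * bit y
bit-∧ true  y = sym (ℕ.+-identityʳ _)
bit-∧ false y = refl

∑ : ∀ {n} → (Fin n → ℕ) → ℕ
∑ {zero}  f = 0
∑ {suc n} f = f zero + ∑ (f ∘ suc)

∑-mono : ∀ {n} {f g : Fin n → ℕ} → (∀ i → f i ≤ g i) → ∑ f ≤ ∑ g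
∑-mono {zero}  f≤g = z≤n
∑-mono {suc n} f≤g = ℕ.+-mono-≤ (f≤g zero) (∑-mono (f≤g ∘ suc))

∑-mono-< : ∀ {n} {f g : Fin n → ℕ} → (∀ i → f i ≤ g i) → ∀ i → f i < g i → ∑ f < ∑ g
∑-mono-< f≤g zero    f<g = ℕ.+-mono-<-≤ f<g (∑-mono (f≤g ∘ suc))
∑-mono-< f≤g (suc i) f<g = ℕ.+-mono-≤-< (f≤g zero) (∑-mono-< (f≤g ∘ suc) i f<g)

false≢true : false ≢ true
false≢true ()

clash : ∀ {A : Set} {b} → b ≡ false → b ≡ true → A
clash {b = true}  () _
clash {b = false} _ ()

¬true⇒false : ∀ {b} → b ≢ true → b ≡ false
¬true⇒false {true}  ne = ⊥-elim (ne refl)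
¬true⇒false {false} ne = refl

+-interchange : ∀ a b c d → (a + b) + (c + d) ≡ (a + c) + (b + d)
+-interchange = ℕ-Solver.solve-∀

-- Cuts, tokens and net degrees

module Edges (N : ℕ) where

  X : Set
  X = Fin N

  Edge : Set
  Edge = X × X

  PSet : Set
  PSet = X → Bool

  infix 4 _⊆_ _≐_
  _⊆_ : PSet → PSet → Set
  A ⊆ B = ∀ x → A x ≡ true → B x ≡ true

  _≐_ : PSet → PSet → Set
  A ≐ B = ∀ x → A x ≡ B x

  size : PSet → ℕ
  size A = ∑ (bit ∘ A)

  size-mono : ∀ {A B} → A ⊆ B → size A ≤ size B
  size-mono {A} {B} A⊆B = ∑-mono λ x → aux x
    where
    aux : ∀ x → bit (A x) ≤ bit (B x)
    aux x with A x in a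
    ... | false = z≤n
    ... | true rewrite A⊆B x a = s≤s z≤n

  size-mono-< : ∀ {A B} → A ⊆ B → ∀ x → A x ≡ false → B x ≡ true → size A < size B
  size-mono-< {A} {B} A⊆B x a b = ∑-mono-< aux x lt
    where
    aux : ∀ x → bit (A x) ≤ bit (B x)
    aux x with A x in a
    ... | false = z≤n
    ... | true rewrite A⊆B x a = s≤s z≤n
    lt : bit (A x) < bit (B x)
    lt rewrite a | b = s≤s z≤n

  δ : X → PSet
  δ v x = ⌊ x Fin.≟ v ⌋

  δ-refl : ∀ v → δ v v ≡ true
  δ-refl v with v Fin.≟ v
  ... | yes _ = refl
  ... | no v≢v = ⊥-elim (v≢v refl)

  δ-true : ∀ {v x} → δ v x ≡ true → x ≡ v
  δ-true {v} {x} eq with x Fin.≟ v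
  ... | yes p = p
  ... | no _  = ⊥-elim (false≢true eq)

  δ-false : ∀ {v x} → x ≢ v → δ v x ≡ false
  δ-false {v} {x} ne with x Fin.≟ v
  ... | yes p = ⊥-elim (ne p)
  ... | no _  = refl

  cut : List Edge → PSet → ℕ
  cut []            A = 0
  cut ((u , v) ∷ E) A = bit (A u xor A v) + cut E A

  tok : List X → PSet → ℕ
  tok []      A = 0
  tok (q ∷ Q) A = bit (A q) + tok Q A

  i : Bool → ℤ
  i b = pos (bit b)

  -- Here (u , v) is directed from u to v, so this is in-degree minus out-degree of the set A; edges
  -- inside A cancel. Measuring sets, given as functions, turns contraction into precomposition
  -- (`net-map`).
  net : List Edge → PSet → ℤ
  net []            A = pos 0
  net ((u , v) ∷ D) A = (i (A v) -ᶻ i (A u)) +ᶻ net D A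

  cut-ext : ∀ {A B} → A ≐ B → ∀ E → cut E A ≡ cut E B
  cut-ext A≐B []            = refl
  cut-ext A≐B ((u , v) ∷ E) rewrite A≐B u | A≐B v | cut-ext A≐B E = refl

  tok-ext : ∀ {A B} → A ≐ B → ∀ Q → tok Q A ≡ tok Q B
  tok-ext A≐B []      = refl
  tok-ext A≐B (q ∷ Q) rewrite A≐B q | tok-ext A≐B Q = refl

  net-ext : ∀ {A B} → A ≐ B → ∀ D → net D A ≡ net D B
  net-ext A≐B []            = refl
  net-ext A≐B ((u , v) ∷ D) rewrite A≐B u | A≐B v | net-ext A≐B D = refl

  cut-++ : ∀ E F A → cut (E ++ F) A ≡ cut E A + cut F A
  cut-++ []            F A = refl
  cut-++ ((u , v) ∷ E) F A rewrite cut-++ E F A = sym (ℕ.+-assoc (bit (A u xor A v)) (cut E A) (cut F A))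

  tok-++ : ∀ P Q A → tok (P ++ Q) A ≡ tok P A + tok Q A
  tok-++ []      Q A = refl
  tok-++ (p ∷ P) Q A rewrite tok-++ P Q A = sym (ℕ.+-assoc (bit (A p)) (tok P A) (tok Q A))

  net-++ : ∀ E F A → net (E ++ F) A ≡ net E A +ᶻ net F A
  net-++ []            F A = sym (ℤ.+-identityˡ _)
  net-++ ((u , v) ∷ E) F A rewrite net-++ E F A = sym (ℤ.+-assoc (i (A v) -ᶻ i (A u)) (net E A) (net F A))

  map² : (X → X) → Edge → Edge
  map² κ (u , v) = κ u , κ v

  cut-map : ∀ κ E A → cut (map (map² κ) E) A ≡ cut E (A ∘ κ)
  cut-map κ []            A = refl
  cut-map κ ((u , v) ∷ E) A = cong (_ +_) (cut-map κ E A)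

  tok-map : ∀ κ Q A → tok (map κ Q) A ≡ tok Q (A ∘ κ)
  tok-map κ []      A = refl
  tok-map κ (q ∷ Q) A = cong (_ +_) (tok-map κ Q A)

  net-map : ∀ κ D A → net (map (map² κ) D) A ≡ net D (A ∘ κ)
  net-map κ []            A = refl
  net-map κ ((u , v) ∷ D) A = cong ((i (A (κ v)) -ᶻ i (A (κ u))) +ᶻ_) (net-map κ D A)

  data Ornt : List Edge → List Edge → Set where
    []   : Ornt [] []
    keep : ∀ {e E D} → Ornt E D → Ornt (e ∷ E) (e ∷ D)
    flip : ∀ {u v E D} → Ornt E D → Ornt ((u , v) ∷ E) ((v , u) ∷ D)

  Ornt-cut : ∀ {E D} → Ornt E D → ∀ A → cut D A ≡ cut E A
  Ornt-cut []                      A = refl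
  Ornt-cut (keep o)                A = cong (_ +_) (Ornt-cut o A)
  Ornt-cut (flip {u} {v} o) A rewrite xor-comm (A u) (A v) = cong (_ +_) (Ornt-cut o A)

  Ornt-map : ∀ κ E {D′} → Ornt (map (map² κ) E) D′ → ∃ λ D → Ornt E D × map (map² κ) D ≡ D′
  Ornt-map κ []      []       = [] , [] , refl
  Ornt-map κ (e ∷ E) (keep o) with D , o′ , eq ← Ornt-map κ E o = e ∷ D , keep o′ , cong (map² κ e ∷_) eq
  Ornt-map κ ((u , v) ∷ E) (flip o) with D , o′ , eq ← Ornt-map κ E o = (v , u) ∷ D , flip o′ , cong
      ((κ v , κ u) ∷_) eq

  -- E and F agree as multisets of undirected edges, as far as cuts and orientations can tell.
  infix 4 _≃_
  record _≃_ (E F : List Edge) : Set where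
    field
      ≃cut : ∀ A → cut E A ≡ cut F A
      ≃len : length E ≡ length F
      ≃or  : ∀ {D} → Ornt F D → ∃ λ D′ → Ornt E D′ × ∀ A → net D′ A ≡ net D A
  open _≃_ public

  ≃-refl : ∀ {E} → E ≃ E
  ≃-refl = record { ≃cut = λ A → refl ; ≃len = refl ; ≃or = λ {D} o → D , o , λ A → refl }

  ≃-trans : ∀ {E F G} → E ≃ F → F ≃ G → E ≃ G
  ≃-trans p q = record
    { ≃cut = λ A → trans (≃cut p A) (≃cut q A)
    ; ≃len = trans (≃len p) (≃len q)
    ; ≃or  = λ o → let D₁ , o₁ , n₁ = ≃or q o ; D₂ , o₂ , n₂ = ≃or p o₁ in
                   D₂ , o₂ , λ A → trans (n₂ A) (n₁ A) }

  ≃-cons : ∀ e {E F} → E ≃ F → e ∷ E ≃ e ∷ F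
  ≃-cons (u , v) p = record
    { ≃cut = λ A → cong (_ +_) (≃cut p A)
    ; ≃len = cong suc (≃len p)
    ; ≃or  = λ { (keep o) → let D , o′ , n = ≃or p o in
                   _ ∷ D , keep o′ , λ A → cong ((i (A v) -ᶻ i (A u)) +ᶻ_) (n A)
               ; (flip o) → let D , o′ , n = ≃or p o in
                   _ ∷ D , flip o′ , λ A → cong ((i (A u) -ᶻ i (A v)) +ᶻ_) (n A) } }

  ≃-++ : ∀ G {E F} → E ≃ F → G ++ E ≃ G ++ F
  ≃-++ []      p = p
  ≃-++ (e ∷ G) p = ≃-cons e (≃-++ G p)

  swapℕ : ∀ a b c → a + (b + c) ≡ b + (a + c)
  swapℕ a b c = trans (sym (ℕ.+-assoc a b c)) (trans (cong (_+ c) (ℕ.+-comm a b)) (ℕ.+-assoc b a c))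

  swapℤ : ∀ a b c → a +ᶻ (b +ᶻ c) ≡ b +ᶻ (a +ᶻ c)
  swapℤ = ℤ-Solver.solve-∀

  ≃-swap : ∀ {e f E} → e ∷ f ∷ E ≃ f ∷ e ∷ E
  ≃-swap {u , v} {x , y} = record
    { ≃cut = λ A → swapℕ (bit (A u xor A v)) (bit (A x xor A y)) _
    ; ≃len = refl
    ; ≃or  = λ { (keep (keep {D = D} o)) → _ , keep (keep o) , λ A → swapℤ (i (A v) -ᶻ i (A u)) (i (A y) -ᶻ i (A x))
        (net D A)
               ; (keep (flip {D = D} o)) → _ , flip (keep o) , λ A → swapℤ (i (A u) -ᶻ i (A v)) (i (A y) -ᶻ i (A x))
                   (net D A)
               ; (flip (keep {D = D} o)) → _ , keep (flip o) , λ A → swapℤ (i (A v) -ᶻ i (A u)) (i (A x) -ᶻ i (A y))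
                   (net D A)
               ; (flip (flip {D = D} o)) → _ , flip (flip o) , λ A → swapℤ (i (A u) -ᶻ i (A v)) (i (A x) -ᶻ i (A y))
                   (net D A) } }

  ≃-shift : ∀ e G {E} → e ∷ (G ++ E) ≃ G ++ e ∷ E
  ≃-shift e []      = ≃-refl
  ≃-shift e (f ∷ G) = ≃-trans ≃-swap (≃-cons f (≃-shift e G))

  ≃-unshift : ∀ e G {E} → G ++ e ∷ E ≃ e ∷ (G ++ E)
  ≃-unshift e []      = ≃-refl
  ≃-unshift e (f ∷ G) = ≃-trans (≃-cons f (≃-unshift e G)) ≃-swap

  Ornt-++ : ∀ {E₁ E₂ D₁ D₂} → Ornt E₁ D₁ → Ornt E₂ D₂ → Ornt (E₁ ++ E₂) (D₁ ++ D₂)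
  Ornt-++ []       p = p
  Ornt-++ (keep o) p = keep (Ornt-++ o p)
  Ornt-++ (flip o) p = flip (Ornt-++ o p)

  ≃-flip : ∀ {u v E} → (u , v) ∷ E ≃ (v , u) ∷ E
  ≃-flip {u} {v} = record
    { ≃cut = λ A → cong (λ b → bit b + _) (xor-comm (A u) (A v))
    ; ≃len = refl
    ; ≃or  = λ { (keep o) → _ , flip o , λ A → refl ; (flip o) → _ , keep o , λ A → refl } }

  pick : ∀ E A → 0 < cut E A →
         ∃ λ u → ∃ λ v → ∃ λ F → A u ≡ true × A v ≡ false × E ≃ (u , v) ∷ F
  pick ((u , v) ∷ E) A 0<c with A u in a | A v in b
  ... | true  | false = u , v , E , a , b , ≃-refl
  ... | false | true  = v , u , E , b , a , ≃-flip
  ... | true  | true  = let x , y , F , p , q , eq = pick E A 0<c in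
                        x , y , _ ∷ F , p , q , ≃-trans (≃-cons _ eq) ≃-swap
  ... | false | false = let x , y , F , p , q , eq = pick E A 0<c in
                        x , y , _ ∷ F , p , q , ≃-trans (≃-cons _ eq) ≃-swap

  record Split (A : PSet) (E : List Edge) : Set where
    field
      inn out : List Edge
      inn-in  : All (λ e → A (proj₁ e) ≡ true × A (proj₂ e) ≡ true) inn
      out-out : All (λ e → A (proj₁ e) ∧ A (proj₂ e) ≡ false) out
      splits  : E ≃ inn ++ out

  split : ∀ A E → Split A E
  split A [] = record { inn = [] ; out = [] ; inn-in = [] ; out-out = [] ; splits = ≃-refl }
  split A ((u , v) ∷ E) with split A E | A u in a | A v in b
  ... | s | true  | true  = record
    { inn = (u , v) ∷ Split.inn s ; out = Split.out s ; inn-in = (a , b) ∷ Split.inn-in s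
    ; out-out = Split.out-out s ; splits = ≃-cons _ (Split.splits s) }
  ... | s | true  | false = record
    { inn = Split.inn s ; out = (u , v) ∷ Split.out s ; inn-in = Split.inn-in s
    ; out-out = cong₂ _∧_ a b ∷ Split.out-out s
    ; splits = ≃-trans (≃-cons _ (Split.splits s)) (≃-shift _ (Split.inn s)) }
  ... | s | false | _ = record
    { inn = Split.inn s ; out = (u , v) ∷ Split.out s ; inn-in = Split.inn-in s
    ; out-out = cong (_∧ A v) a ∷ Split.out-out s
    ; splits = ≃-trans (≃-cons _ (Split.splits s)) (≃-shift _ (Split.inn s)) }

  infix 4 _≋_
  -- Reordering of directed edges, expressed by what an instance observes of them: cuts, net degrees
  -- and properties shared by all edges.
  record _≋_ (R S : List Edge) : Set₁ where
    field
      ≋cut : ∀ A → cut R A ≡ cut S A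
      ≋net : ∀ A → net R A ≡ net S A
      ≋all : ∀ {P : Edge → Set} → All P R → All P S
  open _≋_ public

  ≋-refl : ∀ {R} → R ≋ R
  ≋-refl = record { ≋cut = λ A → refl ; ≋net = λ A → refl ; ≋all = id }

  ≋-bubble : ∀ {f e R S} → R ≋ e ∷ S → f ∷ R ≋ e ∷ f ∷ S
  ≋-bubble {u , v} {x , y} {S = S} p = record
    { ≋cut = λ A → trans (cong (bit (A u xor A v) +_) (≋cut p A))
        (swapℕ (bit (A u xor A v)) (bit (A x xor A y)) (cut S A))
    ; ≋net = λ A → trans (cong ((i (A v) -ᶻ i (A u)) +ᶻ_) (≋net p A))
        (swapℤ (i (A v) -ᶻ i (A u)) (i (A y) -ᶻ i (A x)) (net S A))
    ; ≋all = λ { (q ∷ qs) → let r = ≋all p qs in All.head r ∷ q ∷ All.tail r } }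

  -- If no edge leaves A, every crossing edge enters it and adds 1 to the net degree, which is then
  -- the whole cut.
  pickOut : ∀ R A → (∃₂ λ u w → ∃ λ S → A u ≡ true × A w ≡ false × R ≋ (u , w) ∷ S) ⊎ net R A ≡ pos (cut R A)
  pickOut [] A = inj₂ refl
  pickOut ((u , v) ∷ R) A with A u in a | A v in b | pickOut R A
  ... | true  | false | _ = inj₁ (u , v , R , a , b , ≋-refl)
  ... | true  | true  | inj₁ (x , y , S , p , q , eq) = inj₁ (x , y , _ ∷ S , p , q , ≋-bubble eq)
  ... | false | true  | inj₁ (x , y , S , p , q , eq) = inj₁ (x , y , _ ∷ S , p , q , ≋-bubble eq)
  ... | false | false | inj₁ (x , y , S , p , q , eq) = inj₁ (x , y , _ ∷ S , p , q , ≋-bubble eq)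
  ... | true  | true  | inj₂ eq = inj₂ (trans (ℤ.+-identityˡ _) eq)
  ... | false | true  | inj₂ eq = inj₂ (cong (pos 1 +ᶻ_) eq)
  ... | false | false | inj₂ eq = inj₂ (trans (ℤ.+-identityˡ _) eq)

  pickDir : ∀ R A → 0 < cut R A →
            ∃₂ λ u w → ∃ λ S → A u ≡ true × A w ≡ false × (R ≋ (u , w) ∷ S ⊎ R ≋ (w , u) ∷ S)
  pickDir ((u , v) ∷ R) A 0<c with A u in a | A v in b
  ... | true  | false = u , v , R , a , b , inj₁ ≋-refl
  ... | false | true  = v , u , R , b , a , inj₂ ≋-refl
  ... | true  | true  = let x , y , S , p , q , eq = pickDir R A 0<c in
                        x , y , _ ∷ S , p , q , Sum.map ≋-bubble ≋-bubble eq
  ... | false | false = let x , y , S , p , q , eq = pickDir R A 0<c in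
                        x , y , _ ∷ S , p , q , Sum.map ≋-bubble ≋-bubble eq

  -- Sets are functions and pointwise equality does not make them equal; the search runs over subset
  -- vectors and `resp` carries the answer back.
  searchSet : {P : PSet → Set} → (∀ A → Dec (P A)) → (∀ {A B} → A ≐ B → P A → P B) →
              (∃ P) ⊎ (∀ A → ¬ P A)
  searchSet {P} P? resp with anySubset? (λ s → P? (lookup s))
  ... | yes (s , p) = inj₁ (lookup s , p)
  ... | no ¬p = inj₂ λ A p → ¬p (tabulate A , resp (λ x → sym (lookup∘tabulate A x)) p)

  size≤N : ∀ {n} (f : Fin n → Bool) → ∑ (bit ∘ f) ≤ n
  size≤N {zero}  f = z≤n
  size≤N {suc n} f with f zero
  ... | true  = s≤s (size≤N (f ∘ suc))
  ... | false = ℕ.m≤n⇒m≤1+n (size≤N (f ∘ suc))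

  _⊆?_ : ∀ (A B : PSet) → Dec (A ⊆ B)
  A ⊆? B = Fin.all? λ x → (A x ≟ᵇ true) →-dec (B x ≟ᵇ true)

  outside? : ∀ (A B : PSet) → Dec (∃ λ x → B x ≡ true × A x ≡ false)
  outside? A B = Fin.any? λ x → (B x ≟ᵇ true) ×-dec (A x ≟ᵇ false)

  ≡true∨false : ∀ b → b ≡ true ⊎ b ≡ false
  ≡true∨false true  = inj₁ refl
  ≡true∨false false = inj₂ refl

  -- Each enlargement raises `size`, which is at most `N`; the difference is the fuel.
  maximalSet : {P : PSet → Set} → (∀ A → Dec (P A)) → (∀ {A B} → A ≐ B → P A → P B) → ∀ A → P A →
               ∃ λ B → A ⊆ B × P B × (∀ C → B ⊆ C → P C → C ⊆ B)
  maximalSet {P} P? resp A pA = go (suc N) A pA (ℕ.m≤m+n (suc N) (size A))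
    where
    go : ∀ fuel A → P A → suc N ≤ fuel + size A → ∃ λ B → A ⊆ B × P B × (∀ C → B ⊆ C → P C → C ⊆ B)
    go zero       A pA le = ⊥-elim (ℕ.<⇒≱ le (size≤N A))
    go (suc fuel) A pA le
      with searchSet {λ C → A ⊆ C × P C × ∃ λ x → C x ≡ true × A x ≡ false}
             (λ C → (A ⊆? C) ×-dec (P? C ×-dec outside? A C))
             (λ eq (s , p , x , c , a) → (λ y q → trans (sym (eq y)) (s y q)) , resp eq p , x , trans
                 (sym (eq x)) c , a)
    ... | inj₂ none = A , (λ _ p → p) , pA , λ C A⊆C pC x c → case A⊆C pC x c
      where
      case : ∀ {C} → A ⊆ C → P C → ∀ x → C x ≡ true → A x ≡ true
      case {C} A⊆C pC x c with ≡true∨false (A x)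
      ... | inj₁ a = a
      ... | inj₂ a = ⊥-elim (none C (A⊆C , pC , x , c , a))
    ... | inj₁ (C , A⊆C , pC , x , c , a) with go fuel C pC
        (ℕ.≤-trans le (ℕ.≤-trans (ℕ.≤-reflexive (sym (ℕ.+-suc fuel (size A))))
        (ℕ.+-monoʳ-≤ fuel (size-mono-< A⊆C x a c))))
    ... | B , C⊆B , pB , mx = B , (λ y p → C⊆B y (A⊆C y p)) , pB , mx

  Ornt-refl : ∀ E → Ornt E E
  Ornt-refl []      = []
  Ornt-refl (e ∷ E) = keep (Ornt-refl E)

  only⇒≐ : ∀ {V : PSet} {p} → (∀ q → V q ≡ true → q ≡ p) → ∀ v → V v ≡ true → V ≐ δ v
  only⇒≐ {V} only v Vv x with δ v x in dx
  ... | true  = subst (λ y → V y ≡ true) (sym (δ-true {v} {x} dx)) Vv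
  ... | false = ¬true⇒false λ Vx → clash dx (subst (λ y → δ v y ≡ true) (trans (only v Vv) (sym (only x Vx)))
      (δ-refl v))

  All⇒cut≡0 : ∀ {A B : PSet} b → (∀ x → A x ≡ true → B x ≡ b) → ∀ {E} →
              All (λ e → A (proj₁ e) ≡ true × A (proj₂ e) ≡ true) E → cut E B ≡ 0
  All⇒cut≡0 b f [] = refl
  All⇒cut≡0 {A} {B} b f {(u , v) ∷ E} ((p , q) ∷ ps) rewrite f u p | f v q | All⇒cut≡0 {A} {B} b f ps with b
  ... | true  = refl
  ... | false = refl

  cut≡0⇒net≡0 : ∀ D B → cut D B ≡ 0 → net D B ≡ pos 0
  cut≡0⇒net≡0 []            B eq = refl
  cut≡0⇒net≡0 ((u , v) ∷ D) B eq with B u | B v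
  ... | true  | true  = trans (ℤ.+-identityˡ _) (cut≡0⇒net≡0 D B eq)
  ... | false | false = trans (ℤ.+-identityˡ _) (cut≡0⇒net≡0 D B eq)

  net-comm : ∀ D D′ B → net (D ++ D′) B ≡ net (D′ ++ D) B
  net-comm D D′ B = trans (net-++ D D′ B) (trans (ℤ.+-comm (net D B) (net D′ B)) (sym (net-++ D′ D B)))

  -- The vertex type stays the same: A collapses to its member r, and `shrunk` is V without A but
  -- with r. A set B after the contraction stands for B ∘ κ before it, which contains A or avoids
  -- it.
  module Contract {V A : PSet} {r : X} (A⊆V : A ⊆ V) (Ar : A r ≡ true) where
    κ : X → X
    κ x = if A x then r else x

    κ-in : ∀ {x} → A x ≡ true → κ x ≡ r
    κ-in eq rewrite eq = refl

    κ-out : ∀ {x} → A x ≡ false → κ x ≡ x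
    κ-out eq rewrite eq = refl

    shrunk : PSet
    shrunk x = (V x ∧ not (A x)) ∨ δ r x

    δr⇒A : ∀ {x} → δ r x ≡ true → A x ≡ true
    δr⇒A {x} d = subst (λ y → A y ≡ true) (sym (δ-true {r} {x} d)) Ar

    shrunk-r : shrunk r ≡ true
    shrunk-r rewrite Ar | A⊆V r Ar = δ-refl r

    shrunk-out : ∀ {x} → A x ≡ false → shrunk x ≡ V x
    shrunk-out {x} a with V x | δ r x in d
    ... | true  | _ rewrite a = refl
    ... | false | false = refl
    ... | false | true  = clash a (δr⇒A {x} d)

    shrunk-in : ∀ {x} → A x ≡ true → shrunk x ≡ true → x ≡ r
    shrunk-in {x} a s with V x | δ r x in d
    ... | _     | true  = δ-true {r} {x} d
    ... | true  | false rewrite a = ⊥-elim (false≢true s)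
    ... | false | false = ⊥-elim (false≢true s)

    shrunk-⊆ : shrunk ⊆ V
    shrunk-⊆ x s with A x in a
    ... | true  = A⊆V x a
    ... | false with V x | δ r x in d
    ... | true  | _     = refl
    ... | false | true  = clash a (δr⇒A {x} d)
    ... | false | false = s

    shrunk-κ : ∀ x → shrunk (κ x) ≡ V x
    shrunk-κ x with ≡true∨false (A x)
    ... | inj₁ a rewrite κ-in a = trans shrunk-r (sym (A⊆V x a))
    ... | inj₂ a rewrite κ-out a = shrunk-out a

    pull-⊆ : ∀ {B} → B ⊆ shrunk → (B ∘ κ) ⊆ V
    pull-⊆ B⊆ x b = trans (sym (shrunk-κ x)) (B⊆ (κ x) b)

    pull-self : ∀ {B : PSet} {b} x → shrunk x ≡ true → B x ≡ b → B (κ x) ≡ b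
    pull-self x s b with ≡true∨false (A x)
    ... | inj₁ a rewrite κ-in a = trans (cong _ (sym (shrunk-in a s))) b
    ... | inj₂ a rewrite κ-out a = b

    δκ-out : ∀ {v} → A v ≡ false → ∀ x → δ v (κ x) ≡ δ v x
    δκ-out {v} av x with ≡true∨false (A x)
    ... | inj₂ a rewrite κ-out a = refl
    ... | inj₁ a rewrite κ-in a = trans (δ-false {v} {r} λ { refl → clash av Ar })
        (sym (δ-false {v} {x} λ { refl → clash av a }))

    δκ-r : ∀ x → δ r (κ x) ≡ A x
    δκ-r x with ≡true∨false (A x)
    ... | inj₁ a rewrite κ-in a = trans (δ-refl r) (sym a)
    ... | inj₂ a rewrite κ-out a = trans (δ-false {r} {x} λ { refl → clash a Ar }) (sym a)

  _⊕_≐_ : PSet → PSet → PSet → Set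
  A ⊕ B ≐ C = ∀ x → bit (C x) ≡ bit (A x) + bit (B x)

  tok-⊕ : ∀ {A B C} → A ⊕ B ≐ C → ∀ Q → tok Q C ≡ tok Q A + tok Q B
  tok-⊕ p []      = refl
  tok-⊕ {A} {B} p (q ∷ Q) rewrite p q | tok-⊕ p Q = +-interchange (bit (A q)) (bit (B q)) (tok Q A) (tok Q B)

  net-⊕ : ∀ {A B C} → A ⊕ B ≐ C → ∀ D → net D C ≡ net D A +ᶻ net D B
  net-⊕ p []            = refl
  net-⊕ {A} {B} p ((u , v) ∷ D) rewrite p u | p v | net-⊕ p D | ℤ.pos-+ (bit (A u)) (bit (B u)) | ℤ.pos-+ (bit (A v))
      (bit (B v)) =
    lem (i (A v)) (i (B v)) (i (A u)) (i (B u)) (net D A) (net D B)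
    where
    lem : ∀ a b c d e f → ((a +ᶻ b) -ᶻ (c +ᶻ d)) +ᶻ (e +ᶻ f) ≡ ((a -ᶻ c) +ᶻ e) +ᶻ ((b -ᶻ d) +ᶻ f)
    lem = ℤ-Solver.solve-∀

  -- Additivity fails only at an edge between A and B, and such an edge has both ends in C.
  cutR-⊕ : ∀ {A B C} → A ⊕ B ≐ C → ∀ {R} → All (λ e → C (proj₁ e) ∧ C (proj₂ e) ≡ false) R →
      cut R C ≡ cut R A + cut R B
  cutR-⊕ p [] = refl
  cutR-⊕ {A} {B} {C} p {(u , v) ∷ R} (q ∷ qs) rewrite cutR-⊕ {A} {B} {C} p qs = trans
      (cong (_+ (cut R A + cut R B)) (bits {A u} {A v} {B u} {B v} (p u) (p v) q))
      (+-interchange (bit (A u xor A v)) (bit (B u xor B v)) (cut R A) (cut R B))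
    where
    bits : ∀ {a a′ b b′ c c′} → bit c ≡ bit a + bit b → bit c′ ≡ bit a′ + bit b′ → c ∧ c′ ≡ false →
        bit (c xor c′) ≡ bit (a xor a′) + bit (b xor b′)
    bits {false} {false} {false} {false} {false} {false} _ _ _ = refl
    bits {true}  {false} {false} {false} {true}  {false} _ _ _ = refl
    bits {false} {false} {true}  {false} {true}  {false} _ _ _ = refl
    bits {false} {true}  {false} {false} {false} {true}  _ _ _ = refl
    bits {false} {false} {false} {true}  {false} {true}  _ _ _ = refl

  -- As no edge crosses C, the edges leaving A are exactly those that end in B.
  cutE-⊕ : ∀ {A B C} → A ⊕ B ≐ C → ∀ E → cut E C ≡ 0 → cut E A ≡ cut E B
  cutE-⊕ p [] eq = refl
  cutE-⊕ {A} {B} {C} p ((u , v) ∷ E) eq = cong₂ _+_ (bits {A u} {A v} {B u} {B v} (p u) (p v) (ℕ.m+n≡0⇒m≡0 _ eq))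
      (cutE-⊕ p E (ℕ.m+n≡0⇒n≡0 (bit (C u xor C v)) eq))
    where
    bits : ∀ {a a′ b b′ c c′} → bit c ≡ bit a + bit b → bit c′ ≡ bit a′ + bit b′ → bit (c xor c′) ≡ 0 →
        bit (a xor a′) ≡ bit (b xor b′)
    bits {false} {false} {false} {false} {false} {false} _ _ _ = refl
    bits {true}  {true}  {false} {false} {true}  {true}  _ _ _ = refl
    bits {true}  {false} {false} {true}  {true}  {true}  _ _ _ = refl
    bits {false} {true}  {true}  {false} {true}  {true}  _ _ _ = refl
    bits {false} {false} {true}  {true}  {true}  {true}  _ _ _ = refl

  _∖_ : PSet → X → PSet
  (A ∖ v) x = A x ∧ not (δ v x)

  ∖-⊕ : ∀ {A v} → A v ≡ true → δ v ⊕ (A ∖ v) ≐ A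
  ∖-⊕ {A} {v} Av x with δ v x in d
  ... | true rewrite δ-true {v} {x} d | Av = refl
  ... | false with A x
  ... | true  = refl
  ... | false = refl

  ∖-⊆ : ∀ {A v} → (A ∖ v) ⊆ A
  ∖-⊆ {A} x p with A x
  ... | true = refl
  ... | false = p

  ∖-≢ : ∀ {A v x} → (A ∖ v) x ≡ true → x ≢ v
  ∖-≢ {A} {v} p refl with A v
  ... | true rewrite δ-refl v = false≢true p
  ... | false = false≢true p

  ∖-self : ∀ A v → (A ∖ v) v ≡ false
  ∖-self A v = ¬true⇒false λ p → ∖-≢ {A} {v} p refl

  ∖-in : ∀ {A v x} → A x ≡ true → x ≢ v → (A ∖ v) x ≡ true
  ∖-in {A} {v} {x} a ne rewrite a | δ-false {v} {x} ne = refl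

  ⁅_,_⁆ : X → X → PSet
  ⁅ u , v ⁆ x = δ u x ∨ δ v x

  pair-⊕ : ∀ {u v} → u ≢ v → δ u ⊕ δ v ≐ ⁅ u , v ⁆
  pair-⊕ {u} {v} ne x with δ u x in p | δ v x in q
  ... | true | true = ⊥-elim (ne (trans (sym (δ-true {u} {x} p)) (δ-true {v} {x} q)))
  ... | true | false = refl
  ... | false | true = refl
  ... | false | false = refl

  turn : ∀ {u v E D} B (inward : Bool) → B u xor B v ≡ true → Ornt E D →
         ∃ λ D′ → Ornt ((u , v) ∷ E) D′ × net D′ B ≡ (if inward then pos 1 else ℤ.-[1+ 0 ]) +ᶻ net D B
  turn {u} {v} {D = D} B inward cr o with B u in bu | B v in bv | inward | cr
  ... | true  | false | true  | _ = _ , flip o , cong₂ (λ x y → (i x -ᶻ i y) +ᶻ net D B) bu bv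
  ... | true  | false | false | _ = _ , keep o , cong₂ (λ x y → (i x -ᶻ i y) +ᶻ net D B) bv bu
  ... | false | true  | true  | _ = _ , keep o , cong₂ (λ x y → (i x -ᶻ i y) +ᶻ net D B) bv bu
  ... | false | true  | false | _ = _ , flip o , cong₂ (λ x y → (i x -ᶻ i y) +ᶻ net D B) bu bv
  ... | true  | true  | _     | ()
  ... | false | false | _     | ()

  -- Of the crossing edges, c are directed into B and count +1; the others are directed out and
  -- count -1.
  orient-cut : ∀ E B c → c ≤ cut E B → ∃ λ D → Ornt E D × net D B ≡ (pos c +ᶻ pos c) -ᶻ pos (cut E B)
  orient-cut [] B zero z≤n = [] , [] , refl
  orient-cut ((u , v) ∷ E) B c le with B u xor B v in cr
  ... | false = let D , o , eq = orient-cut E B c le in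
    _ , keep {e = u , v} o , trans (cong (_+ᶻ net D B) (level (B u) (B v) cr)) (trans (ℤ.+-identityˡ _) eq)
    where
    level : ∀ x y → x xor y ≡ false → i y -ᶻ i x ≡ pos 0
    level true  true  _ = refl
    level false false _ = refl
  orient-cut ((u , v) ∷ E) B zero le | true =
    let D , o , eq = orient-cut E B zero z≤n ; D′ , o′ , eq′ = turn B false cr o in
    D′ , o′ , trans eq′ (trans (cong (ℤ.-[1+ 0 ] +ᶻ_) eq)
        (trans (lem (pos (cut E B))) (cong (λ x → pos 0 -ᶻ x) (sym (ℤ.pos-+ 1 (cut E B))))))
    where
    lem : ∀ x → ℤ.-[1+ 0 ] +ᶻ ((pos 0 +ᶻ pos 0) -ᶻ x) ≡ pos 0 -ᶻ (pos 1 +ᶻ x)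
    lem = ℤ-Solver.solve-∀
  orient-cut ((u , v) ∷ E) B (suc c) (s≤s le) | true =
    let D , o , eq = orient-cut E B c le ; D′ , o′ , eq′ = turn B true cr o in
    D′ , o′ , trans eq′ (trans (cong (pos 1 +ᶻ_) eq) (trans (lem (pos (cut E B)) (pos c))
      (cong₂ (λ x y → (x +ᶻ x) -ᶻ y) (sym (ℤ.pos-+ 1 c)) (sym (ℤ.pos-+ 1 (cut E B))))))
    where
    lem : ∀ x c → pos 1 +ᶻ ((c +ᶻ c) -ᶻ x) ≡ ((pos 1 +ᶻ c) +ᶻ (pos 1 +ᶻ c)) -ᶻ (pos 1 +ᶻ x)
    lem = ℤ-Solver.solve-∀

  balance : ∀ E B → 2 ∣ cut E B → ∃ λ D → Ornt E D × net D B ≡ pos 0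
  balance E B (divides q eq) = let D , o , net≡ = orient-cut E B q (subst (q ≤_) (sym c≡) (ℕ.m≤m+n q q)) in
    D , o , trans net≡ (trans (cong₂ _-ᶻ_ (sym (ℤ.pos-+ q q)) (cong pos c≡)) (ℤ.+-inverseʳ (pos (q + q))))
    where
    c≡ : cut E B ≡ q + q
    c≡ = trans eq (trans (ℕ.*-comm q 2) (cong (q +_) (ℕ.+-identityʳ q)))

  net-nonpositive : ∀ D (V : PSet) → (∀ v → V v ≡ true → net D (δ v) ≤ᶻ pos 0) → ∀ m B → B ⊆ V → size B < m →
      net D B ≤ᶻ pos 0
  net-nonpositive D V ≤0 (suc m) B B⊆V sz with Fin.any? (λ p → B p ≟ᵇ true)
  ... | no none = ℤ.≤-reflexive (trans (net-ext {B} {λ _ → false} (λ x → ¬true⇒false λ Bx → none (x , Bx)) D)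
      (net-∅ D))
    where
    net-∅ : ∀ D → net D (λ _ → false) ≡ pos 0
    net-∅ []      = refl
    net-∅ (e ∷ D) = trans (ℤ.+-identityˡ _) (net-∅ D)
  ... | yes (p , Bp) = ℤ.≤-trans (ℤ.≤-reflexive (net-⊕ {δ p} {B ∖ p} {B} (∖-⊕ {B} Bp) D))
    (ℤ.+-mono-≤ (≤0 p (B⊆V p Bp)) (net-nonpositive D V ≤0 m (B ∖ p) (λ x b → B⊆V x (∖-⊆ {B} x b))
      (ℕ.<-≤-trans (size-mono-< (∖-⊆ {B}) p (∖-self B p) Bp) (ℕ.≤-pred sz))))

-- A linear inequality from one identity that the ring solver can check.
lin : ∀ {a b x y} s → x ≤ y → b + x ≡ a + y + s → a ≤ b
lin {a} {b} {x} {y} s x≤y eq = ℕ.+-cancelʳ-≤ x a b (begin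
  a + x     ≤⟨ ℕ.+-monoʳ-≤ a x≤y ⟩
  a + y     ≤⟨ ℕ.m≤m+n (a + y) s ⟩
  a + y + s ≡⟨ sym eq ⟩
  b + x     ∎)
  where open ℕ.≤-Reasoning

-- Residues and integer congruences modulo `L`.

module Mod (h : ℕ) where

  -- With k = h + 1 these are 2k - 1, 2k and the density threshold 2L - 2. The Eulerian case takes h
  -- = 0, that is L = K = 2.
  L₁ L K : ℕ
  L₁ = suc (h + h)
  L  = suc L₁
  K  = L₁ + L₁

  2∣L : 2 ∣ L
  2∣L = divides (suc h) (eq h)
    where
    eq : ∀ h → suc (suc (h + h)) ≡ suc h * 2
    eq = ℕ-Solver.solve-∀

  2∣K : 2 ∣ K
  2∣K = divides L₁ (eq L₁)
    where
    eq : ∀ h → h + h ≡ h * 2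
    eq = ℕ-Solver.solve-∀

  %≤L₁ : ∀ t → t % L ≤ L₁
  %≤L₁ t = ℕ.≤-pred (m%n<n t L)

  K≤2L : ∀ q → K ≤ suc (suc q) * L
  K≤2L q = ℕ.+-mono-≤ (ℕ.n≤1+n L₁) (ℕ.≤-trans (ℕ.n≤1+n L₁) (ℕ.m≤m+n L (q * L)))

  multiple≥K : ∀ {x} → L ∣ x → L < x → K ≤ x
  multiple≥K (divides zero          refl) ()
  multiple≥K (divides (suc zero)    refl) lt = ⊥-elim (ℕ.<-irrefl (sym (ℕ.*-identityˡ L)) lt)
  multiple≥K (divides (suc (suc q)) refl) lt = K≤2L q

  2∣-% : ∀ x t → 2 ∣ x + t → 2 ∣ x + t % L
  2∣-% x t p = ∣m+n∣m⇒∣n (subst (2 ∣_) eq p) (∣-trans 2∣L (n∣m*n (t / L)))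
    where
    eq : x + t ≡ t / L * L + (x + t % L)
    eq = trans (cong (x +_) (m≡m%n+[m/n]*n t L)) (lem x (t % L) (t / L * L))
      where
      lem : ∀ a b c → a + (b + c) ≡ c + (a + b)
      lem = ℕ-Solver.solve-∀

  suc-%-top : ∀ t → t % L ≡ L₁ → suc t % L ≡ 0
  suc-%-top t eq = trans (cong (λ s → suc s % L) (trans (m≡m%n+[m/n]*n t L) (cong (_+ t / L * L) eq)))
                         (trans ([m+kn]%n≡m%n L (t / L) L)
                             (trans (cong (_% L) (sym (ℕ.+-identityʳ L))) (trans ([m+kn]%n≡m%n 0 1 L) refl)))

  suc-%-lo : ∀ t → t % L ≢ L₁ → suc t % L ≡ suc (t % L)
  suc-%-lo t ne = trans (cong (λ s → suc s % L) (m≡m%n+[m/n]*n t L))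
                  (trans ([m+kn]%n≡m%n (suc (t % L)) (t / L) L) (m<n⇒m%n≡m (s≤s (ℕ.≤∧≢⇒< (%≤L₁ t) ne))))

  suc-%-≤ : ∀ t → suc t % L ≤ suc (t % L)
  suc-%-≤ t with t % L ℕ.≟ L₁
  ... | yes eq = subst (_≤ suc (t % L)) (sym (suc-%-top t eq)) z≤n
  ... | no ne  = ℕ.≤-reflexive (suc-%-lo t ne)

  -- `L ∸ b + a` represents a - b modulo L. Residues are subadditive, with equality when nothing
  -- wraps around (`shift-≡`).
  shift-≥ : ∀ b a → b ≤ L → a % L ≤ b + (L ∸ b + a) % L
  shift-≥ b a b≤L = ℕ.≤-trans (ℕ.≤-reflexive eq) (m%n≤m (b + c % L) L)
    where
    c = L ∸ b + a
    eq : a % L ≡ (b + c % L) % L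
    eq = begin
      a % L                   ≡⟨ sym ([m+n]%n≡m%n a L) ⟩
      (a + L) % L             ≡⟨ cong (_% L) (trans (ℕ.+-comm a L)
          (trans (cong (_+ a) (sym (ℕ.m+[n∸m]≡n b≤L))) (ℕ.+-assoc b (L ∸ b) a))) ⟩
      (b + c) % L             ≡⟨ cong (λ s → (b + s) % L) (m≡m%n+[m/n]*n c L) ⟩
      (b + (c % L + c / L * L)) % L ≡⟨ cong (_% L) (sym (ℕ.+-assoc b (c % L) _)) ⟩
      (b + c % L + c / L * L) % L ≡⟨ [m+kn]%n≡m%n (b + c % L) (c / L) L ⟩
      (b + c % L) % L ∎
      where open ≡-Reasoning

  shift-≡ : ∀ b a → b ≤ a % L → b + (L ∸ b + a) % L ≡ a % L
  shift-≡ b a b≤r = trans (cong (b +_) eq) (ℕ.m+[n∸m]≡n b≤r)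
    where
    r = a % L
    b≤L : b ≤ L
    b≤L = ℕ.≤-trans b≤r (ℕ.<⇒≤ (m%n<n a L))
    lem : L ∸ b + a ≡ (r ∸ b) + suc (a / L) * L
    lem = ℕ.+-cancelˡ-≡ b _ _ (begin
      b + (L ∸ b + a)  ≡⟨ sym (ℕ.+-assoc b _ a) ⟩
      b + (L ∸ b) + a  ≡⟨ cong₂ _+_ (ℕ.m+[n∸m]≡n b≤L) (m≡m%n+[m/n]*n a L) ⟩
      L + (r + a / L * L) ≡⟨ ℕ-lem L r (a / L * L) ⟩
      r + (L + a / L * L) ≡⟨ cong (_+ (L + a / L * L)) (sym (ℕ.m+[n∸m]≡n b≤r)) ⟩
      b + (r ∸ b) + suc (a / L) * L ≡⟨ ℕ.+-assoc b _ _ ⟩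
      b + (r ∸ b + suc (a / L) * L) ∎)
      where
      open ≡-Reasoning
      ℕ-lem : ∀ x y z → x + (y + z) ≡ y + (x + z)
      ℕ-lem = ℕ-Solver.solve-∀
    eq : (L ∸ b + a) % L ≡ r ∸ b
    eq = trans (cong (_% L) lem) (trans ([m+kn]%n≡m%n (r ∸ b) (suc (a / L)) L)
         (m<n⇒m%n≡m (ℕ.≤-<-trans (ℕ.m∸n≤m r b) (m%n<n a L))))

  Cong : ℤ → ℕ → Set
  Cong a t = ∃ λ c → a ≡ pos t +ᶻ c *ᶻ pos L

  -- Bounded from above only: a value congruent to 0 is then at most 0 (`balanced≤0`), and a
  -- nonnegative value is its own residue (`residue`).
  Good : ℤ → ℕ → Set
  Good a t = Cong a t × a ≤ᶻ pos L₁

  mult≤0 : ∀ c → c *ᶻ pos L ≤ᶻ pos L₁ → c *ᶻ pos L ≤ᶻ pos 0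
  mult≤0 (pos zero)    p = ℤ.≤-refl
  mult≤0 (pos (suc c)) p = ⊥-elim (ℕ.<⇒≱ (ℕ.n<1+n L₁)
      (ℕ.≤-trans (ℕ.m≤m+n L (c * L)) (ℤ.drop‿+≤+ (subst (_≤ᶻ pos L₁) (sym (ℤ.pos-* (suc c) L)) p))))
  mult≤0 ℤ.-[1+ c ]   p = ℤ.-≤+

  balanced≤0 : ∀ {a t} → Good a t → L ∣ t → a ≤ᶻ pos 0
  balanced≤0 {a} {t} ((c , eq) , le) (divides q refl) = subst (_≤ᶻ pos 0) (sym eq′)
      (mult≤0 (pos q +ᶻ c) (subst (_≤ᶻ pos L₁) eq′ le))
    where
    eq′ : a ≡ (pos q +ᶻ c) *ᶻ pos L
    eq′ = trans eq (trans (cong (_+ᶻ c *ᶻ pos L) (ℤ.pos-* q L)) (sym (ℤ.*-distribʳ-+ (pos L) (pos q) c)))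

  residue : ∀ {c t} → Cong (pos c) t → c ≤ L₁ → c ≡ t % L
  residue {c} {t} (q , eq) c≤ = trans (sym (m<n⇒m%n≡m (s≤s c≤))) (go q eq)
    where
    go : ∀ q → pos c ≡ pos t +ᶻ q *ᶻ pos L → c % L ≡ t % L
    go (pos q) eq = trans (cong (_% L) (ℤ.+-injective
        (trans eq (trans (cong (pos t +ᶻ_) (sym (ℤ.pos-* q L))) (sym (ℤ.pos-+ t (q * L)))))))
                          ([m+kn]%n≡m%n t q L)
    go ℤ.-[1+ q ] eq = sym (trans (cong (_% L) t≡) ([m+kn]%n≡m%n c (suc q) L))
      where
      t≡ : t ≡ c + suc q * L
      t≡ = ℤ.+-injective (begin
        pos t ≡⟨ lem (pos t) (pos (suc q)) (pos L) ⟩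
        (pos t +ᶻ neg (pos (suc q)) *ᶻ pos L) +ᶻ pos
            (suc q) *ᶻ pos L ≡⟨ cong₂ _+ᶻ_ (sym eq) (sym (ℤ.pos-* (suc q) L)) ⟩
        pos c +ᶻ pos (suc q * L) ≡⟨ sym (ℤ.pos-+ c _) ⟩
        pos (c + suc q * L) ∎)
        where
        open ≡-Reasoning
        lem : ∀ a b c → a ≡ (a +ᶻ neg b *ᶻ c) +ᶻ b *ᶻ c
        lem = ℤ-Solver.solve-∀

-- The orientation theorem

module Orientation (N : ℕ) (z : Fin N) (h : ℕ) where
  open Edges N public
  open Mod h public

  -- E holds the edges still to be directed, R the directed edges joining V to its complement, and
  -- the number of tokens of Q at v is the prescribed residue of the net in-degree of v.
  record Inst : Set where
    constructor inst
    field
      V : PSet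
      E R : List Edge
      Q : List X
  open Inst public

  deg : Inst → PSet → ℕ
  deg I B = cut (E I) B + cut (R I) B

  Φ : Inst → PSet → ℕ
  Φ I B = deg I B + tok (Q I) B % L

  Proper : Inst → PSet → Set
  Proper I B = B ⊆ V I × ∃ λ q → V I q ≡ true × B q ≡ false

  -- The net degree of V is already determined by `R`; `root` says that it is admissible. `root` and
  -- the upper bound `rootφ` are what a contracted set inherits when it becomes the vertex set of
  -- the inner instance, whereas density bounds Φ of proper subsets from below.
  record Base (I : Inst) : Set where
    field
      Vz   : V I z ≡ false
      noE  : cut (E I) (V I) ≡ 0
      rno  : All (λ e → V I (proj₁ e) ∧ V I (proj₂ e) ≡ false) (R I)
      par  : ∀ B → B ⊆ V I → 2 ∣ deg I B + tok (Q I) B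
      rootφ : Φ I (V I) ≤ K
      root : Good (net (R I) (V I)) (tok (Q I) (V I))

  -- The vertex v₀ is exempt from the density condition; v₀ = z means that no vertex is.
  Dense : Inst → X → Set
  Dense I v₀ = ∀ B → Proper I B → ∀ p → B p ≡ true → p ≢ v₀ → K ≤ Φ I B

  Exempt : Inst → X → Set
  Exempt I v₀ = V I v₀ ≡ true → L ∣ tok (Q I) (δ v₀)

  Hyp : Inst → X → Set
  Hyp I v₀ = Base I × Dense I v₀ × Exempt I v₀

  Sol : Inst → Set
  Sol I = ∃ λ D → Ornt (E I) D × ∀ v → V I v ≡ true → Good (net (D ++ R I) (δ v)) (tok (Q I) (δ v))

  outside-z : ∀ {V A : PSet} → V z ≡ false → A ⊆ V → A z ≡ false
  outside-z Vz A⊆V = ¬true⇒false λ az → clash Vz (A⊆V z az)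

  Good-resp : ∀ {a b t u} → a ≡ b → t ≡ u → Good a t → Good b u
  Good-resp refl refl g = g

  -- Contracting a set: the outer and the inner instance.

  module Contraction (I : Inst) {A : PSet} {r : X} (A⊆V : A ⊆ V I) (Ar : A r ≡ true) (s : Split A (E I)) where
    open Contract {V I} A⊆V Ar public
    open Split s public

    outer : Inst
    outer = inst (shrunk) (map (map² κ) out) (map (map² κ) (R I)) (map κ (Q I))

    -- B ∘ κ is constant on A, so no edge inside A crosses it.
    cutE-pull : ∀ B → cut (E I) (B ∘ κ) ≡ cut out (B ∘ κ)
    cutE-pull B = trans (≃cut splits (B ∘ κ)) (trans (cut-++ inn out (B ∘ κ))
      (cong (_+ cut out (B ∘ κ)) (All⇒cut≡0 {A} {B ∘ κ} (B r) (λ x a → cong B (κ-in a)) inn-in)))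

    deg-outer : ∀ B → deg outer B ≡ deg I (B ∘ κ)
    deg-outer B = cong₂ _+_ (trans (cut-map κ out B) (sym (cutE-pull B))) (cut-map κ (R I) B)

    Φ-outer : ∀ B → Φ outer B ≡ Φ I (B ∘ κ)
    Φ-outer B = cong₂ (λ x y → x + y % L) (deg-outer B) (tok-map κ (Q I) B)

    deg-ext : ∀ {A B} → A ≐ B → deg I A ≡ deg I B
    deg-ext eq = cong₂ _+_ (cut-ext eq (E I)) (cut-ext eq (R I))

    Φ-ext : ∀ {A B} → A ≐ B → Φ I A ≡ Φ I B
    Φ-ext eq = cong₂ (λ x y → x + y % L) (deg-ext eq) (tok-ext eq (Q I))

    outer-Base : Base I → Base outer
    outer-Base b = record
      { Vz = outside-z Vz shrunk-⊆
      ; noE = trans (cut-map κ out _) (trans (sym (cutE-pull (shrunk))) (trans (cut-ext Vκ (E I)) noE))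
      ; rno = All.map⁺ (All.map (λ {e} p → trans (cong₂ _∧_ (shrunk-κ (proj₁ e)) (shrunk-κ (proj₂ e))) p) rno)
      ; par = λ B B⊆ → subst (2 ∣_) (sym (cong₂ _+_ (deg-outer B) (tok-map κ (Q I) B))) (par (B ∘ κ) (pull-⊆ B⊆))
      ; rootφ = subst (_≤ K) (sym (trans (Φ-outer _) (Φ-ext Vκ))) rootφ
      ; root = Good-resp (sym (trans (net-map κ (R I) _) (net-ext Vκ (R I))))
          (sym (trans (tok-map κ (Q I) _) (tok-ext Vκ (Q I)))) root }
      where
      open Base b
      Vκ : (shrunk ∘ κ) ≐ V I
      Vκ = shrunk-κ

    outer-len : length (E outer) ≤ length (E I)
    outer-len = ℕ.≤-trans (ℕ.≤-reflexive (length-map _ out)) (ℕ.≤-trans (ℕ.m≤n+m (length out) (length inn))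
      (ℕ.≤-reflexive (sym (trans (≃len splits) (length-++ inn)))))

    outer-size : size (V outer) ≤ size (V I)
    outer-size = size-mono (shrunk-⊆)

    outer-size-< : ∀ x → A x ≡ true → x ≢ r → size (V outer) < size (V I)
    outer-size-< x a x≢r = size-mono-< (shrunk-⊆) x (¬true⇒false λ s → x≢r (shrunk-in a s)) (A⊆V x a)

    outer-cutR : cut (R outer) (V outer) ≡ cut (R I) (V I)
    outer-cutR = trans (cut-map κ (R I) _) (cut-ext (shrunk-κ) (R I))

    -- The edges not inside A, once directed, are boundary edges from the point of view of A and
    -- join `R`. Cuts ignore directions, so Φ is unchanged and density is inherited.
    inner : List Edge → Inst
    inner D = inst A inn (R I ++ D) (Q I)

    deg-inner : ∀ {D} → Ornt out D → ∀ B → deg (inner D) B ≡ deg I B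
    deg-inner {D} o B = begin
      cut inn B + cut (R I ++ D) B       ≡⟨ cong (cut inn B +_)
          (trans (cut-++ (R I) D B) (cong (cut (R I) B +_) (Ornt-cut o B))) ⟩
      cut inn B + (cut (R I) B + cut out B) ≡⟨ lem (cut inn B) (cut (R I) B) (cut out B) ⟩
      cut inn B + cut out B + cut (R I) B   ≡⟨ cong (_+ cut (R I) B)
          (sym (trans (≃cut splits B) (cut-++ inn out B))) ⟩
      deg I B ∎
      where
      open ≡-Reasoning
      lem : ∀ a b c → a + (b + c) ≡ a + c + b
      lem = ℕ-Solver.solve-∀

    Φ-inner : ∀ {D} → Ornt out D → ∀ B → Φ (inner D) B ≡ Φ I B
    Φ-inner o B = cong (_+ tok (Q I) B % L) (deg-inner o B)

    inner-noE : cut inn A ≡ 0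
    inner-noE = All⇒cut≡0 {A} {A} true (λ x a → a) inn-in

    ∧-mono : ∀ {a b c d} → (a ≡ true → c ≡ true) → (b ≡ true → d ≡ true) → c ∧ d ≡ false → a ∧ b ≡ false
    ∧-mono {true} {true} f g eq rewrite f refl | g refl = eq
    ∧-mono {true} {false} f g eq = refl
    ∧-mono {false} f g eq = refl

    inner-rno : ∀ {D} → Ornt out D → All (λ e → V I (proj₁ e) ∧ V I (proj₂ e) ≡ false) (R I) →
                All (λ e → A (proj₁ e) ∧ A (proj₂ e) ≡ false) (R I ++ D)
    inner-rno o p = All.++⁺ (All.map (λ {e} q → ∧-mono (A⊆V (proj₁ e)) (A⊆V (proj₂ e)) q) p) (go o out-out)
      where
      go : ∀ {E D} → Ornt E D → All (λ e → A (proj₁ e) ∧ A (proj₂ e) ≡ false) E →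
          All (λ e → A (proj₁ e) ∧ A (proj₂ e) ≡ false) D
      go [] [] = []
      go (keep o) (p ∷ ps) = p ∷ go o ps
      go (flip {u} {v} o) (p ∷ ps) = trans (∧-comm (A v) (A u)) p ∷ go o ps

    inner-Dense : ∀ {D v₀} → Ornt out D → Dense I v₀ → Dense (inner D) v₀
    inner-Dense o d B (B⊆ , y , Ay , By) p bp p≢ = subst (K ≤_) (sym (Φ-inner o B))
      (d B ((λ v bv → A⊆V v (B⊆ v bv)) , y , A⊆V y Ay , By) p bp p≢)

    -- Φ A ≤ K becomes `rootφ`, and the condition that the outer solution meets at the contracted
    -- vertex becomes `root`.
    inner-Base : ∀ {D} → Ornt out D → Base I → Φ I A ≤ K → Good (net (R I ++ D) A) (tok (Q I) A) → Base (inner D)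
    inner-Base o b le g = record
      { Vz = outside-z Vz A⊆V
      ; noE = inner-noE
      ; rno = inner-rno o rno
      ; par = λ B B⊆ → subst (λ t → 2 ∣ t + tok (Q I) B) (sym (deg-inner o B)) (par B (λ v bv → A⊆V v (B⊆ v bv)))
      ; rootφ = subst (_≤ K) (sym (Φ-inner o A)) le
      ; root = g }
      where open Base b

    pull-Proper : ∀ {B} → Proper outer B → Proper I (B ∘ κ)
    pull-Proper {B} (B⊆ , y , Vy , By) = pull-⊆ B⊆ , y , shrunk-⊆ y Vy , pull-self {B} y Vy By

    OuterSol : List Edge → Set
    OuterSol D = Ornt out D × Good (net (R I ++ D) A) (tok (Q I) A) ×
                 (∀ v → V I v ≡ true → A v ≡ false → Good (net (R I ++ D) (δ v)) (tok (Q I) (δ v)))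

    -- δ r ∘ κ is the indicator of A, so the net degree found at r is that of A in the original
    -- graph; outside A nothing changes.
    fromOuter : Sol outer → ∃ OuterSol
    fromOuter (D′ , o′ , g) with Ornt-map κ out o′
    ... | D , o , refl = D , o , 
      Good-resp (trans (pull (δ r)) (trans (net-ext δκ-r (D ++ R I)) (net-comm D (R I) A)))
          (trans (tok-map κ (Q I) _) (tok-ext δκ-r (Q I))) (g r (shrunk-r)) ,
      λ v Vv av → Good-resp (trans (pull (δ v)) (trans (net-ext (δκ-out av) (D ++ R I)) (net-comm D (R I) (δ v))))
          (trans (tok-map κ (Q I) _) (tok-ext (δκ-out av) (Q I)))
                    (g v (trans (shrunk-out av) Vv))
      where
      pull : ∀ B → net (map (map² κ) D ++ map (map² κ) (R I)) B ≡ net (D ++ R I) (B ∘ κ)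
      pull B = trans (cong (λ F → net F B) (sym (map-++ (map² κ) D (R I)))) (net-map κ (D ++ R I) B)

    inner-net-out : ∀ {Dᵢ} → Ornt inn Dᵢ → ∀ v → A v ≡ false → net Dᵢ (δ v) ≡ pos 0
    inner-net-out {Dᵢ} o v av = cut≡0⇒net≡0 Dᵢ (δ v) (trans (Ornt-cut o (δ v))
      (All⇒cut≡0 {A} {δ v} false (λ x a → δ-false {v} {x} λ { refl → clash av a }) inn-in))

    -- Edges inside A contribute 0 at vertices outside A, and at vertices of A the inner instance
    -- has already counted D.
    glue : ∀ {D} → Ornt out D → (∀ v → V I v ≡ true → A v ≡ false → Good (net (R I ++ D) (δ v)) (tok (Q I) (δ v))) →
           Sol (inner D) → Sol I
    glue {D} o g (Dᵢ , oᵢ , gᵢ) with ≃or splits (Ornt-++ oᵢ o)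
    ... | F , oF , nF = F , oF , final
      where
      eqn : ∀ B → net (F ++ R I) B ≡ net Dᵢ B +ᶻ net (R I ++ D) B
      eqn B = begin
        net (F ++ R I) B ≡⟨ net-++ F (R I) B ⟩
        net F B +ᶻ net (R I) B ≡⟨ cong (_+ᶻ net (R I) B) (trans (nF B) (net-++ Dᵢ D B)) ⟩
        (net Dᵢ B +ᶻ net D B) +ᶻ net (R I) B ≡⟨ lem (net Dᵢ B) (net D B) (net (R I) B) ⟩
        net Dᵢ B +ᶻ (net (R I) B +ᶻ net D B) ≡⟨ cong (net Dᵢ B +ᶻ_) (sym (net-++ (R I) D B)) ⟩
        net Dᵢ B +ᶻ net (R I ++ D) B ∎
        where
        open ≡-Reasoning
        lem : ∀ a b c → (a +ᶻ b) +ᶻ c ≡ a +ᶻ (c +ᶻ b)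
        lem = ℤ-Solver.solve-∀
      final : ∀ v → V I v ≡ true → Good (net (F ++ R I) (δ v)) (tok (Q I) (δ v))
      final v Vv with ≡true∨false (A v)
      ... | inj₁ av = Good-resp (trans (net-++ Dᵢ (R I ++ D) (δ v)) (sym (eqn (δ v)))) refl (gᵢ v av)
      ... | inj₂ av = Good-resp (sym (trans (eqn (δ v))
          (trans (cong (_+ᶻ net (R I ++ D) (δ v)) (inner-net-out oᵢ v av)) (ℤ.+-identityˡ _)))) refl (g v Vv av)

  Good-∣ : ∀ {a t u} → L ∣ t → Good a (t + u) → Good a u
  Good-∣ {a} {_} {u} (divides q refl) ((c , eq) , le) = (pos q +ᶻ c , eq′) , le
    where
    lem : ∀ x y z w → (x *ᶻ w +ᶻ y) +ᶻ z *ᶻ w ≡ y +ᶻ (x +ᶻ z) *ᶻ w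
    lem = ℤ-Solver.solve-∀
    eq′ : a ≡ pos u +ᶻ (pos q +ᶻ c) *ᶻ pos L
    eq′ = trans eq (trans (cong (_+ᶻ c *ᶻ pos L) (trans (ℤ.pos-+ (q * L) u) (cong (_+ᶻ pos u) (ℤ.pos-* q L))))
        (lem (pos q) (pos u) c (pos L)))

  Good-0 : ∀ {t} → L ∣ t → Good (pos 0) t
  Good-0 {t} d = Good-∣ {pos 0} {t} {t} d′ ((neg (pos (q + q)) , eq) , ℤ.+≤+ z≤n)
    where
    open _∣_ d using () renaming (quotient to q ; equality to t≡)
    d′ = d
    lem : ∀ x w → pos 0 ≡ (x *ᶻ w +ᶻ x *ᶻ w) +ᶻ neg (x +ᶻ x) *ᶻ w
    lem = ℤ-Solver.solve-∀
    eq : pos 0 ≡ pos (t + t) +ᶻ neg (pos (q + q)) *ᶻ pos L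
    eq = trans (lem (pos q) (pos L)) (cong₂ _+ᶻ_
           (sym (trans (ℤ.pos-+ t t) (cong (λ s → s +ᶻ s) (trans (cong pos t≡) (ℤ.pos-* q L)))))
           (cong (λ s → neg s *ᶻ pos L) (sym (ℤ.pos-+ q q))))

  Good-pred : ∀ {a t} → Good a (suc t) → Good (a -ᶻ pos 1) t
  Good-pred {a} {t} ((c , eq) , le) = (c , trans (cong (_-ᶻ pos 1) (trans eq (cong (_+ᶻ c *ᶻ pos L) (ℤ.pos-+ 1 t))))
      (lem (pos t) (c *ᶻ pos L)))
    , ℤ.≤-trans (ℤ.i≤j⇒i-k≤j {a} (pos 1) ℤ.≤-refl) le
    where
    lem : ∀ x y → ((pos 1 +ᶻ x) +ᶻ y) -ᶻ pos 1 ≡ x +ᶻ y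
    lem = ℤ-Solver.solve-∀

  Cong-suc : ∀ {a t} → Cong a t → Cong (pos 1 +ᶻ a) (suc t)
  Cong-suc {a} {t} (c , eq) = c , trans (cong (pos 1 +ᶻ_) eq)
      (trans (sym (ℤ.+-assoc (pos 1) (pos t) (c *ᶻ pos L))) (cong (_+ᶻ c *ᶻ pos L) (sym (ℤ.pos-+ 1 t))))

  reHyp : ∀ {V E F R S Q v₀} → E ≃ F → R ≋ S → Hyp (inst V E R Q) v₀ → Hyp (inst V F S Q) v₀
  reHyp {V} {E} {F} {R} {S} {Q} {v₀} p q (b , d , e) = record
    { Vz = Vz ; noE = trans (sym (≃cut p V)) noE ; rno = ≋all q rno
    ; par = λ B s → subst (λ x → 2 ∣ x + tok Q B) (deg≡ B) (par B s)
    ; rootφ = subst (λ x → x + tok Q V % L ≤ K) (deg≡ V) rootφ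
    ; root = Good-resp (≋net q V) refl root } ,
    (λ B pr x bx ne → subst (λ x → K ≤ x + tok Q B % L) (deg≡ B) (d B pr x bx ne)) , e
    where
    open Base b
    deg≡ : ∀ B → deg (inst V E R Q) B ≡ deg (inst V F S Q) B
    deg≡ B = cong₂ _+_ (≃cut p B) (≋cut q B)

  reSol : ∀ {V E F R S Q} → E ≃ F → R ≋ S → Sol (inst V F S Q) → Sol (inst V E R Q)
  reSol {V} {E} {F} {R} {S} {Q} p q (D , o , g) with ≃or p o
  ... | D′ , o′ , n = D′ , o′ , λ v Vv → Good-resp
      (sym (trans (net-++ D′ R (δ v)) (trans (cong₂ _+ᶻ_ (n (δ v)) (≋net q (δ v))) (sym (net-++ D S (δ v)))))) refl
      (g v Vv)

  Solve< : ℕ → Set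
  Solve< n = ∀ I v₀ → size (V I) < n → Hyp I v₀ → Sol I

  Solve≤ : ℕ → ℕ → ℕ → Set
  Solve≤ n m r = ∀ I v₀ → size (V I) ≤ n → length (E I) ≤ m → cut (R I) (V I) ≤ r → Hyp I v₀ → Sol I

  -- The directed edge (x , w) is given the source z, at the price of a token at x. This preserves Φ
  -- from below except at the tight sets, where the residue drops from L₁ to 0.
  module Op (V : PSet) (E R : List Edge) (Q : List X) (x w : X) where
    I I⁺ : Inst
    I  = inst V E ((x , w) ∷ R) Q
    I⁺ = inst V E ((z , w) ∷ R) (x ∷ Q)

    -- If B contains x but not w, one unit moves from the cut to the residue, unless the residue
    -- wraps from L₁ to 0; then the degree alone must still reach K after losing 1. If B contains
    -- both, the new edge crosses B additionally; this occurs when an edge inside V is redirected.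
    op-Φ : ∀ B → B z ≡ false → K ≤ Φ I B → (B x ≡ true → tok Q B % L ≡ L₁ → K < deg I B) → K ≤ Φ I⁺ B
    op-Φ B bz le noT with B x | B w | B z | tok Q B % L ℕ.≟ L₁
    ... | false | _     | false | _ = le
    ... | true  | false | false | yes e = ℕ.≤-trans (lin 0 (noT refl e) (lem K (cut E B) (cut R B))) (ℕ.m≤m+n _ _)
      where
      lem : ∀ k e r → (e + r) + suc k ≡ k + (e + suc r) + 0
      lem = ℕ-Solver.solve-∀
    ... | true  | true  | false | yes e = ℕ.≤-trans
        (ℕ.<⇒≤ (ℕ.≤-trans (noT refl e) (ℕ.+-monoʳ-≤ (cut E B) (ℕ.n≤1+n _)))) (ℕ.m≤m+n _ _)
    ... | true  | false | false | no ne = subst (K ≤_)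
        (trans (lem (cut E B) (cut R B) (tok Q B % L)) (cong (cut E B + cut R B +_) (sym (suc-%-lo (tok Q B) ne)))) le
      where
      lem : ∀ a b c → a + suc b + c ≡ a + b + suc c
      lem = ℕ-Solver.solve-∀
    ... | true  | true  | false | no ne = ℕ.≤-trans le
        (ℕ.≤-trans (ℕ.m≤n+m _ 2) (ℕ.≤-reflexive (trans (lem (cut E B) (cut R B) (tok Q B % L))
        (cong (cut E B + suc (cut R B) +_) (sym (suc-%-lo (tok Q B) ne))))))
      where
      lem : ∀ a b c → 2 + (a + b + c) ≡ a + suc b + suc c
      lem = ℕ-Solver.solve-∀

    op-par : ∀ B → B z ≡ false → 2 ∣ deg I B + tok Q B → 2 ∣ deg I⁺ B + tok (x ∷ Q) B
    op-par B bz p with B x | B w | B z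
    ... | false | _     | false = p
    ... | true  | false | false = subst (2 ∣_) (lem (cut E B) (cut R B) (tok Q B)) p
      where
      lem : ∀ a b c → a + suc b + c ≡ a + b + suc c
      lem = ℕ-Solver.solve-∀
    ... | true  | true  | false = subst (2 ∣_) (lem (cut E B) (cut R B) (tok Q B)) (∣m∣n⇒∣m+n ∣-refl p)
      where
      lem : ∀ a b c → 2 + (a + b + c) ≡ a + suc b + suc c
      lem = ℕ-Solver.solve-∀

    op-Good : ∀ F B → B z ≡ false → Good (net ((z , w) ∷ F) B) (tok (x ∷ Q) B) → Good (net ((x , w) ∷ F) B) (tok Q B)
    op-Good F B bz g with B x
    ... | false rewrite bz = g
    ... | true  rewrite bz = Good-resp (lem (i (B w)) (net F B)) refl (Good-pred g)
      where
      lem : ∀ a b → ((a -ᶻ pos 0) +ᶻ b) -ᶻ pos 1 ≡ (a -ᶻ pos 1) +ᶻ b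
      lem = ℤ-Solver.solve-∀

    δz : V z ≡ false → ∀ {v} → V v ≡ true → δ v z ≡ false
    δz Vz {v} Vv = δ-false {v} {z} λ { refl → clash Vz Vv }

    op-Sol : V z ≡ false → Sol I⁺ → Sol I
    op-Sol Vz (D , o , g) = D , o , λ v Vv → Good-resp (net-comm ((x , w) ∷ R) D (δ v)) refl
      (op-Good (R ++ D) (δ v) (δz Vz Vv) (Good-resp (net-comm D ((z , w) ∷ R) (δ v)) refl (g v Vv)))

    -- Such a set, if it contains x but not w, is left with residue 0 and degree below K by the
    -- redirection. Membership of x is not part of the notion, so that a maximal tight set can be
    -- fixed before an edge leaving it is chosen.
    Tight : PSet → Set
    Tight B = Proper I B × tok Q B % L ≡ L₁ × deg I B ≤ K

    tight? : ∀ B → Dec (Tight B)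
    tight? B = ((B ⊆? V) ×-dec outside? B V) ×-dec ((tok Q B % L ℕ.≟ L₁) ×-dec (deg I B ≤? K))

    tight-resp : ∀ {A B} → A ≐ B → Tight A → Tight B
    tight-resp {A} {B} eq ((A⊆V , q , Vq , Aq) , e , le) =
      ((λ v bv → A⊆V v (trans (eq v) bv)) , q , Vq , trans (sym (eq q)) Aq) ,
      trans (cong (_% L) (sym (tok-ext eq Q))) e , subst (_≤ K)
          (cong₂ _+_ (cut-ext eq E) (cut-ext eq ((x , w) ∷ R))) le

    -- `Base` is asked of I⁺ but density of I: when the edge to be redirected has both ends in V, I
    -- violates `rno`, and only I⁺ is an instance in the proper sense.
    out-free : Base I⁺ → Dense I z → V x ≡ true → (∀ B → B x ≡ true → ¬ Tight B) →
               (Hyp I⁺ z → Sol I⁺) → Sol I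
    out-free b d Vx noT solve = op-Sol Vz (solve (b , dense , λ Vz′ → clash Vz Vz′))
      where
      open Base b
      dense : Dense I⁺ z
      dense B pr p bp p≢z = op-Φ B (outside-z Vz (proj₁ pr))
        (d B pr p bp p≢z) (λ bx e → ℕ.≰⇒> λ le → noT B bx (pr , e , le))

    -- Inside a tight set the redirection may again destroy density. The recursion therefore starts
    -- before it, with density of the original and `Base` of the redirected instance.
    Out< : ℕ → Set
    Out< n = ∀ V E R Q → size V < n → V x ≡ true → V w ≡ false →
             Base (inst V E ((z , w) ∷ R) (x ∷ Q)) → Dense (inst V E ((x , w) ∷ R) Q) z → Sol
                 (inst V E ((x , w) ∷ R) Q)

    -- The new token makes the residue of A vanish, so the vertex x to which A is contracted may be
    -- exempt. A tight set containing A lies in A by maximality, so in the contracted instance only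
    -- {x} can have fallen below K. For the inner instance `rootφ` holds because Φ of A is now deg A
    -- - 1 ≤ K.
    out-tight : Base I⁺ → Dense I z → ∀ A → A x ≡ true → A w ≡ false → Tight A →
                (∀ C → A ⊆ C → Tight C → C ⊆ A) →
                Solve≤ (size V) (length E) (cut ((z , w) ∷ R) V) → Out< (size V) → Sol I
    out-tight b d A Ax Aw tA@((A⊆V , q , Vq , Aq) , eA , dA) mx solve inn< =
      C.glue o (λ v Vv Av → op-Good (R ++ D) (δ v) (δz Vz Vv) (gs v Vv Av))
        (inn< A C.inn (R ++ D) Q (size-mono-< A⊆V q Aq Vq) Ax Aw inBase (C.inner-Dense o d))
      where
      open Base b
      s = split A E
      module C  = Contraction I  {A} {x} A⊆V Ax s
      module C⁺ = Contraction I⁺ {A} {x} A⊆V Ax s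
      open C using (κ; κ-in; shrunk-in; pull-self)
      J = C⁺.outer
      dense : Dense J x
      dense B prJ@(B⊆ , _) p bp p≢x = subst (K ≤_) (sym (C⁺.Φ-outer B))
        (op-Φ (B ∘ κ) (outside-z Vz (proj₁ pr)) (d (B ∘ κ) pr p bκp p≢z) λ bx e → ℕ.≰⇒> λ le →
          p≢x (shrunk-in (mx (B ∘ κ) (λ y Ay → trans (cong B (trans (κ-in Ay) (sym (κ-in Ax)))) bx)
              (pr , e , le) p bκp) (B⊆ p bp)))
        where
        pr : Proper I (B ∘ κ)
        pr = C.pull-Proper prJ
        bκp : B (κ p) ≡ true
        bκp = pull-self {B} p (B⊆ p bp) bp
        p≢z : p ≢ z
        p≢z refl = clash Vz (proj₁ pr p bκp)
      exempt : Exempt J x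
      exempt _ = m%n≡0⇒n∣m _ L (trans (cong (_% L) (trans (tok-map κ (x ∷ Q) (δ x))
        (trans (tok-ext C.δκ-r (x ∷ Q)) (cong (λ y → bit y + tok Q A) Ax)))) (suc-%-top (tok Q A) eA))
      os = C⁺.fromOuter (solve J x C⁺.outer-size C⁺.outer-len (ℕ.≤-reflexive C⁺.outer-cutR)
          (C⁺.outer-Base b , dense , exempt))
      D = proj₁ os
      o = proj₁ (proj₂ os)
      gA = proj₁ (proj₂ (proj₂ os))
      gs = proj₂ (proj₂ (proj₂ os))
      deg⁺A : suc (deg I⁺ A) ≡ deg I A
      deg⁺A rewrite Ax | Aw | outside-z Vz A⊆V = sym (ℕ.+-suc (cut E A) (cut R A))
      inBase : Base (C⁺.inner D)
      inBase = C⁺.inner-Base o b (ℕ.≤-trans (ℕ.≤-reflexive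
          (trans (cong (deg I⁺ A +_) (trans (cong (λ y → (bit y + tok Q A) % L) Ax)
        (suc-%-top (tok Q A) eA))) (ℕ.+-identityʳ _))) (ℕ.≤-trans (ℕ.n≤1+n _) (subst (_≤ K) (sym deg⁺A) dA))) gA

  out-edge : ∀ n x w V E R Q → size V < n → V x ≡ true → V w ≡ false →
        Base (inst V E ((z , w) ∷ R) (x ∷ Q)) → Dense (inst V E ((x , w) ∷ R) Q) z →
        Solve≤ (size V) (length E) (cut ((z , w) ∷ R) V) → Solve< (size V) → Sol (inst V E ((x , w) ∷ R) Q)
  out-edge (suc n) x w V E R Q sz Vx Vw b d solve solve<
    with searchSet {λ B → B x ≡ true × Op.Tight V E R Q x w B}
           (λ B → (B x ≟ᵇ true) ×-dec Op.tight? V E R Q x w B)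
           (λ eq (bx , t) → trans (sym (eq x)) bx , Op.tight-resp V E R Q x w eq t)
  ... | inj₂ none = Op.out-free V E R Q x w b d Vx (λ B bx t → none B (bx , t))
                      λ hyp → solve _ z ℕ.≤-refl ℕ.≤-refl ℕ.≤-refl hyp
  ... | inj₁ (A₀ , A₀x , t₀) with maximalSet (Op.tight? V E R Q x w) (Op.tight-resp V E R Q x w) A₀ t₀
  ... | A , A₀⊆A , tA , mx = Op.out-tight V E R Q x w b d A (A₀⊆A x A₀x)
        (¬true⇒false λ aw → clash Vw (proj₁ (proj₁ tA) w aw)) tA mx solve
        -- A has fewer vertices than V, so the bounds on E and R that `solve` requires come for free
        -- from `solve<`.
        λ V′ E′ R′ Q′ lt V′x V′w b′ d′ → out-edge n x w V′ E′ R′ Q′ (ℕ.<-≤-trans lt (ℕ.≤-pred sz)) V′x V′w b′ d′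
          (λ I v₀ le _ _ hyp → solve< I v₀ (ℕ.≤-<-trans le lt) hyp)
          (λ I v₀ lt′ hyp → solve< I v₀ (ℕ.<-trans lt′ lt) hyp)

  -- Splitting off the edges at an exempt vertex.

  NoLow : Inst → Set
  NoLow I = ∀ B → Proper I B → ∀ p q → B p ≡ true → B q ≡ true → p ≢ q → 2 + K ≤ Φ I B

  lift-bits : ∀ a u w → (bit (a xor u) + bit (a xor w) ≡ bit (u xor w)) ⊎
                        (bit (a xor u) + bit (a xor w) ≡ 2 + bit (u xor w) × u ≡ w × a ≡ not u)
  lift-bits false false false = inj₁ refl
  lift-bits false false true  = inj₁ refl
  lift-bits false true  false = inj₁ refl
  lift-bits false true  true  = inj₂ (refl , refl , refl)
  lift-bits true  false false = inj₂ (refl , refl , refl)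
  lift-bits true  false true  = inj₁ refl
  lift-bits true  true  false = inj₁ refl
  lift-bits true  true  true  = inj₁ refl

  -- Replacing v₀u and v₀w by uw lowers the degree of a set by 2 exactly when the set separates
  -- v₀ from u and w; NoLow leaves room for this, except at the exempt set {v₀}.
  module Lift {I : Inst} {v₀ u w : X} {E′ R′ : List Edge} {c : PSet → ℕ}
    (Vv₀ : V I v₀ ≡ true) (Vu : V I u ≡ true) (uw : V I w ≡ false ⊎ u ≢ w)
    (degI : ∀ B → deg I B ≡ (bit (B v₀ xor B u) + bit (B v₀ xor B w)) + c B)
    (degJ : ∀ B → deg (inst (V I) E′ R′ (Q I)) B ≡ bit (B u xor B w) + c B) where

    J : Inst
    J = inst (V I) E′ R′ (Q I)

    lift-Dense : NoLow I → Dense I v₀ → Dense J v₀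
    lift-Dense nl d B pr p bp p≢v₀ with lift-bits (B v₀) (B u) (B w)
    ... | inj₁ eq = subst (λ x → K ≤ x + tok (Q I) B % L) (trans (degI B) (trans (cong (_+ c B) eq) (sym (degJ B))))
        (d B pr p bp p≢v₀)
    ... | inj₂ (eq , u≡w , v≡) = ℕ.+-cancelˡ-≤ 2 _ _ (subst (2 + K ≤_) eqΦ big)
      where
      eqΦ : Φ I B ≡ 2 + Φ J B
      eqΦ = cong (_+ tok (Q I) B % L) (trans (degI B) (trans (cong (_+ c B) eq) (cong (2 +_) (sym (degJ B)))))
      big : 2 + K ≤ Φ I B
      big with B u in bu
      ... | false = nl B pr p v₀ bp v≡ p≢v₀
      ... | true = Sum.[ (λ Vw → clash Vw (proj₁ pr w (sym u≡w)))
                            , (λ ne → nl B pr u w bu (sym u≡w) ne) ] uw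

    lift-par : ∀ B → 2 ∣ deg I B + tok (Q I) B → 2 ∣ deg J B + tok (Q I) B
    lift-par B p with lift-bits (B v₀) (B u) (B w)
    ... | inj₁ eq = subst (λ x → 2 ∣ x + tok (Q I) B) (trans (degI B) (trans (cong (_+ c B) eq) (sym (degJ B)))) p
    ... | inj₂ (eq , _) = ∣m+n∣m⇒∣n (subst (2 ∣_)
        (cong (_+ tok (Q I) B) (trans (degI B) (trans (cong (_+ c B) eq) (cong (2 +_) (sym (degJ B)))))) p) ∣-refl

    lift-Φ : Φ J (V I) ≡ Φ I (V I)
    lift-Φ = cong (_+ tok (Q I) (V I) % L) (trans (degJ (V I)) (trans (cong (_+ c (V I)) eq) (sym (degI (V I)))))
      where
      eq : bit (V I u xor V I w) ≡ bit (V I v₀ xor V I u) + bit (V I v₀ xor V I w)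
      eq rewrite Vv₀ | Vu = refl

  module _ {I : Inst} {v₀ : X} (b : Base I) (d : Dense I v₀) (Vv₀ : V I v₀ ≡ true) (ev₀ : L ∣ tok (Q I) (δ v₀)) where
    open Base b
    private
      U = V I ∖ v₀
      ⊕U : δ v₀ ⊕ U ≐ V I
      ⊕U = ∖-⊕ {V I} Vv₀

    tokU : tok (Q I) (V I) % L ≡ tok (Q I) U % L
    tokU = trans (cong (_% L) (tok-⊕ ⊕U (Q I))) (trans (cong (_% L) (ℕ.+-comm (tok (Q I) (δ v₀)) _))
        (%-remove-+ʳ (tok (Q I) U) ev₀))

    -- V and V without v₀ have the same residue, as v₀ carries a multiple of L, and Φ V ≤ K ≤ Φ U.
    -- The edges of R away from v₀ cancel in this comparison. So v₀ cannot have edges of R when it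
    -- has none of E.
    cutR≤cutE : ∀ p → V I p ≡ true → p ≢ v₀ → cut (R I) (δ v₀) ≤ cut (E I) (δ v₀)
    cutR≤cutE p Vp p≢ = lin 0 (ℕ.≤-trans rootφ (d U (∖-⊆ {V I} , v₀ , Vv₀ , ∖-self (V I) v₀) p
        (∖-in {V I} Vp p≢) p≢)) eq
      where
      lem : ∀ e r u t → e + (0 + (r + u) + t) ≡ r + (e + u + t) + 0
      lem = ℕ-Solver.solve-∀
      eq : cut (E I) (δ v₀) + Φ I (V I) ≡ cut (R I) (δ v₀) + Φ I U + 0
      eq rewrite noE | cutR-⊕ {δ v₀} {U} {V I} ⊕U rno | tokU | sym (cutE-⊕ {δ v₀} {U} {V I} ⊕U (E I) noE) =
        lem (cut (E I) (δ v₀)) (cut (R I) (δ v₀)) (cut (R I) U) (tok (Q I) U % L)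

    -- Without edges, v₀ has net 0, which its residue allows. Removing it keeps Φ of the vertex set,
    -- and the remaining sets all avoid v₀, so no exemption is left.
    elim-isolated : cut (E I) (δ v₀) ≡ 0 → cut (R I) (δ v₀) ≡ 0 → Solve< (size (V I)) → Sol I
    elim-isolated e0 r0 solve< with solve< J z (size-mono-< (∖-⊆ {V I}) v₀ (∖-self (V I) v₀) Vv₀)
        (base , dense , λ Uz → clash Vz (∖-⊆ {V I} z Uz))
      where
      J : Inst
      J = inst U (E I) (R I) (Q I)
      base : Base J
      base = record
        { Vz = ¬true⇒false λ Uz → clash Vz (∖-⊆ {V I} z Uz)
        ; noE = trans (sym (cutE-⊕ {δ v₀} {U} {V I} ⊕U (E I) noE)) e0
        ; rno = All.map (λ {e} q → mono (V I (proj₁ e)) (V I (proj₂ e)) q) rno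
        ; par = λ B B⊆ → par B (λ x bx → ∖-⊆ {V I} x (B⊆ x bx))
        ; rootφ = subst (_≤ K) eqΦ rootφ
        ; root = Good-∣ {net (R I) U} {tok (Q I) (δ v₀)} ev₀
            (Good-resp (trans (net-⊕ {δ v₀} {U} {V I} ⊕U (R I))
            (trans (cong (_+ᶻ net (R I) U) (cut≡0⇒net≡0 (R I) (δ v₀) r0)) (ℤ.+-identityˡ _))) (tok-⊕ ⊕U (Q I)) root) }
        where
        mono : ∀ a c {x y} → a ∧ c ≡ false → (a ∧ x) ∧ (c ∧ y) ≡ false
        mono true false {x} eq with x
        ... | true = refl
        ... | false = refl
        mono false c eq = refl
        eqΦ : Φ I (V I) ≡ Φ J U
        eqΦ = cong₂ _+_ (cong₂ _+_ (trans noE (sym (trans (sym (cutE-⊕ {δ v₀} {U} {V I} ⊕U (E I) noE)) e0)))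
            (trans (cutR-⊕ {δ v₀} {U} {V I} ⊕U rno) (cong (_+ cut (R I) U) r0))) tokU
      dense : Dense J z
      dense B (B⊆ , q , Uq , Bq) p bp _ = d B ((λ x bx → ∖-⊆ {V I} x (B⊆ x bx)) , q , ∖-⊆ {V I} q Uq , Bq) p bp
          (∖-≢ {V I} (B⊆ p bp))
    ... | D , o , g = D , o , fin
      where
      fin : ∀ v → V I v ≡ true → Good (net (D ++ R I) (δ v)) (tok (Q I) (δ v))
      fin v Vv with v Fin.≟ v₀
      ... | no ne = g v (∖-in {V I} Vv ne)
      ... | yes refl = Good-resp (sym (cut≡0⇒net≡0 (D ++ R I) (δ v)
          (trans (cut-++ D (R I) (δ v)) (cong₂ _+_ (trans (Ornt-cut o (δ v)) e0) r0)))) refl (Good-0 ev₀)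

  SolveE< : ℕ → ℕ → Set
  SolveE< n m = ∀ I v₀ → size (V I) ≤ n → length (E I) < m → Hyp I v₀ → Sol I

  edge-in : ∀ {V : PSet} {u v F} → V u ≡ true → cut ((u , v) ∷ F) V ≡ 0 → V v ≡ true
  edge-in {V} {u} {v} Vu eq with V v
  ... | true = refl
  ... | false rewrite Vu = ⊥-elim (ℕ.1+n≢0 eq)

  telescope : ∀ a u w n → (w -ᶻ u) +ᶻ n ≡ (a -ᶻ u) +ᶻ ((w -ᶻ a) +ᶻ n)
  telescope = ℤ-Solver.solve-∀

  -- A boundary edge between a and w in either direction; splitting off treats both alike, since
  -- cuts do not see the direction.
  dart : Bool → X → X → Edge
  dart true  a w = a , w
  dart false a w = w , a

  cut-dart : ∀ dir a w S B → cut (dart dir a w ∷ S) B ≡ bit (B a xor B w) + cut S B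
  cut-dart true  a w S B = refl
  cut-dart false a w S B = cong (λ y → bit y + cut S B) (xor-comm (B w) (B a))

  net-dart : ∀ dir {a b} w S B → B a ≡ B b → net (dart dir a w ∷ S) B ≡ net (dart dir b w ∷ S) B
  net-dart true  w S B eq rewrite eq = refl
  net-dart false w S B eq rewrite eq = refl

  dart-out : ∀ dir {a w} (V : PSet) → V w ≡ false → V (proj₁ (dart dir a w)) ∧ V (proj₂ (dart dir a w)) ≡ false
  dart-out true  {a} V Vw with V a
  ... | true  = Vw
  ... | false = refl
  dart-out false V Vw rewrite Vw = refl

  dart-out⁻ : ∀ dir {a w} (V : PSet) → V a ≡ true → V (proj₁ (dart dir a w)) ∧ V (proj₂ (dart dir a w)) ≡ false →
      V w ≡ false
  dart-out⁻ true  V Va eq rewrite Va = eq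
  dart-out⁻ false {a} {w} V Va eq with V w
  ... | true  = trans (sym Va) eq
  ... | false = refl

  -- The directed edge between u and w is replaced by a directed path through v₀, which contributes
  -- 0 at v₀.
  dart-Sol : ∀ dir {V F S Q v₀ u w} → Sol (inst V F (dart dir u w ∷ S) Q) →
      Sol (inst V ((v₀ , u) ∷ F) (dart dir v₀ w ∷ S) Q)
  dart-Sol true {S = S} {v₀ = v₀} {u} {w} (D , o , g) = (u , v₀) ∷ D , flip o , λ v Vv → Good-resp (eq (δ v)) refl
      (g v Vv)
    where
    eq : ∀ B → net (D ++ (u , w) ∷ S) B ≡ net ((u , v₀) ∷ D ++ (v₀ , w) ∷ S) B
    eq B = trans (net-++ D ((u , w) ∷ S) B) (trans (lem (i (B v₀)) (i (B u)) (i (B w)) (net D B) (net S B))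
             (cong ((i (B v₀) -ᶻ i (B u)) +ᶻ_) (sym (net-++ D ((v₀ , w) ∷ S) B))))
      where
      lem : ∀ a u w d s → d +ᶻ ((w -ᶻ u) +ᶻ s) ≡ (a -ᶻ u) +ᶻ (d +ᶻ ((w -ᶻ a) +ᶻ s))
      lem = ℤ-Solver.solve-∀
  dart-Sol false {S = S} {v₀ = v₀} {u} {w} (D , o , g) = (v₀ , u) ∷ D , keep o , λ v Vv → Good-resp (eq (δ v)) refl
      (g v Vv)
    where
    eq : ∀ B → net (D ++ (w , u) ∷ S) B ≡ net ((v₀ , u) ∷ D ++ (w , v₀) ∷ S) B
    eq B = trans (net-++ D ((w , u) ∷ S) B) (trans (lem (i (B v₀)) (i (B u)) (i (B w)) (net D B) (net S B))
             (cong ((i (B u) -ᶻ i (B v₀)) +ᶻ_) (sym (net-++ D ((w , v₀) ∷ S) B))))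
      where
      lem : ∀ a u w d s → d +ᶻ ((u -ᶻ w) +ᶻ s) ≡ (u -ᶻ a) +ᶻ (d +ᶻ ((a -ᶻ w) +ᶻ s))
      lem = ℤ-Solver.solve-∀

  elim-root : ∀ dir {V F S Q v₀ u w} → let I = inst V ((v₀ , u) ∷ F) (dart dir v₀ w ∷ S) Q in
    Base I → Dense I v₀ → V v₀ ≡ true → L ∣ tok Q (δ v₀) → NoLow I →
    SolveE< (size V) (suc (length F)) → Sol I
  elim-root dir {V} {F} {S} {Q} {v₀} {u} {w} b d Vv₀ ev₀ nl solveE =
    dart-Sol dir {Q = Q} (solveE J v₀ ℕ.≤-refl ℕ.≤-refl (base , lift-Dense nl d , λ _ → ev₀))
    where
    open Base b
    I = inst V ((v₀ , u) ∷ F) (dart dir v₀ w ∷ S) Q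
    J = inst V F (dart dir u w ∷ S) Q
    Vu : V u ≡ true
    Vu = edge-in {V} {v₀} {u} {F} Vv₀ noE
    Vw : V w ≡ false
    Vw = dart-out⁻ dir V Vv₀ (All.head rno)
    lem₁ : ∀ a b c d → (a + b) + (c + d) ≡ (a + c) + (b + d)
    lem₁ = ℕ-Solver.solve-∀
    lem₂ : ∀ a b c → b + (a + c) ≡ a + (b + c)
    lem₂ = ℕ-Solver.solve-∀
    open Lift {I} {v₀} {u} {w} {F} {dart dir u w ∷ S} {λ B → cut F B + cut S B} Vv₀ Vu (inj₁ Vw)
      (λ B → trans (cong (bit (B v₀ xor B u) + cut F B +_) (cut-dart dir v₀ w S B))
          (lem₁ (bit (B v₀ xor B u)) (cut F B) (bit (B v₀ xor B w)) (cut S B)))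
      (λ B → trans (cong (cut F B +_) (cut-dart dir u w S B)) (lem₂ (bit (B u xor B w)) (cut F B) (cut S B))) hiding
          (J)
    base : Base J
    base = record
      { Vz = Vz
      ; noE = ℕ.m+n≡0⇒n≡0 (bit (V v₀ xor V u)) noE
      ; rno = dart-out dir V Vw ∷ All.tail rno
      ; par = λ B B⊆ → lift-par B (par B B⊆)
      ; rootφ = subst (_≤ K) (sym lift-Φ) rootφ
      ; root = Good-resp (net-dart dir w S V (trans Vv₀ (sym Vu))) refl root }

  -- For a set that contains u and w but not v₀, `NoLow` needs two distinct vertices; hence `u ≢ w`.
  -- Parallel edges are left to `elim-pair`.
  elim-path : ∀ {V G R Q v₀ u w} → let I = inst V ((v₀ , u) ∷ (v₀ , w) ∷ G) R Q in
    Base I → Dense I v₀ → V v₀ ≡ true → L ∣ tok Q (δ v₀) → u ≢ w → NoLow I →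
    SolveE< (size V) (suc (suc (length G))) → Sol I
  elim-path {V} {G} {R} {Q} {v₀} {u} {w} b d Vv₀ ev₀ u≢w nl solveE = back
      (solveE J v₀ ℕ.≤-refl ℕ.≤-refl (base , dense , λ _ → ev₀))
    where
    open Base b
    I = inst V ((v₀ , u) ∷ (v₀ , w) ∷ G) R Q
    J = inst V ((u , w) ∷ G) R Q
    Vu : V u ≡ true
    Vu = edge-in {V} {v₀} {u} {(v₀ , w) ∷ G} Vv₀ noE
    Vw : V w ≡ true
    Vw = edge-in {V} {v₀} {w} {G} Vv₀ (ℕ.m+n≡0⇒n≡0 (bit (V v₀ xor V u)) noE)
    lem₁ : ∀ a b c d → (a + (b + c)) + d ≡ (a + b) + (c + d)
    lem₁ = ℕ-Solver.solve-∀
    open Lift {I} {v₀} {u} {w} {(u , w) ∷ G} {R} {λ B → cut G B + cut R B} Vv₀ Vu (inj₂ u≢w)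
      (λ B → lem₁ (bit (B v₀ xor B u)) (bit (B v₀ xor B w)) (cut G B) (cut R B))
      (λ B → ℕ.+-assoc (bit (B u xor B w)) (cut G B) (cut R B)) hiding (J)
    dense : Dense J v₀
    dense = lift-Dense nl d
    base : Base J
    base = record
      { Vz = Vz
      ; noE = trans (cong₂ (λ x y → bit (x xor y) + cut G V) Vu Vw)
          (ℕ.m+n≡0⇒n≡0 (bit (V v₀ xor V w)) (ℕ.m+n≡0⇒n≡0 (bit (V v₀ xor V u)) noE))
      ; rno = rno
      ; par = λ B B⊆ → lift-par B (par B B⊆)
      ; rootφ = subst (_≤ K) (sym lift-Φ) rootφ
      ; root = root }
    back : Sol J → Sol I
    back (_ , keep {D = D} o , g) = (u , v₀) ∷ (v₀ , w) ∷ D , flip (keep o) , λ v Vv → Good-resp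
        (telescope (i (δ v v₀)) (i (δ v u)) (i (δ v w)) (net (D ++ R) (δ v))) refl (g v Vv)
    back (_ , flip {D = D} o , g) = (v₀ , u) ∷ (w , v₀) ∷ D , keep (flip o) , λ v Vv →
      Good-resp (trans (telescope (i (δ v v₀)) (i (δ v w)) (i (δ v u)) (net (D ++ R) (δ v)))
          (swapℤ (i (δ v v₀) -ᶻ i (δ v w)) (i (δ v u) -ᶻ i (δ v v₀)) (net (D ++ R) (δ v)))) refl (g v Vv)

  -- When all edges of E at v₀ go to u, half of them are directed each way.
  elim-pair : ∀ {I v₀ u} → Base I → Dense I v₀ → V I v₀ ≡ true → L ∣ tok (Q I) (δ v₀) → V I u ≡ true → u ≢ v₀ →
    cut (R I) (δ v₀) ≡ 0 → (s : Split ⁅ v₀ , u ⁆ (E I)) → cut (Split.out s) (δ v₀) ≡ 0 → Solve< (size (V I)) → Sol I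
  elim-pair {I} {v₀} {u} b d Vv₀ ev₀ Vu u≢v₀ r0 s o0 solve< =
    glue o gs (Dᵢ , oᵢ , fin)
    where
    open Base b
    A = ⁅ v₀ , u ⁆
    Au : A u ≡ true
    Au with δ v₀ u
    ... | true  = refl
    ... | false = δ-refl u
    Av₀ : A v₀ ≡ true
    Av₀ rewrite δ-refl v₀ = refl
    A-inv : ∀ {x} → A x ≡ true → x ≡ v₀ ⊎ x ≡ u
    A-inv {x} a with δ v₀ x in p
    ... | true  = inj₁ (δ-true {v₀} {x} p)
    ... | false = inj₂ (δ-true {u} {x} a)
    A⊆V : A ⊆ V I
    A⊆V x a with A-inv {x} a
    ... | inj₁ refl = Vv₀
    ... | inj₂ refl = Vu
    open Contraction I {A} {u} A⊆V Au s
    J = outer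
    -- v₀ has been absorbed by u, so the outer instance has no exempt vertex.
    dense : Dense J z
    dense B pr p bp _ = subst (K ≤_) (sym (Φ-outer B))
        (d (B ∘ κ) (pull-Proper pr) p (pull-self {B} p (proj₁ pr p bp) bp)
        λ { refl → u≢v₀ (sym (shrunk-in Av₀ (proj₁ pr p bp))) })
    baseJ = outer-Base b
    os = fromOuter (solve< J z (outer-size-< v₀ Av₀ (u≢v₀ ∘ sym)) (baseJ , dense , λ Vz′ → clash (Base.Vz baseJ) Vz′))
    D = proj₁ os
    o = proj₁ (proj₂ os)
    gA = proj₁ (proj₂ (proj₂ os))
    gs = proj₂ (proj₂ (proj₂ os))
    -- By `par` the degree of v₀ has the parity of its number of tokens, a multiple of the even L;
    -- all edges at v₀ lie in `inn`.
    ev : 2 ∣ cut inn (δ v₀)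
    ev = subst (2 ∣_) (trans (≃cut splits (δ v₀))
        (trans (cut-++ inn out (δ v₀)) (trans (cong (cut inn (δ v₀) +_) o0) (ℕ.+-identityʳ _))))
      (∣m+n∣m⇒∣n (subst (2 ∣_) (trans (ℕ.+-comm _ (tok (Q I) (δ v₀)))
          (cong (tok (Q I) (δ v₀) +_) (trans (cong (cut (E I) (δ v₀) +_) r0) (ℕ.+-identityʳ _))))
         (par (δ v₀) λ x p → subst (λ y → V I y ≡ true) (sym (δ-true {v₀} {x} p)) Vv₀)) (∣-trans 2∣L ev₀))
    alt = balance inn (δ v₀) ev
    Dᵢ = proj₁ alt
    oᵢ = proj₁ (proj₂ alt)
    F = Dᵢ ++ (R I ++ D)
    netF₀ : net F (δ v₀) ≡ pos 0
    netF₀ = trans (net-++ Dᵢ (R I ++ D) (δ v₀)) (cong₂ _+ᶻ_ (proj₂ (proj₂ alt)) (cut≡0⇒net≡0 (R I ++ D) (δ v₀)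
      (trans (cut-++ (R I) D (δ v₀)) (cong₂ _+_ r0 (trans (Ornt-cut o (δ v₀)) o0)))))
    netFA : net F A ≡ net (R I ++ D) A
    netFA = trans (net-++ Dᵢ (R I ++ D) A) (trans
        (cong (_+ᶻ net (R I ++ D) A) (cut≡0⇒net≡0 Dᵢ A (trans (Ornt-cut oᵢ A) inner-noE))) (ℤ.+-identityˡ _))
    pair : δ v₀ ⊕ δ u ≐ A
    pair = pair-⊕ (u≢v₀ ∘ sym)
    fin : ∀ v → A v ≡ true → Good (net F (δ v)) (tok (Q I) (δ v))
    fin v Av = Sum.[ (λ eq → at eq fin-v₀) , (λ eq → at eq fin-u) ] (A-inv {v} Av)
      where
      at : ∀ {y} → v ≡ y → Good (net F (δ y)) (tok (Q I) (δ y)) → Good (net F (δ v)) (tok (Q I) (δ v))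
      at refl g = g
      fin-v₀ : Good (net F (δ v₀)) (tok (Q I) (δ v₀))
      fin-v₀ = Good-resp (sym netF₀) refl (Good-0 ev₀)
      fin-u : Good (net F (δ u)) (tok (Q I) (δ u))
      fin-u = Good-∣ {net F (δ u)} {tok (Q I) (δ v₀)} ev₀ (Good-resp
        (trans (sym netFA) (trans (net-⊕ {δ v₀} {δ u} {A} pair F)
            (trans (cong (_+ᶻ net F (δ u)) netF₀) (ℤ.+-identityˡ _))))
        (tok-⊕ {δ v₀} {δ u} {A} pair (Q I)) gA)

  NoLow-resp : ∀ {V E F R S Q} → E ≃ F → R ≋ S → NoLow (inst V E R Q) → NoLow (inst V F S Q)
  NoLow-resp {Q = Q} p q nl B pr x y bx by ne = subst (λ t → 2 + K ≤ t + tok Q B % L)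
      (cong₂ _+_ (≃cut p B) (≋cut q B)) (nl B pr x y bx by ne)

  -- Edges of R at v₀ are treated before two edges of E, because `elim-pair` requires that none of
  -- them be left. Each branch lowers the number of vertices or of edges of E.
  elim : ∀ I v₀ → Base I → Dense I v₀ → V I v₀ ≡ true → L ∣ tok (Q I) (δ v₀) → ∀ p → V I p ≡ true → p ≢ v₀ →
         NoLow I → Solve< (size (V I)) → SolveE< (size (V I)) (length (E I)) → Sol I
  elim I@(inst V E R Q) v₀ b d Vv₀ ev₀ p Vp p≢ nl solve< solveE with cut E (δ v₀) in ce | cut R (δ v₀) in cr
  ... | zero | c = elim-isolated b d Vv₀ ev₀ ce (ℕ.n≤0⇒n≡0
      (subst (cut R (δ v₀) ≤_) ce (cutR≤cutE b d Vv₀ ev₀ p Vp p≢))) solve<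
  ... | suc m | c with pick E (δ v₀) (subst (0 <_) (sym ce) (s≤s z≤n))
  ... | a , u , F , δa , δu , E≃ with δ-true {v₀} {a} δa
  ... | refl with c
  ... | suc _ = Sum.[ (λ R≋ → case true R≋) , (λ R≋ → case false R≋) ] R≋₂
    where
    pk = pickDir R (δ v₀) (subst (0 <_) (sym cr) (s≤s z≤n))
    y = proj₁ pk
    w = proj₁ (proj₂ pk)
    S = proj₁ (proj₂ (proj₂ pk))
    y≡ : y ≡ v₀
    y≡ = δ-true {v₀} {y} (proj₁ (proj₂ (proj₂ (proj₂ pk))))
    R≋₂ : R ≋ (v₀ , w) ∷ S ⊎ R ≋ (w , v₀) ∷ S
    R≋₂ = subst (λ a → R ≋ (a , w) ∷ S ⊎ R ≋ (w , a) ∷ S) y≡ (proj₂ (proj₂ (proj₂ (proj₂ (proj₂ pk)))))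
    case : (dir : Bool) → R ≋ dart dir v₀ w ∷ S → Sol I
    case dir R≋ = reSol {Q = Q} E≃ R≋ (elim-root dir (proj₁ hyp) (proj₁ (proj₂ hyp)) Vv₀ ev₀
        (NoLow-resp {R = R} {Q = Q} E≃ R≋ nl)
       (λ I v₀ n≤ m< → solveE I v₀ n≤ (subst (length (Inst.E I) <_) (sym (≃len E≃)) m<)))
      where
      hyp = reHyp E≃ R≋ (b , d , λ _ → ev₀)
  ... | zero with split ⁅ v₀ , u ⁆ F
  ... | s with cut (Split.out s) (δ v₀) in co
  ... | zero = reSol {Q = Q} E≃ ≋-refl (elim-pair (proj₁ hyp) (proj₁ (proj₂ hyp)) Vv₀ ev₀ Vu u≢ cr s′ co solve<)
    where
    hyp = reHyp E≃ ≋-refl (b , d , λ _ → ev₀)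
    Vu : V u ≡ true
    Vu = edge-in {V} {v₀} {u} {F} Vv₀ (Base.noE (proj₁ hyp))
    u≢ : u ≢ v₀
    u≢ refl = clash δu (δ-refl u)
    s′ : Split ⁅ v₀ , u ⁆ ((v₀ , u) ∷ F)
    s′ = record { inn = (v₀ , u) ∷ Split.inn s ; out = Split.out s
                ; inn-in = (cong (_∨ δ u v₀) (δ-refl v₀) , trans (cong (_∨ δ u u) δu) (δ-refl u)) ∷ Split.inn-in s
                ; out-out = Split.out-out s ; splits = ≃-cons _ (Split.splits s) }
  ... | suc _ with pick′ (Split.out s) (Split.out-out s) (subst (0 <_) (sym co) (s≤s z≤n))
    where
    pick′ : ∀ E → All (λ e → ⁅ v₀ , u ⁆ (proj₁ e) ∧ ⁅ v₀ , u ⁆ (proj₂ e) ≡ false) E → 0 < cut E (δ v₀) → ∃₂ λ w G →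
        u ≢ w × E ≃ (v₀ , w) ∷ G
    pick′ ((a , c) ∷ E) (q ∷ qs) 0<c with δ v₀ a in pa | δ v₀ c in pc
    ... | true  | true  = let w , G , ne , eq = pick′ E qs 0<c in w , _ ∷ G , ne , ≃-trans (≃-cons _ eq) ≃-swap
    ... | false | false = let w , G , ne , eq = pick′ E qs 0<c in w , _ ∷ G , ne , ≃-trans (≃-cons _ eq) ≃-swap
    ... | true  | false rewrite δ-true {v₀} {a} pa = c , E , (λ { refl → clash q (δ-refl u) }) , ≃-refl
    ... | false | true  rewrite δ-true {v₀} {c} pc = a , E , (λ { refl → clash q (cong (_∧ true) (δ-refl u)) }) ,
        ≃-flip
  ... | w , G , u≢w , out≃ = reSol {Q = Q} E≃′ ≋-refl
      (elim-path (proj₁ hyp) (proj₁ (proj₂ hyp)) Vv₀ ev₀ u≢w (NoLow-resp {R = R} {Q = Q} E≃′ ≋-refl nl)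
       (λ I v₀ n≤ m< → solveE I v₀ n≤ (subst (length (Inst.E I) <_) (sym (≃len E≃′)) m<)))
    where
    E≃′ : E ≃ (v₀ , u) ∷ (v₀ , w) ∷ (Split.inn s ++ G)
    E≃′ = ≃-trans E≃ (≃-cons _ (≃-trans (Split.splits s)
        (≃-trans (≃-++ (Split.inn s) out≃) (≃-unshift _ (Split.inn s)))))
    hyp = reHyp E≃′ ≋-refl (b , d , λ _ → ev₀)

  cut-rep : ∀ b v B → B z ≡ false → cut (replicate b (v , z)) B ≡ b * bit (B v)
  cut-rep zero    v B bz = refl
  cut-rep (suc b) v B bz rewrite cut-rep b v B bz | bz with B v
  ... | true  = refl
  ... | false = refl

  tok-rep : ∀ b v B → tok (replicate b v) B ≡ b * bit (B v)
  tok-rep zero    v B = refl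
  tok-rep (suc b) v B = cong (bit (B v) +_) (tok-rep b v B)

  net-rep : ∀ b v B → B z ≡ false → net (replicate b (v , z)) B ≡ neg (pos (b * bit (B v)))
  net-rep zero    v B bz = refl
  net-rep (suc b) v B bz rewrite net-rep b v B bz | bz | ℤ.pos-+ (bit (B v)) (b * bit (B v)) = lem (pos (bit (B v)))
      (pos (b * bit (B v)))
    where
    lem : ∀ a b → (pos 0 -ᶻ a) +ᶻ neg b ≡ neg (a +ᶻ b)
    lem = ℤ-Solver.solve-∀

  -- Dummy edges from v to the root, as many as the residue of v, make v balanced, hence exempt.
  module Debt (V : PSet) (E R : List Edge) (Q : List X) (v : X) (Vz : V z ≡ false) (Vv : V v ≡ true)
              (le : tok Q (δ v) % L ≤ tok Q V % L) where
    I J : Inst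
    b c : ℕ
    b = tok Q (δ v) % L
    c = L ∸ b
    I = inst V E R Q
    J = inst V E (replicate b (v , z) ++ R) (replicate c v ++ Q)

    b≤L : b ≤ L
    b≤L = ℕ.<⇒≤ (m%n<n (tok Q (δ v)) L)

    cutJ : ∀ B → B z ≡ false → cut (replicate b (v , z) ++ R) B ≡ b * bit (B v) + cut R B
    cutJ B bz = trans (cut-++ (replicate b (v , z)) R B) (cong (_+ cut R B) (cut-rep b v B bz))

    tokJ : ∀ B → tok (replicate c v ++ Q) B ≡ c * bit (B v) + tok Q B
    tokJ B = trans (tok-++ (replicate c v) Q B) (cong (_+ tok Q B) (tok-rep c v B))

    lem₁ : ∀ a b c d → a + (b + c) + d ≡ a + c + (b + d)
    lem₁ = ℕ-Solver.solve-∀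

    -- A set containing v gains b in its cut and loses at most b in its residue. For V itself the
    -- two changes cancel, because its residue is at least b; thus `rootφ` survives.
    ΦJ-≥ : ∀ B → B z ≡ false → Φ I B ≤ Φ J B
    ΦJ-≥ B bz rewrite cutJ B bz | tokJ B with B v
    ... | false rewrite ℕ.*-zeroʳ b | ℕ.*-zeroʳ c = ℕ.≤-refl
    ... | true  rewrite ℕ.*-identityʳ b | ℕ.*-identityʳ c = ℕ.≤-trans
        (ℕ.+-monoʳ-≤ (cut E B + cut R B) (shift-≥ b (tok Q B) b≤L))
                  (ℕ.≤-reflexive (sym (lem₁ (cut E B) b (cut R B) ((c + tok Q B) % L))))

    ΦJ-V : Φ J V ≡ Φ I V
    ΦJ-V rewrite cutJ V Vz | tokJ V | Vv | ℕ.*-identityʳ b | ℕ.*-identityʳ c =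
      trans (lem₁ (cut E V) b (cut R V) ((c + tok Q V) % L)) (cong (cut E V + cut R V +_) (shift-≡ b (tok Q V) le))

    par-J : ∀ B → B z ≡ false → 2 ∣ deg I B + tok Q B → 2 ∣ deg J B + tok (Inst.Q J) B
    par-J B bz p rewrite cutJ B bz | tokJ B with B v
    ... | false rewrite ℕ.*-zeroʳ b | ℕ.*-zeroʳ c = p
    ... | true  rewrite ℕ.*-identityʳ b | ℕ.*-identityʳ c = subst (2 ∣_) eq (∣m∣n⇒∣m+n 2∣L p)
      where
      lem : ∀ b c e r t → (b + c) + (e + r + t) ≡ e + (b + r) + (c + t)
      lem = ℕ-Solver.solve-∀
      eq : L + (cut E B + cut R B + tok Q B) ≡ cut E B + (b + cut R B) + (c + tok Q B)
      eq = trans (cong (_+ (cut E B + cut R B + tok Q B)) (sym (ℕ.m+[n∸m]≡n b≤L)))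
          (lem b c (cut E B) (cut R B) (tok Q B))

    netJ : ∀ D B → B z ≡ false → net (D ++ Inst.R J) B ≡ net (D ++ R) B -ᶻ pos (b * bit (B v))
    netJ D B bz = trans (net-++ D (Inst.R J) B) (trans
        (cong (net D B +ᶻ_) (trans (net-++ (replicate b (v , z)) R B) (cong (_+ᶻ net R B) (net-rep b v B bz))))
      (trans (lem (net D B) (pos (b * bit (B v))) (net R B)) (cong (_-ᶻ pos (b * bit (B v))) (sym (net-++ D R B)))))
      where
      lem : ∀ d x r → d +ᶻ (neg x +ᶻ r) ≡ (d +ᶻ r) -ᶻ x
      lem = ℤ-Solver.solve-∀

    debt-Cong : ∀ {a t} → Cong a t → Cong (a -ᶻ pos b) (c + t)
    debt-Cong {a} {t} (q , eq) = q -ᶻ pos 1 , (begin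
      a -ᶻ pos b ≡⟨ cong (_-ᶻ pos b) eq ⟩
      (pos t +ᶻ q *ᶻ pos L) -ᶻ pos b ≡⟨ lem (pos t) (pos c) (pos b) (q *ᶻ pos L) ⟩
      (pos c +ᶻ pos t) +ᶻ (q *ᶻ pos L -ᶻ (pos b +ᶻ pos c)) ≡⟨ cong₂ (λ x y → x +ᶻ (q *ᶻ pos L -ᶻ y))
          (sym (ℤ.pos-+ c t)) (trans (sym (ℤ.pos-+ b c)) (cong pos (ℕ.m+[n∸m]≡n b≤L))) ⟩
      pos (c + t) +ᶻ (q *ᶻ pos L -ᶻ pos L) ≡⟨ cong (pos (c + t) +ᶻ_) (lem₂ q (pos L)) ⟩
      pos (c + t) +ᶻ (q -ᶻ pos 1) *ᶻ pos L ∎)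
      where
      open ≡-Reasoning
      lem : ∀ t c b q → (t +ᶻ q) -ᶻ b ≡ (c +ᶻ t) +ᶻ (q -ᶻ (b +ᶻ c))
      lem = ℤ-Solver.solve-∀
      lem₂ : ∀ q l → q *ᶻ l -ᶻ l ≡ (q -ᶻ pos 1) *ᶻ l
      lem₂ = ℤ-Solver.solve-∀

    debt-Cong⁻ : ∀ {a t} → Cong (a -ᶻ pos b) (c + t) → Cong a t
    debt-Cong⁻ {a} {t} (q , eq) = q +ᶻ pos 1 , (begin
      a ≡⟨ lem₀ a (pos b) ⟩
      (a -ᶻ pos b) +ᶻ pos b ≡⟨ cong (_+ᶻ pos b) (trans eq (cong (_+ᶻ q *ᶻ pos L) (ℤ.pos-+ c t))) ⟩
      ((pos c +ᶻ pos t) +ᶻ q *ᶻ pos L) +ᶻ pos b ≡⟨ lem (pos t) (pos c) (pos b) (q *ᶻ pos L) ⟩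
      pos t +ᶻ (q *ᶻ pos L +ᶻ (pos b +ᶻ pos c)) ≡⟨ cong (λ y → pos t +ᶻ (q *ᶻ pos L +ᶻ y))
          (trans (sym (ℤ.pos-+ b c)) (cong pos (ℕ.m+[n∸m]≡n b≤L))) ⟩
      pos t +ᶻ (q *ᶻ pos L +ᶻ pos L) ≡⟨ cong (pos t +ᶻ_) (lem₂ q (pos L)) ⟩
      pos t +ᶻ (q +ᶻ pos 1) *ᶻ pos L ∎)
      where
      open ≡-Reasoning
      lem₀ : ∀ a b → a ≡ (a -ᶻ b) +ᶻ b
      lem₀ = ℤ-Solver.solve-∀
      lem : ∀ t c b q → ((c +ᶻ t) +ᶻ q) +ᶻ b ≡ t +ᶻ (q +ᶻ (b +ᶻ c))
      lem = ℤ-Solver.solve-∀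
      lem₂ : ∀ q l → q *ᶻ l +ᶻ l ≡ (q +ᶻ pos 1) *ᶻ l
      lem₂ = ℤ-Solver.solve-∀

    tok-δJ : tok (Inst.Q J) (δ v) ≡ c + tok Q (δ v)
    tok-δJ = trans (tokJ (δ v)) (cong (_+ tok Q (δ v)) (trans (cong (λ y → c * bit y) (δ-refl v)) (ℕ.*-identityʳ c)))

    exempt : L ∣ tok (Inst.Q J) (δ v)
    exempt = m%n≡0⇒n∣m _ L (trans (cong (_% L) tok-δJ)
        (ℕ.+-cancelˡ-≡ b _ _ (trans (shift-≡ b (tok Q (δ v)) ℕ.≤-refl) (sym (ℕ.+-identityʳ b)))))

    base : Base I → Base J
    base bs = record
      { Vz = Vz ; noE = noE
      ; rno = All.++⁺ (rep b) rno
      ; par = λ B B⊆ → par-J B (outside-z Vz B⊆) (par B B⊆)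
      ; rootφ = subst (_≤ K) (sym ΦJ-V) rootφ
      ; root = Good-resp (sym netV) (sym tokV) (debt-Cong (proj₁ root) , ℤ.≤-trans
          (ℤ.i≤j⇒i-k≤j {net R V} (pos b) ℤ.≤-refl) (proj₂ root)) }
      where
      open Base bs hiding (Vz)
      rep : ∀ n → All (λ e → V (proj₁ e) ∧ V (proj₂ e) ≡ false) (replicate n (v , z))
      rep zero = []
      rep (suc n) = trans (cong (_∧ V z) Vv) Vz ∷ rep n
      netV : net (Inst.R J) V ≡ net R V -ᶻ pos b
      netV = trans (netJ [] V Vz) (cong (λ y → net R V -ᶻ pos y)
          (trans (cong (λ y → b * bit y) Vv) (ℕ.*-identityʳ b)))
      tokV : tok (Inst.Q J) V ≡ c + tok Q V
      tokV = trans (tokJ V) (cong (_+ tok Q V) (trans (cong (λ y → c * bit y) Vv) (ℕ.*-identityʳ c)))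

    dense : Dense I z → Dense J v
    dense d B pr p bp _ = ℕ.≤-trans (d B pr p bp λ { refl → clash Vz (proj₁ pr p bp) })
        (ΦJ-≥ B (outside-z Vz (proj₁ pr)))

    noLow : NoLow I → NoLow J
    noLow nl B pr p q bp bq ne = ℕ.≤-trans (nl B pr p q bp bq ne) (ΦJ-≥ B (outside-z Vz (proj₁ pr)))

    -- In J the vertex v is balanced, hence has net at most 0. Withdrawing the b dummy edges adds b,
    -- and b is a residue, hence at most L₁.
    debt-Sol : Sol J → Sol I
    debt-Sol (D , o , g) = D , o , fin
      where
      δvz : ∀ {u} → V u ≡ true → δ u z ≡ false
      δvz {u} Vu = δ-false {u} {z} λ { refl → clash Vz Vu }
      fin : ∀ u → V u ≡ true → Good (net (D ++ R) (δ u)) (tok Q (δ u))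
      fin u Vu with u Fin.≟ v
      ... | no ne = Good-resp (trans (netJ D (δ u) (δvz Vu))
          (trans (cong (λ y → net (D ++ R) (δ u) -ᶻ pos y) (z0 b)) (ℤ.+-identityʳ _)))
                      (trans (tokJ (δ u)) (cong (_+ tok Q (δ u)) (z0 c))) (g u Vu)
        where
        z0 : ∀ n → n * bit (δ u v) ≡ 0
        z0 n rewrite δ-false {u} {v} (λ eq → ne (sym eq)) = ℕ.*-zeroʳ n
      ... | yes refl = debt-Cong⁻ (proj₁ g′) , ℤ.≤-trans
          (subst (_≤ᶻ pos b) (lem a (pos b)) (ℤ.+-monoˡ-≤ (pos b) a′≤0)) (ℤ.+≤+ (%≤L₁ (tok Q (δ v))))
        where
        a = net (D ++ R) (δ v)
        lem : ∀ a b → (a -ᶻ b) +ᶻ b ≡ a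
        lem = ℤ-Solver.solve-∀
        net≡ : net (D ++ Inst.R J) (δ v) ≡ a -ᶻ pos b
        net≡ = trans (netJ D (δ v) (δvz Vu)) (cong (λ y → a -ᶻ pos y)
            (trans (cong (λ y → b * bit y) (δ-refl v)) (ℕ.*-identityʳ b)))
        g′ : Good (a -ᶻ pos b) (c + tok Q (δ v))
        g′ = Good-resp net≡ tok-δJ (g v Vu)
        a′≤0 : a -ᶻ pos b ≤ᶻ pos 0
        a′≤0 = balanced≤0 g′ (subst (L ∣_) tok-δJ exempt)

  -- Low sets and single vertices.

  Low : Inst → PSet → Set
  Low I B = Proper I B × (∃₂ λ p q → B p ≡ true × B q ≡ true × p ≢ q) × Φ I B ≤ K

  low? : ∀ I B → Dec (Low I B)
  low? I B = ((B ⊆? V I) ×-dec outside? B (V I)) ×-dec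
    (Fin.any? (λ p → Fin.any? λ q → (B p ≟ᵇ true) ×-dec ((B q ≟ᵇ true) ×-dec ¬? (p Fin.≟ q))) ×-dec (Φ I B ≤? K))

  low-resp : ∀ I {A B} → A ≐ B → Low I A → Low I B
  low-resp I eq ((A⊆V , y , Vy , Ay) , (p , q , ap , aq , ne) , le) =
    ((λ v bv → A⊆V v (trans (eq v) bv)) , y , Vy , trans (sym (eq y)) Ay) ,
    (p , q , trans (sym (eq p)) ap , trans (sym (eq q)) aq , ne) ,
    subst (_≤ K) (cong₂ (λ x t → x + t % L) (cong₂ _+_ (cut-ext eq (E I)) (cut-ext eq (R I))) (tok-ext eq (Q I))) le

  -- Φ B is even by `par`, because L is even, and K is even too; so exceeding K means reaching K +
  -- 2.
  noLow : ∀ I → Base I → (∀ B → ¬ Low I B) → NoLow I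
  noLow I b none B pr p q bp bq ne with ℕ.m<1+n⇒m<n∨m≡n (s≤s (ℕ.≰⇒> λ le → none B (pr , (p , q , bp , bq , ne) , le)))
  ... | inj₁ lt = lt
  ... | inj₂ eq = ⊥-elim (odd (∣m+n∣m⇒∣n (subst (2 ∣_) (trans (sym eq) (ℕ.+-comm 1 K))
      (2∣-% (deg I B) (tok (Q I) B) (Base.par b B (proj₁ pr)))) 2∣K))
    where
    odd : ¬ 2 ∣ 1
    odd (divides zero ())
    odd (divides (suc q) ())

  -- As r differs from v₀, an exempt vertex in A disappears from the outer instance and stays exempt
  -- in the inner one; an exempt vertex outside A stays exempt in the outer one. The second element
  -- of A makes the outer instance smaller, properness the inner one.
  contract-low : ∀ I v₀ → Hyp I v₀ → ∀ A r → Proper I A → A r ≡ true → r ≢ v₀ → (∃ λ x → A x ≡ true × x ≢ r) →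
      Φ I A ≤ K →
                 Solve< (size (V I)) → Sol I
  contract-low I v₀ (b , d , e) A r (A⊆V , y , Vy , Ay) Ar r≢ (x , Ax , x≢r) le solve< =
    glue o gs (solve< (inner D) v₀ (size-mono-< A⊆V y Ay Vy)
        (inner-Base o b le gA , inner-Dense o d , λ Av → e (A⊆V v₀ Av)))
    where
    open Contraction I {A} {r} A⊆V Ar (split A (E I))
    dense : Dense outer v₀
    dense B pr p bp p≢ = subst (K ≤_) (sym (Φ-outer B))
        (d (B ∘ κ) (pull-Proper pr) p (pull-self {B} p (proj₁ pr p bp) bp) p≢)
    exempt : Exempt outer v₀
    exempt Jv₀ with ≡true∨false (A v₀)
    ... | inj₁ a = ⊥-elim (r≢ (sym (shrunk-in a Jv₀)))
    ... | inj₂ a = subst (L ∣_) (sym (trans (tok-map κ (Q I) (δ v₀)) (tok-ext (δκ-out a) (Q I))))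
        (e (shrunk-⊆ v₀ Jv₀))
    os = fromOuter (solve< outer v₀ (outer-size-< x Ax x≢r) (outer-Base b , dense , exempt))
    D = proj₁ os
    o = proj₁ (proj₂ os)
    gA = proj₁ (proj₂ (proj₂ os))
    gs = proj₂ (proj₂ (proj₂ os))

  single : ∀ I → Base I → ∀ p → (∀ q → V I q ≡ true → q ≡ p) → Sol I
  single I b p only = E I , Ornt-refl (E I) , λ v Vv → Good-resp
    (trans (sym (trans (net-++ (E I) (R I) (V I))
        (trans (cong (_+ᶻ net (R I) (V I)) (cut≡0⇒net≡0 (E I) (V I) noE)) (ℤ.+-identityˡ _))))
           (net-ext (only⇒≐ only v Vv) (E I ++ R I))) (tok-ext (only⇒≐ only v Vv) (Q I)) root
    where open Base b

  -- No exempt vertex, and the residue of V below L - 1.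

  module Last {V E R Q} (b : Base (inst V E R Q)) (d : Dense (inst V E R Q) z) (e< : tok Q V % L < L₁) where
    open Base b
    I = inst V E R Q

    -- The net degree of V is at most L₁ and cannot equal it, its residue being smaller, so it may
    -- grow by 1. The redirected edge no longer meets V, so fewer edges of R cross V.
    out-step : ∀ x w S → V x ≡ true → V w ≡ false → R ≋ (x , w) ∷ S →
               (∀ J v₀ → size (Inst.V J) ≤ size V → length (Inst.E J) ≤ length E → cut (Inst.R J)
                   (Inst.V J) < cut R V → Hyp J v₀ → Sol J) →
               Solve< (size V) → Sol I
    out-step x w S Vx Vw R≋ solveR solve< = reSol {Q = Q} ≃-refl R≋
      (out-edge (suc (size V)) x w V E S Q ℕ.≤-refl Vx Vw base⁺ (proj₁ (proj₂ hyp))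
        (λ J v₀ n≤ m≤ r≤ → solveR J v₀ n≤ m≤ (ℕ.≤-<-trans r≤ cut<)) solve<)
      where
      hyp = reHyp ≃-refl R≋ (b , d , λ Vz′ → clash Vz Vz′)
      b′ = proj₁ hyp
      cutS : cut ((z , w) ∷ S) V ≡ cut S V
      cutS rewrite Vz | Vw = refl
      cutRS : cut R V ≡ suc (cut S V)
      cutRS = trans (≋cut R≋ V) (cong₂ (λ a c → bit (a xor c) + cut S V) Vx Vw)
      cut< : cut ((z , w) ∷ S) V < cut R V
      cut< = subst (cut ((z , w) ∷ S) V <_) (sym cutRS) (s≤s (ℕ.≤-reflexive cutS))
      net⁺ : net ((z , w) ∷ S) V ≡ pos 1 +ᶻ net R V
      net⁺ = trans (cong₂ (λ a c → (i a -ᶻ i c) +ᶻ net S V) Vw Vz)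
          (trans (lem (net S V)) (cong (pos 1 +ᶻ_)
          (sym (trans (≋net R≋ V) (cong₂ (λ a c → (i a -ᶻ i c) +ᶻ net S V) Vw Vx)))))
        where
        lem : ∀ s → (pos 0 -ᶻ pos 0) +ᶻ s ≡ pos 1 +ᶻ ((pos 0 -ᶻ pos 1) +ᶻ s)
        lem = ℤ-Solver.solve-∀
      net<L₁ : net R V ≢ pos L₁
      net<L₁ eq = ℕ.<⇒≢ e< (sym (residue (subst (λ a → Cong a (tok Q V)) eq (proj₁ root)) ℕ.≤-refl))
      suc≤ : pos 1 +ᶻ net R V ≤ᶻ pos L₁
      suc≤ = ℤ.i<j⇒suc[i]≤j (ℤ.≤∧≢⇒< (proj₂ root) net<L₁)
      base⁺ : Base (inst V E ((z , w) ∷ S) (x ∷ Q))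
      base⁺ = record
        { Vz = Vz ; noE = noE ; rno = cong (_∧ V w) Vz ∷ All.tail (Base.rno b′)
        ; par = λ B B⊆ → Op.op-par V E S Q x w B (outside-z Vz B⊆) (Base.par b′ B B⊆)
        ; rootφ = ℕ.≤-trans (ℕ.≤-trans (ℕ.≤-reflexive
            (cong₂ (λ a t → cut E V + a + t % L) cutS (cong (λ y → bit y + tok Q V) Vx)))
                    (ℕ.+-monoʳ-≤ (cut E V + cut S V) (suc-%-≤ (tok Q V))))
                    (ℕ.≤-trans (ℕ.≤-reflexive (trans (lem (cut E V) (cut S V) (tok Q V % L))
                        (cong (λ a → cut E V + a + tok Q V % L) (sym cutRS)))) rootφ)
        ; root = Good-resp (sym net⁺) (cong (λ y → bit y + tok Q V) (sym Vx)) (Cong-suc (proj₁ root) , suc≤) }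
        where
        lem : ∀ a b c → a + b + suc c ≡ a + suc b + c
        lem = ℕ-Solver.solve-∀

    -- Here all boundary edges of V enter it, so their number is the net degree of V and hence
    -- equals the residue `a`, which is less than L₁. Progress must come from an edge of E.
    in-step : net R V ≡ pos (cut R V) → ∀ p q → V p ≡ true → V q ≡ true → p ≢ q →
              (∀ J v₀ → size (Inst.V J) ≤ size V → length (Inst.E J) < length E → Hyp J v₀ → Sol J) →
              Solve< (size V) → Sol I
    in-step net≡ p₀ q₀ Vp Vq p≢q solveE solve< = go (searchSet {λ B → ∃ (λ p → B p ≡ true) × Tight₀ B} dec resp)
      where
      a = tok Q V % L
      cutR : cut R V ≡ a
      cutR = residue (subst (λ x → Cong x (tok Q V)) net≡ (proj₁ root))
          (ℤ.drop‿+≤+ (subst (_≤ᶻ pos L₁) net≡ (proj₂ root)))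
      Tight₀ : PSet → Set
      Tight₀ B = Proper I B × tok Q B % L ≡ L₁ × deg I B ≤ K
      dec : ∀ B → Dec (∃ (λ p → B p ≡ true) × Tight₀ B)
      dec B = Fin.any? (λ p → B p ≟ᵇ true) ×-dec
          (((B ⊆? V) ×-dec outside? B V) ×-dec ((tok Q B % L ℕ.≟ L₁) ×-dec (deg I B ≤? K)))
      resp : ∀ {A B} → A ≐ B → ∃ (λ p → A p ≡ true) × Tight₀ A → ∃ (λ p → B p ≡ true) × Tight₀ B
      resp {A} {B} eq ((p , ap) , (A⊆V , q , Vq , Aq) , e , le) = (p , trans (sym (eq p)) ap) ,
        ((λ v bv → A⊆V v (trans (eq v) bv)) , q , Vq , trans (sym (eq q)) Aq) ,
        trans (cong (_% L) (sym (tok-ext eq Q))) e , subst (_≤ K) (cong₂ _+_ (cut-ext eq E) (cut-ext eq R)) le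
      cutR-mono : ∀ {A} → A ⊆ V → cut R A ≤ cut R V
      cutR-mono {A} A⊆V = subst (cut R A ≤_) (sym (cutR-⊕ {A} {C} {V} part rno)) (ℕ.m≤m+n _ _)
        where
        C : PSet
        C x = V x ∧ not (A x)
        part : A ⊕ C ≐ V
        part x with A x in ax
        ... | true rewrite A⊆V x ax = refl
        ... | false with V x
        ... | true = refl
        ... | false = refl
      -- The value 2 L₁ of the threshold is decisive here: the residue accounts for at most L₁ of Φ
      -- A and the edges of R for less than L₁, so some edge of E crosses A.
      leaving : ∀ A p → Proper I A → A p ≡ true → 0 < cut E A
      leaving A p pr Ap = ℕ.≤-trans (s≤s z≤n) (lin {1} {cut E A} 0
          (ℕ.+-mono-≤ (ℕ.+-mono-≤ big (%≤L₁ (tok Q A))) small) (lem (cut E A) (cut R A) (tok Q A % L) L₁))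
        where
        big : K ≤ Φ I A
        big = d A pr p Ap λ { refl → clash Vz (proj₁ pr p Ap) }
        small : suc (cut R A) ≤ L₁
        small = ℕ.≤-<-trans (ℕ.≤-trans (cutR-mono (proj₁ pr)) (ℕ.≤-reflexive cutR)) e<
        lem : ∀ e r t l → e + (((l + l) + t) + suc r) ≡ 1 + (((e + r + t) + l) + l) + 0
        lem = ℕ-Solver.solve-∀
      -- I₂ has the chosen edge directed from x to u although both ends lie in V; moving its source
      -- to z turns it into a boundary edge.
      module Commit (x u : X) (F : List Edge) (Vx : V x ≡ true) (E≃ : E ≃ (x , u) ∷ F) where
        I₂ I⁺ : Inst
        I₂ = inst V F ((x , u) ∷ R) Q
        I⁺ = inst V F ((z , u) ∷ R) (x ∷ Q)
        deg₂ : ∀ B → deg I B ≡ deg I₂ B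
        deg₂ B = trans (cong (_+ cut R B) (≃cut E≃ B)) (lem (bit (B x xor B u)) (cut F B) (cut R B))
          where
          lem : ∀ a b c → (a + b) + c ≡ b + (a + c)
          lem = ℕ-Solver.solve-∀
        dense₂ : Dense I₂ z
        dense₂ B pr p bp ne = subst (λ x → K ≤ x + tok Q B % L) (deg₂ B) (d B pr p bp ne)
        cutEV : bit (V x xor V u) + cut F V ≡ 0
        cutEV = trans (sym (≃cut E≃ V)) noE
        Vu : V u ≡ true
        Vu = edge-in {V} {x} {u} {F} Vx cutEV
        base⁺ : Base I⁺
        base⁺ = record
          { Vz = Vz ; noE = ℕ.m+n≡0⇒n≡0 (bit (V x xor V u)) cutEV ; rno = cong (_∧ V u) Vz ∷ rno
          ; par = λ B B⊆ → Op.op-par V F R Q x u B (outside-z Vz B⊆)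
              (subst (λ t → 2 ∣ t + tok Q B) (deg₂ B) (par B B⊆))
          ; rootφ = rootφ⁺
          ; root = Good-resp (cong₂ (λ a c → (i a -ᶻ i c) +ᶻ net R V) (sym Vu) (sym Vz))
              (cong (λ y → bit y + tok Q V) (sym Vx))
                     (Cong-suc (proj₁ root) , subst (λ y → pos 1 +ᶻ y ≤ᶻ pos L₁) (sym net≡)
                         (ℤ.+≤+ (subst (λ y → suc y ≤ L₁) (sym cutR) e<))) }
          where
          -- The degree becomes a + 1 and the residue is at most a + 1; both are at most L₁.
          rootφ⁺ : Φ I⁺ V ≤ K
          rootφ⁺ rewrite ℕ.m+n≡0⇒n≡0 (bit (V x xor V u)) cutEV | Vu | Vz | Vx | cutR =
            ℕ.+-mono-≤ e< (ℕ.≤-trans (suc-%-≤ (tok Q V)) e<)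
        len< : length F < length E
        len< = ℕ.≤-reflexive (sym (≃len E≃))
        back : Sol I₂ → Sol I
        back (D , o , g) with ≃or E≃ (keep o)
        ... | D′ , o′ , n = D′ , o′ , λ v Vv → Good-resp (eq (δ v)) refl (g v Vv)
          where
          eq : ∀ B → net (D ++ (x , u) ∷ R) B ≡ net (D′ ++ R) B
          eq B = trans (net-++ D ((x , u) ∷ R) B) (trans (swapℤ (net D B) (i (B u) -ᶻ i (B x)) (net R B))
                 (trans (sym (ℤ.+-assoc (i (B u) -ᶻ i (B x)) (net D B) (net R B)))
                     (trans (cong (_+ᶻ net R B) (sym (n B))) (sym (net-++ D′ R B)))))
        tight⇒ : ∀ {B} → Op.Tight V F R Q x u B → Tight₀ B
        tight⇒ {B} (pr , e , le) = pr , e , subst (_≤ K) (sym (deg₂ B)) le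
      go : (∃ λ B → ∃ (λ p → B p ≡ true) × Tight₀ B) ⊎ (∀ B → ¬ (∃ (λ p → B p ≡ true) × Tight₀ B)) → Sol I
      go (inj₂ none) with pick E (δ p₀) (leaving (δ p₀) p₀ pr (δ-refl p₀))
        where
        pr : Proper I (δ p₀)
        pr = (λ x dx → subst (λ y → V y ≡ true) (sym (δ-true {p₀} {x} dx)) Vp) , q₀ , Vq , δ-false {p₀} {q₀}
            λ eq → p≢q (sym eq)
      ... | x , u , F , δx , _ , E≃ = back (Op.out-free V F R Q x u base⁺ dense₂ Vx
          (λ B bx t → none B ((x , bx) , tight⇒ t))
                                        λ hyp → solveE I⁺ z ℕ.≤-refl len< hyp)
        where
        Vx : V x ≡ true
        Vx = subst (λ y → V y ≡ true) (sym (δ-true {p₀} {x} δx)) Vp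
        open Commit x u F Vx E≃
      go (inj₁ (A₀ , ne₀ , t₀)) with maximalSet dec resp A₀ (ne₀ , t₀)
      -- The edge is taken across the boundary of the maximal tight set, so that this set contains x
      -- but not u.
      ... | A , A₀⊆A , ((p , Ap) , tA) , mx with pick E A (leaving A p (proj₁ tA) Ap)
      ... | x , u , F , Ax , Au , E≃ = back (Op.out-tight V F R Q x u base⁺ dense₂ A Ax Au
            (proj₁ tA , proj₁ (proj₂ tA) , subst (_≤ K) (deg₂ A) (proj₂ (proj₂ tA)))
            (λ C A⊆C tC → mx C A⊆C ((x , A⊆C x Ax) , tight⇒ tC))
            (λ J v₀ n≤ m≤ r≤ hyp → solveE J v₀ n≤ (ℕ.≤-<-trans m≤ len<) hyp)
            λ V′ E′ R′ Q′ lt V′x V′u b′ d′ → out-edge (suc (size V′)) x u V′ E′ R′ Q′ ℕ.≤-refl V′x V′u b′ d′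
              (λ J v₀ le _ _ hyp → solve< J v₀ (ℕ.≤-<-trans le lt) hyp)
              (λ J v₀ lt′ hyp → solve< J v₀ (ℕ.<-trans lt′ lt) hyp))
        where
        Vx : V x ≡ true
        Vx = proj₁ (proj₁ tA) x Ax
        open Commit x u F Vx E≃

  -- The induction.

  step : ∀ I v₀ → Hyp I v₀ → Solve< (size (V I)) → SolveE< (size (V I)) (length (E I)) →
         (∀ J v₁ → size (V J) ≤ size (V I) → length (E J) ≤ length (E I) → cut (R J) (V J) < cut (R I)
             (V I) → Hyp J v₁ → Sol J) → Sol I
  step I@(inst V E R Q) v₀ hyp@(b , d , e) solve< solveE solveR with Fin.any? (λ p → V p ≟ᵇ true)
  ... | no none = E , Ornt-refl E , λ v Vv → ⊥-elim (none (v , Vv))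
  ... | yes (p , Vp) with Fin.any? (λ q → (V q ≟ᵇ true) ×-dec ¬? (q Fin.≟ p))
  ... | no none = single I b p λ q Vq → decidable-stable (q Fin.≟ p) λ ne → none (q , Vq , ne)
  ... | yes (q , Vq , q≢p) with searchSet {Low I} (low? I) (low-resp I)
  ... | inj₁ (A , pr , (x , y , Ax , Ay , x≢y) , le) = contract
    where
    contract : Sol I
    contract with x Fin.≟ v₀
    ... | no ne = contract-low I v₀ hyp A x pr Ax ne (y , Ay , λ eq → x≢y (sym eq)) le solve<
    ... | yes refl = contract-low I v₀ hyp A y pr Ay (λ eq → x≢y (sym eq)) (x , Ax , x≢y) le solve<
  ... | inj₂ none with ≡true∨false (V v₀)
  ... | inj₁ Vv₀ = elim I v₀ b d Vv₀ (e Vv₀) (proj₁ other) (proj₁ (proj₂ other)) (proj₂ (proj₂ other))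
      (noLow I b none) solve< solveE
    where
    other : ∃ λ y → V y ≡ true × y ≢ v₀
    other with p Fin.≟ v₀
    ... | no ne = p , Vp , ne
    ... | yes refl = q , Vq , q≢p
  ... | inj₂ Vv₀ with Fin.any? (λ v → (V v ≟ᵇ true) ×-dec (tok Q (δ v) % L ≤? tok Q V % L))
  -- The dummy edges enlarge R, which is harmless: `elim` calls the induction only with fewer
  -- vertices or fewer edges of E.
  ... | yes (v , Vv , le) = debt-Sol (elim J v (base b) (dense dz) Vv exempt (proj₁ other) (proj₁ (proj₂ other))
      (proj₂ (proj₂ other)) (Debt.noLow V E R Q v (Base.Vz b) Vv le (noLow I b none)) solve< solveE)
    where
    open Debt V E R Q v (Base.Vz b) Vv le using (J; base; dense; exempt; debt-Sol)
    dz : Dense I z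
    dz B pr y by _ = d B pr y by λ { refl → clash Vv₀ (proj₁ pr y by) }
    other : ∃ λ y → V y ≡ true × y ≢ v
    other with p Fin.≟ v
    ... | no ne = p , Vp , ne
    ... | yes refl = q , Vq , q≢p
  ... | no ¬small = last (pickOut R V)
    where
    dz : Dense I z
    dz B pr y by _ = d B pr y by λ { refl → clash Vv₀ (proj₁ pr y by) }
    e< : tok Q V % L < L₁
    e< = ℕ.<-≤-trans (ℕ.≰⇒> λ le → ¬small (p , Vp , le)) (%≤L₁ (tok Q (δ p)))
    last : (∃₂ λ x w → ∃ λ S → V x ≡ true × V w ≡ false × R ≋ (x , w) ∷ S) ⊎ net R V ≡ pos (cut R V) → Sol I
    last (inj₁ (x , w , S , Vx , Vw , R≋)) = Last.out-step b dz e< x w S Vx Vw R≋ solveR solve<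
    last (inj₂ net≡) = Last.in-step b dz e< net≡ q p Vq Vp q≢p solveE solve<

  -- Lexicographic induction on the number of vertices, the number of edges of E and the number of
  -- edges of R crossing V.
  solve : ∀ I v₀ → Hyp I v₀ → Sol I
  solve I v₀ hyp = byN (suc (size (V I))) I v₀ ℕ.≤-refl hyp
    where
    byR : ∀ n m → Solve< n → SolveE< n m → ∀ r J v₀ → size (V J) ≤ n → length (E J) ≤ m → cut (R J) (V J) < r →
        Hyp J v₀ → Sol J
    byR n m s< sE (suc r) J v₀ n≤ m≤ r< hyp = step J v₀ hyp
      (λ J′ v′ lt → s< J′ v′ (ℕ.<-≤-trans lt n≤))
      (λ J′ v′ le lt → sE J′ v′ (ℕ.≤-trans le n≤) (ℕ.<-≤-trans lt m≤))
      (λ J′ v′ le le′ lt → byR n m s< sE r J′ v′ (ℕ.≤-trans le n≤) (ℕ.≤-trans le′ m≤) (ℕ.<-≤-trans lt (ℕ.≤-pred r<)))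
    byE : ∀ n → Solve< n → ∀ m → SolveE< n m
    byE n s< (suc m) J v₀ n≤ m< hyp = byR n m s< (byE n s< m) (suc (cut (R J) (V J))) J v₀ n≤
        (ℕ.≤-pred m<) ℕ.≤-refl hyp
    byN : ∀ n → Solve< n
    byN (suc n) J v₀ n< hyp = byE n (byN n) (suc (length (E J))) J v₀ (ℕ.≤-pred n<) ℕ.≤-refl hyp

-- Stars from in-neighbourhoods

∑-cong : ∀ {n} {f g : Fin n → ℕ} → (∀ i → f i ≡ g i) → ∑ f ≡ ∑ g
∑-cong {zero}  f≡g = refl
∑-cong {suc n} f≡g = cong₂ _+_ (f≡g zero) (∑-cong (f≡g ∘ suc))

∣∣≡∑ : ∀ {n} (p : Subset n) → ∣ p ∣ ≡ ∑ (bit ∘ lookup p)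
∣∣≡∑ []          = refl
∣∣≡∑ (true  ∷ p) = cong suc (∣∣≡∑ p)
∣∣≡∑ (false ∷ p) = ∣∣≡∑ p

choose-subset : ∀ {n} k (p : Subset n) → k ≤ ∣ p ∣ →
  ∃₂ λ (s r : Subset n) → ∣ s ∣ ≡ k × k + ∣ r ∣ ≡ ∣ p ∣ ×
    (∀ x → lookup s x ∨ lookup r x ≡ lookup p x) × (∀ x → lookup s x ∧ lookup r x ≡ false)
choose-subset zero    []          le = [] , [] , refl , refl , (λ ()) , (λ ())
choose-subset k       (false ∷ p) le =
  let s , r , sk , sr , u , d = choose-subset k p le in
  false ∷ s , false ∷ r , sk , sr , (λ { zero → refl ; (suc x) → u x }) , (λ { zero → refl ; (suc x) → d x })
choose-subset zero    (true ∷ p)  le =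
  let s , r , sk , sr , u , d = choose-subset zero p z≤n in
  false ∷ s , true ∷ r , sk , cong suc sr , (λ { zero → refl ; (suc x) → u x }) , (λ { zero → refl ; (suc x) → d x })
choose-subset (suc k) (true ∷ p) (s≤s le) =
  let s , r , sk , sr , u , d = choose-subset k p le in
  true ∷ s , false ∷ r , cong suc sk , cong suc sr , (λ { zero → refl ; (suc x) → u x }) ,
      (λ { zero → refl ; (suc x) → d x })

record Peeling {n : ℕ} (k : ℕ) (f : Fin n → Subset n) : Set where
  field
    {m}    : ℕ
    S      : Vec (Star n) m
    size-k : ∀ a → ∣ leaves (lookup S a) ∣ ≡ k
    inside : ∀ a x → x ∈ leaves (lookup S a) → x ∈ f (centre (lookup S a))
    unique : ∀ v x → x ∈ f v → ∃! _≡_ λ a → v ≡ centre (lookup S a) × x ∈ leaves (lookup S a)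

-- A nonempty neighbourhood whose size is divisible by k has at least k elements, and removing k of
-- them keeps divisibility. The total size serves as fuel.
peel : ∀ {n} k .{{_ : NonZero k}} (f : Fin n → Subset n) → (∀ v → k ∣ ∣ f v ∣) → Peeling k f
peel {n} k@(suc k-1) f div = go (suc (∑ (∣_∣ ∘ f))) f div ℕ.≤-refl
  where
  go : ∀ fuel (f : Fin n → Subset n) → (∀ v → k ∣ ∣ f v ∣) → ∑ (∣_∣ ∘ f) < fuel → Peeling k f
  go (suc fuel) f div lt with Fin.any? (λ v → 1 ≤? ∣ f v ∣)
  ... | no none = record { S = [] ; size-k = λ () ; inside = λ () ; unique = λ v x x∈ → ⊥-elim
      (none (v , nonempty (f v) x x∈)) }
    where
    nonempty : ∀ {n} (p : Subset n) x → x ∈ p → 1 ≤ ∣ p ∣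
    nonempty (true ∷ p)  x x∈ = s≤s z≤n
    nonempty (false ∷ p) (suc x) (Data.Vec.there x∈) = nonempty p x x∈
  ... | yes (v , 1≤) with choose-subset k (f v) (∣⇒≤ {{>-nonZero 1≤}} (div v))
  ... | s , r , sk , sr , union , disjoint = record
    { S = star v s ∷ Peeling.S rec
    ; size-k = λ { zero → sk ; (suc a) → Peeling.size-k rec a }
    ; inside = λ { zero x x∈s → lookup⇒[]= x (f v) (trans (sym (union x)) (cong (_∨ lookup r x) ([]=⇒lookup x∈s)))
                 ; (suc a) x x∈ → f′⊆f (centre (lookup (Peeling.S rec) a)) x (Peeling.inside rec a x x∈) }
    ; unique = uniq }
    where
    f′ : Fin n → Subset n
    f′ u with u Fin.≟ v
    ... | yes _ = r
    ... | no  _ = f u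
    f′≤f : ∀ u → ∣ f′ u ∣ ≤ ∣ f u ∣
    f′≤f u with u Fin.≟ v
    ... | yes refl = subst (∣ r ∣ ≤_) sr (ℕ.m≤n+m ∣ r ∣ k)
    ... | no  _ = ℕ.≤-refl
    f′<f : ∣ f′ v ∣ < ∣ f v ∣
    f′<f with v Fin.≟ v
    ... | yes refl = subst (∣ r ∣ <_) sr (ℕ.m<n+m ∣ r ∣ (s≤s z≤n))
    ... | no ne = ⊥-elim (ne refl)
    div′ : ∀ u → k ∣ ∣ f′ u ∣
    div′ u with u Fin.≟ v
    ... | yes refl = ∣m+n∣m⇒∣n (subst (k ∣_) (sym sr) (div v)) ∣-refl
    ... | no  _ = div u
    f′⊆f : ∀ u x → x ∈ f′ u → x ∈ f u
    f′⊆f u x x∈ with u Fin.≟ v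
    ... | no  _ = x∈
    ... | yes refl = lookup⇒[]= x (f v) (trans (sym (union x)) (∨-trueʳ (lookup s x) ([]=⇒lookup x∈)))
      where
      ∨-trueʳ : ∀ a {b} → b ≡ true → a ∨ b ≡ true
      ∨-trueʳ true  _ = refl
      ∨-trueʳ false eq = eq
    rec : Peeling k f′
    rec = go fuel f′ div′ (ℕ.<-≤-trans (∑-mono-< f′≤f v f′<f) (ℕ.≤-pred lt))
    S′ = Peeling.S rec
    not-in-s : ∀ {x} → x ∈ f′ v → x ∈ s → ⊥
    not-in-s {x} x∈ x∈s with v Fin.≟ v
    ... | yes refl = clash (disjoint x) (cong₂ _∧_ ([]=⇒lookup x∈s) ([]=⇒lookup x∈))
    ... | no ne = ne refl
    uniq : ∀ u x → x ∈ f u → ∃! _≡_ λ a → u ≡ centre (lookup (star v s ∷ S′) a) ×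
        x ∈ leaves (lookup (star v s ∷ S′) a)
    uniq u x x∈ with case u x x∈
      where
      case : ∀ u x → x ∈ f u → (u ≡ v × x ∈ s) ⊎ (x ∈ f′ u × ¬ (u ≡ v × x ∈ s))
      case u x x∈ with u Fin.≟ v
      ... | no ne = inj₂ (x∈ , λ (eq , _) → ne eq)
      ... | yes refl with lookup s x in sx
      ... | true  = inj₁ (refl , lookup⇒[]= x s sx)
      ... | false = inj₂ (lookup⇒[]= x r (trans (cong (_∨ lookup r x) (sym sx)) (trans (union x) ([]=⇒lookup x∈))) ,
          λ (_ , x∈s) → clash sx ([]=⇒lookup x∈s))
    ... | inj₁ (refl , x∈s) = zero , (refl , x∈s) ,
        λ { {zero} _ → refl ; {suc b} (eq , x∈b) → ⊥-elim
        (not-in-s (subst (λ c → x ∈ f′ c) (sym eq) (Peeling.inside rec b x x∈b)) x∈s) }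
    ... | inj₂ (x∈′ , ns) with Peeling.unique rec u x x∈′
    ... | a , pa , ua = suc a , pa , λ { {zero} p → ⊥-elim (ns p) ; {suc b} p → cong suc (ua p) }

module _ {n k : ℕ} .{{_ : NonZero k}} {G : Digraph n} (simple : IsSimple G) (f : Fin n → Subset n)
         (div : ∀ v → k ∣ ∣ f v ∣) (f⊆G : ∀ v x → x ∈ f v → Adj G v x)
         (total : ∀ i j → Adj G i j → j ∈ f i ⊎ i ∈ f j) (anti : ∀ i j → j ∈ f i → i ∈ f j → ⊥) where

  starDecomposition : HasStarDecomposition k G
  starDecomposition = _ , S , record
    { isKStar = λ a → (λ c∈ → irreflexive _ (f⊆G _ _ (inside a _ c∈))) , size-k a
    ; subgraph = λ { a i j (inj₁ (refl , j∈)) → f⊆G _ _ (inside a j j∈)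
                   ; a i j (inj₂ (refl , i∈)) → symmetric _ _ (f⊆G _ _ (inside a i i∈)) }
    ; covered = cov }
    where
    open IsSimple simple
    open Peeling (peel k f div)
    cov : ∀ i j → Adj G i j → ∃! _≡_ λ a → StarEdge (lookup S a) i j
    cov i j ij with total i j ij
    ... | inj₁ j∈ = let a , p , u = unique i j j∈ in a , inj₁ p ,
          λ { (inj₁ q) → u q ; {b} (inj₂ (eq , i∈)) → ⊥-elim
              (anti i j j∈ (subst (λ c → i ∈ f c) (sym eq) (inside b i i∈))) }
    ... | inj₂ i∈ = let a , p , u = unique j i i∈ in a , inj₂ p ,
          λ { (inj₂ q) → u q ; {b} (inj₁ (eq , j∈)) → ⊥-elim
              (anti j i i∈ (subst (λ c → j ∈ f c) (sym eq) (inside b j j∈))) }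

∑-zero : ∀ n → ∑ {n} (λ _ → 0) ≡ 0
∑-zero zero    = refl
∑-zero (suc n) = ∑-zero n

∑-+ : ∀ {n} (f g : Fin n → ℕ) → ∑ (λ i → f i + g i) ≡ ∑ f + ∑ g
∑-+ {zero}  f g = refl
∑-+ {suc n} f g = trans (cong (f zero + g zero +_) (∑-+ (f ∘ suc) (g ∘ suc)))
    (+-interchange (f zero) (g zero) (∑ (f ∘ suc)) (∑ (g ∘ suc)))

∑-*ˡ : ∀ {n} c (f : Fin n → ℕ) → ∑ (λ i → c * f i) ≡ c * ∑ f
∑-*ˡ {zero}  c f = sym (ℕ.*-zeroʳ c)
∑-*ˡ {suc n} c f = trans (cong (c * f zero +_) (∑-*ˡ c (f ∘ suc))) (sym (ℕ.*-distribˡ-+ c (f zero) (∑ (f ∘ suc))))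

∑-*ʳ : ∀ {n} (f : Fin n → ℕ) c → ∑ (λ i → f i * c) ≡ ∑ f * c
∑-*ʳ f c = trans (∑-cong (λ i → ℕ.*-comm (f i) c)) (trans (∑-*ˡ c f) (ℕ.*-comm c (∑ f)))

∑-swap : ∀ {m n} (f : Fin m → Fin n → ℕ) → ∑ (λ i → ∑ (f i)) ≡ ∑ (λ j → ∑ (λ i → f i j))
∑-swap {zero}  {n} f = sym (∑-zero n)
∑-swap {suc m} f = trans (cong (∑ (f zero) +_) (∑-swap (f ∘ suc))) (sym (∑-+ (f zero) (λ j → ∑ (λ i → f (suc i) j))))

∑-const : ∀ n c → ∑ {n} (λ _ → c) ≡ n * c
∑-const zero    c = refl
∑-const (suc n) c = cong (c +_) (∑-const n c)

∑-zero′ : ∀ {n} {f : Fin n → ℕ} → (∀ i → f i ≡ 0) → ∑ f ≡ 0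
∑-zero′ {n} eq = trans (∑-cong eq) (∑-zero n)

∑-single : ∀ {n} {f : Fin n → ℕ} (x : Fin n) → (∀ i → i ≢ x → f i ≡ 0) → ∑ f ≡ f x
∑-single {f = f} zero    eq = trans (cong (f zero +_) (∑-zero′ (λ i → eq (suc i) λ ()))) (ℕ.+-identityʳ _)
∑-single {f = f} (suc x) eq = cong₂ _+_ (eq zero λ ()) (∑-single x (λ i ne → eq (suc i) (ne ∘ Fin.suc-injective)))

-- Adjacency matrices and edge lists

Matrix : ℕ → Set
Matrix n = Fin n → Fin n → Bool

Symmetric Irreflexive : ∀ {n} → Matrix n → Set
Symmetric   a = ∀ i j → a i j ≡ a j i
Irreflexive a = ∀ i → a i i ≡ false

cutM : ∀ {n} → Matrix n → (Fin n → Bool) → ℕ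
cutM a B = ∑ λ i → ∑ λ j → bit (a i j ∧ (B i ∧ not (B j)))

-- Off the diagonal the entries come in equal pairs.
∑∑-even : ∀ {n} (s : Fin n → Fin n → ℕ) → (∀ i j → s i j ≡ s j i) → (∀ i → s i i ≡ 0) → 2 ∣ ∑ λ i → ∑ (s i)
∑∑-even {zero}  s sm zr = divides 0 refl
∑∑-even {suc n} s sm zr = subst (2 ∣_) (sym eq) (∣m∣n⇒∣m+n (m∣m*n T)
    (∑∑-even (λ i j → s (suc i) (suc j)) (λ i j → sm (suc i) (suc j)) (λ i → zr (suc i))))
  where
  T = ∑ (λ j → s zero (suc j))
  W = ∑ λ i → ∑ λ j → s (suc i) (suc j)
  eq : ∑ (λ i → ∑ (s i)) ≡ 2 * T + W
  eq = begin
    (s zero zero + T) + ∑ (λ i → s (suc i) zero + ∑ (λ j → s (suc i) (suc j))) ≡⟨ cong₂ (λ x y → x + T + y) (zr zero)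
        (trans (∑-+ (λ i → s (suc i) zero) _) (cong (_+ W) (∑-cong (λ i → sm (suc i) zero)))) ⟩
    T + (T + W) ≡⟨ lem T W ⟩
    2 * T + W ∎
    where
    open ≡-Reasoning
    lem : ∀ t w → t + (t + w) ≡ 2 * t + w
    lem = ℕ-Solver.solve-∀

record RegularM {n} (d : ℕ) (a : Matrix n) : Set where
  field
    symm : Symmetric a
    irr  : Irreflexive a
    reg  : ∀ i → ∑ (bit ∘ a i) ≡ d

toM : ∀ {n} → Digraph n → Matrix n
toM G i j = lookup (lookup G i) j

Adj⇒toM : ∀ {n} (G : Digraph n) {i j} → Adj G i j → toM G i j ≡ true
Adj⇒toM G = []=⇒lookup

toM⇒Adj : ∀ {n} (G : Digraph n) {i j} → toM G i j ≡ true → Adj G i j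
toM⇒Adj G {i} {j} = lookup⇒[]= j (lookup G i)

toM-sym : ∀ {n} {G : Digraph n} → IsSimple G → Symmetric (toM G)
toM-sym {G = G} s i j with toM G i j in p | toM G j i in q
... | true  | true  = refl
... | false | false = refl
... | true  | false = trans (sym (Adj⇒toM G (IsSimple.symmetric s i j (toM⇒Adj G p)))) q
... | false | true  = trans (sym p) (Adj⇒toM G (IsSimple.symmetric s j i (toM⇒Adj G q)))

toM-irr : ∀ {n} {G : Digraph n} → IsSimple G → Irreflexive (toM G)
toM-irr {G = G} s i = ¬true⇒false λ p → IsSimple.irreflexive s i (toM⇒Adj G p)

toM-regular : ∀ {n d} {G : Digraph n} → IsRegularGraph d G → RegularM d (toM G)
toM-regular {G = G} (s , r) = record
  { symm = toM-sym {G = G} s ; irr = toM-irr {G = G} s ; reg = λ i → trans (sym (∣∣≡∑ (lookup G i))) (r i) }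

inside : ∀ {n} → (Fin n → Bool) → Matrix n → Fin n → Fin n → Bool
inside B a x y = a x y ∧ (B x ∧ B y)

-- Ordered pairs are counted, so an edge inside B counts twice.
internal : ∀ {n} → (Fin n → Bool) → Matrix n → ℕ
internal B a = ∑ λ x → ∑ λ y → bit (inside B a x y)

internal-even : ∀ {n d} {a : Matrix n} → RegularM d a → ∀ B → 2 ∣ internal B a
internal-even {a = a} r B = ∑∑-even (λ i j → bit (inside B a i j))
  (λ i j → cong₂ (λ x y → bit (x ∧ y)) (symm i j) (∧-comm (B i) (B j)))
      (λ i → cong (λ x → bit (x ∧ (B i ∧ B i))) (irr i))
  where open RegularM r

internal-eq : ∀ {n d} {a : Matrix n} → RegularM d a → ∀ B → d * ∑ (bit ∘ B) ≡ cutM a B + internal B a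
internal-eq {d = d} {a} r B = begin
  d * ∑ (bit ∘ B)                           ≡⟨ sym (∑-*ˡ d (bit ∘ B)) ⟩
  ∑ (λ i → d * bit (B i))                   ≡⟨ ∑-cong
      (λ i → trans (cong (_* bit (B i)) (sym (reg i))) (sym (∑-*ʳ (bit ∘ a i) (bit (B i))))) ⟩
  ∑ (λ i → ∑ λ j → bit (a i j) * bit (B i)) ≡⟨ ∑-cong (λ i → trans (∑-cong (λ j → bits (a i j) (B i) (B j)))
                                                 (∑-+ (λ j → bit (a i j ∧ (B i ∧ not (B j))))
                                                     (λ j → bit (inside B a i j)))) ⟩
  ∑ (λ i → ∑ (λ j → bit (a i j ∧ (B i ∧ not (B j)))) + ∑ (λ j → bit (inside B a i j))) ≡⟨ ∑-+ _
      (λ i → ∑ λ j → bit (inside B a i j)) ⟩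
  cutM a B + internal B a                   ∎
  where
  open ≡-Reasoning
  open RegularM r
  bits : ∀ x y w → bit x * bit y ≡ bit (x ∧ (y ∧ not w)) + bit (x ∧ (y ∧ w))
  bits true  true  true  = refl
  bits true  true  false = refl
  bits true  false w     = refl
  bits false y     w     = refl

module EdgeList (N : ℕ) where
  open Edges N

  wt : (X → X → ℕ) → List Edge → ℕ
  wt w []            = 0
  wt w ((u , v) ∷ E) = w u v + wt w E

  wt-++ : ∀ w E F → wt w (E ++ F) ≡ wt w E + wt w F
  wt-++ w []            F = refl
  wt-++ w ((u , v) ∷ E) F = trans (cong (w u v +_) (wt-++ w E F)) (sym (ℕ.+-assoc (w u v) _ _))

  wt-+ : ∀ w w′ E → wt (λ u v → w u v + w′ u v) E ≡ wt w E + wt w′ E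
  wt-+ w w′ []            = refl
  wt-+ w w′ ((u , v) ∷ E) = trans (cong (w u v + w′ u v +_) (wt-+ w w′ E))
      (+-interchange (w u v) (w′ u v) (wt w E) (wt w′ E))

  Ornt-wt : ∀ {w} → (∀ u v → w u v ≡ w v u) → ∀ {E D} → Ornt E D → wt w D ≡ wt w E
  Ornt-wt sm []                    = refl
  Ornt-wt sm (keep {u , v} o)      = cong (_ +_) (Ornt-wt sm o)
  Ornt-wt sm (flip {u} {v} o)      = cong₂ _+_ (sm v u) (Ornt-wt sm o)

  cut≡wt : ∀ E B → cut E B ≡ wt (λ u v → bit (B u xor B v)) E
  cut≡wt []            B = refl
  cut≡wt ((u , v) ∷ E) B = cong (_ +_) (cut≡wt E B)

  row : ∀ {m} → X → (Fin m → X) → (Fin m → Bool) → List Edge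
  row {zero}  x ι r = []
  row {suc m} x ι r = (if r zero then (x , ι zero) ∷_ else id) (row x (ι ∘ suc) (r ∘ suc))

  -- Only entries above the diagonal are listed, so every edge appears once.
  edges : ∀ {m} → (Fin m → X) → Matrix m → List Edge
  edges {zero}  ι a = []
  edges {suc m} ι a = row (ι zero) (ι ∘ suc) (a zero ∘ suc) ++ edges (ι ∘ suc) (λ i j → a (suc i) (suc j))

  wt-row : ∀ w {m} x (ι : Fin m → X) r → wt w (row x ι r) ≡ ∑ λ j → bit (r j) * w x (ι j)
  wt-row w {zero}  x ι r = refl
  wt-row w {suc m} x ι r with r zero
  ... | true  = cong₂ _+_ (sym (ℕ.+-identityʳ (w x (ι zero)))) (wt-row w x (ι ∘ suc) (r ∘ suc))
  ... | false = wt-row w x (ι ∘ suc) (r ∘ suc)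

  -- Doubling turns the sum over pairs above the diagonal into one over all ordered pairs, without
  -- division by 2.
  wt-edges : ∀ w {m} (ι : Fin m → X) (a : Matrix m) → (∀ u v → w u v ≡ w v u) → Symmetric a → Irreflexive a →
             wt w (edges ι a) + wt w (edges ι a) ≡ ∑ λ i → ∑ λ j → bit (a i j) * w (ι i) (ι j)
  wt-edges w {zero}  ι a sm as ai = refl
  wt-edges w {suc m} ι a sm as ai = begin
    wt w (r ++ e) + wt w (r ++ e)               ≡⟨ cong (λ x → x + x) (wt-++ w r e) ⟩
    (wt w r + wt w e) + (wt w r + wt w e)       ≡⟨ lem (wt w r) (wt w e) ⟩
    wt w r + (wt w r + (wt w e + wt w e))       ≡⟨ cong₂ _+_ r₁
        (cong₂ _+_ r₂ (wt-edges w (ι ∘ suc) a′ sm (λ i j → as (suc i) (suc j)) (ai ∘ suc))) ⟩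
    ∑ (t zero) + (∑ (λ i → t (suc i) zero) + ∑ (λ i → ∑ λ j → t (suc i) (suc j))) ≡⟨ cong (∑ (t zero) +_)
        (sym (∑-+ (λ i → t (suc i) zero) _)) ⟩
    ∑ (λ i → ∑ (t i)) ∎
    where
    open ≡-Reasoning
    r = row (ι zero) (ι ∘ suc) (a zero ∘ suc)
    a′ = λ i j → a (suc i) (suc j)
    e = edges (ι ∘ suc) a′
    t : Fin (suc m) → Fin (suc m) → ℕ
    t i j = bit (a i j) * w (ι i) (ι j)
    r₁ : wt w r ≡ ∑ (t zero)
    r₁ = trans (wt-row w (ι zero) (ι ∘ suc) (a zero ∘ suc))
        (cong (λ x → bit x * w (ι zero) (ι zero) + ∑ (λ j → t zero (suc j))) (sym (ai zero)))
    r₂ : wt w r ≡ ∑ (λ i → t (suc i) zero)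
    r₂ = trans (wt-row w (ι zero) (ι ∘ suc) (a zero ∘ suc))
        (∑-cong λ j → cong₂ (λ x y → bit x * y) (as zero (suc j)) (sm (ι zero) (ι (suc j))))
    lem : ∀ a b → (a + b) + (a + b) ≡ a + (a + (b + b))
    lem = ℕ-Solver.solve-∀

  wt-edges-0 : ∀ w {m} (ι : Fin m → X) (a : Matrix m) → (∀ i j → i ≢ j → w (ι i) (ι j) ≡ 0) → wt w (edges ι a) ≡ 0
  wt-edges-0 w {zero}  ι a eq = refl
  wt-edges-0 w {suc m} ι a eq = trans (wt-++ w (row (ι zero) (ι ∘ suc) (a zero ∘ suc)) _) (cong₂ _+_
    (trans (wt-row w (ι zero) (ι ∘ suc) (a zero ∘ suc))
        (∑-zero′ λ j → trans (cong (bit (a zero (suc j)) *_)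
        (eq zero (suc j) λ ())) (ℕ.*-zeroʳ (bit (a zero (suc j))))))
    (wt-edges-0 w (ι ∘ suc) _ λ i j ne → eq (suc i) (suc j) (ne ∘ Fin.suc-injective)))

  All-row : ∀ {P : Edge → Set} {m} x (ι : Fin m → X) r → (∀ j → P (x , ι j)) → All P (row x ι r)
  All-row {m = zero}  x ι r p = []
  All-row {m = suc m} x ι r p with r zero
  ... | true  = p zero ∷ All-row x (ι ∘ suc) (r ∘ suc) (p ∘ suc)
  ... | false = All-row x (ι ∘ suc) (r ∘ suc) (p ∘ suc)

  All-edges : ∀ {P : Edge → Set} {m} (ι : Fin m → X) a → (∀ i j → P (ι i , ι j)) → All P (edges ι a)
  All-edges {m = zero}  ι a p = []
  All-edges {m = suc m} ι a p = All.++⁺ (All-row (ι zero) (ι ∘ suc) (a zero ∘ suc) (λ j → p zero (suc j)))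
                                        (All-edges (ι ∘ suc) _ λ i j → p (suc i) (suc j))

  half-inj : ∀ {a b} → a + a ≡ b + b → a ≡ b
  half-inj {a} {b} eq = ℕ.*-cancelˡ-≡ a b 2 (trans (lem a) (trans eq (sym (lem b))))
    where
    lem : ∀ a → 2 * a ≡ a + a
    lem = ℕ-Solver.solve-∀

  cut-edges : ∀ {m} (ι : Fin m → X) (a : Matrix m) → Symmetric a → Irreflexive a → ∀ B →
      cut (edges ι a) B ≡ cutM a (B ∘ ι)
  cut-edges {m} ι a as ai B = half-inj (begin
    cut E B + cut E B ≡⟨ cong (λ x → x + x) (cut≡wt E B) ⟩
    wt w E + wt w E   ≡⟨ wt-edges w ι a (λ u v → cong bit (xor-comm (B u) (B v))) as ai ⟩
    ∑ (λ i → ∑ λ j → bit (a i j) * w (ι i) (ι j)) ≡⟨ ∑-cong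
        (λ i → trans (∑-cong (λ j → bits (a i j) (B (ι i)) (B (ι j)))) (∑-+ (t i) (λ j → t′ i j))) ⟩
    ∑ (λ i → ∑ (t i) + ∑ (t′ i)) ≡⟨ ∑-+ (λ i → ∑ (t i)) _ ⟩
    cutM a (B ∘ ι) + ∑ (λ i → ∑ (t′ i)) ≡⟨ cong (cutM a (B ∘ ι) +_)
        (trans (∑-swap t′) (∑-cong λ j → ∑-cong λ i → cong (λ x → bit (x ∧ (B (ι j) ∧ not (B (ι i))))) (as i j))) ⟩
    cutM a (B ∘ ι) + cutM a (B ∘ ι) ∎)
    where
    open ≡-Reasoning
    E = edges ι a
    w : X → X → ℕ
    w u v = bit (B u xor B v)
    t t′ : Fin m → Fin m → ℕ
    t i j = bit (a i j ∧ (B (ι i) ∧ not (B (ι j))))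
    t′ i j = bit (a i j ∧ (B (ι j) ∧ not (B (ι i))))
    bits : ∀ x y w → bit x * bit (y xor w) ≡ bit (x ∧ (y ∧ not w)) + bit (x ∧ (w ∧ not y))
    bits true true true = refl
    bits true true false = refl
    bits true false true = refl
    bits true false false = refl
    bits false y w = refl

  cnt : List Edge → X → X → ℕ
  cnt D x y = wt (λ u v → bit (δ x u ∧ δ y v)) D

  indeg : List Edge → X → ℕ
  indeg D y = wt (λ u v → bit (δ y v)) D

  indeg≡∑cnt : ∀ D y → indeg D y ≡ ∑ λ x → cnt D x y
  indeg≡∑cnt []            y = sym (∑-zero N)
  indeg≡∑cnt ((u , v) ∷ D) y = trans (cong₂ _+_ (sym one) (indeg≡∑cnt D y)) (sym (∑-+ (λ x → bit (δ x u ∧ δ y v)) _))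
    where
    one : ∑ (λ x → bit (δ x u ∧ δ y v)) ≡ bit (δ y v)
    one = trans (∑-single u λ x ne → cong (λ b → bit (b ∧ δ y v)) (δ-false {x} {u} λ eq → ne (sym eq)))
        (cong (λ b → bit (b ∧ δ y v)) (δ-refl u))

  -- An edge entering y adds 1 + 1 to cut plus net, one leaving it adds 1 - 1. Loops are invisible
  -- to both and need the correction term.
  indeg-net : ∀ D y → pos (indeg D y + indeg D y) ≡ (pos (cut D (δ y)) +ᶻ net D (δ y)) +ᶻ pos (cnt D y y + cnt D y y)
  indeg-net []            y = refl
  indeg-net ((u , v) ∷ D) y = begin
    pos ((p + I) + (p + I)) ≡⟨ cong pos (lem₁ p I) ⟩
    pos ((p + p) + (I + I)) ≡⟨ ℤ.pos-+ (p + p) (I + I) ⟩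
    pos (p + p) +ᶻ pos (I + I) ≡⟨ cong₂ _+ᶻ_ (bits (δ y u) (δ y v)) (indeg-net D y) ⟩
    ((pos c +ᶻ nt) +ᶻ pos (q + q)) +ᶻ ((pos C +ᶻ NT) +ᶻ pos (Z + Z)) ≡⟨ lem₂ (pos c) nt (pos (q + q)) (pos C) NT
        (pos (Z + Z)) ⟩
    ((pos c +ᶻ pos C) +ᶻ (nt +ᶻ NT)) +ᶻ (pos (q + q) +ᶻ pos (Z + Z)) ≡⟨ cong₂ (λ x w → (x +ᶻ (nt +ᶻ NT)) +ᶻ w)
        (sym (ℤ.pos-+ c C)) (trans (sym (ℤ.pos-+ (q + q) (Z + Z))) (cong pos (sym (lem₁ q Z)))) ⟩
    (pos (c + C) +ᶻ (nt +ᶻ NT)) +ᶻ pos ((q + Z) + (q + Z)) ∎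
    where
    open ≡-Reasoning
    p = bit (δ y v)
    I = indeg D y
    c = bit (δ y u xor δ y v)
    nt = i (δ y v) -ᶻ i (δ y u)
    q = bit (δ y u ∧ δ y v)
    C = cut D (δ y)
    NT = net D (δ y)
    Z = cnt D y y
    lem₁ : ∀ p i → (p + i) + (p + i) ≡ (p + p) + (i + i)
    lem₁ = ℕ-Solver.solve-∀
    lem₂ : ∀ a b c d e f → ((a +ᶻ b) +ᶻ c) +ᶻ ((d +ᶻ e) +ᶻ f) ≡ ((a +ᶻ d) +ᶻ (b +ᶻ e)) +ᶻ (c +ᶻ f)
    lem₂ = ℤ-Solver.solve-∀
    bits : ∀ x w → pos (bit w + bit w) ≡ (pos (bit (x xor w)) +ᶻ (i w -ᶻ i x)) +ᶻ pos (bit (x ∧ w) + bit (x ∧ w))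
    bits true  true  = refl
    bits true  false = refl
    bits false true  = refl
    bits false false = refl

-- The vertices of a graph on Fin n become the vertices suc i of Fin (suc n), and zero is the root.
module Oriented {n : ℕ} {k : ℕ} .{{_ : NonZero k}} (G : Digraph n) (simple : IsSimple G) where
  open Edges (suc n)
  open EdgeList (suc n)
  open IsSimple simple

  adj : Matrix n
  adj = toM G

  adj-sym : Symmetric adj
  adj-sym = toM-sym {G = G} simple

  adj-irr : Irreflexive adj
  adj-irr = toM-irr {G = G} simple

  EG : List Edge
  EG = edges suc adj

  module _ {D} (o : Ornt EG D) where
    both : X → X → X → X → ℕ
    both x y u v = bit (δ x u ∧ δ y v) + bit (δ y u ∧ δ x v)

    both-sym : ∀ x y u v → both x y u v ≡ both x y v u
    both-sym x y u v = trans (ℕ.+-comm (bit (δ x u ∧ δ y v)) _)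
        (cong₂ (λ a b → bit a + bit b) (∧-comm (δ y u) (δ x v)) (∧-comm (δ x u) (δ y v)))

    δδ-false : ∀ {x y u v : X} → ¬ (u ≡ x × v ≡ y) → δ x u ∧ δ y v ≡ false
    δδ-false {x} {y} {u} {v} ne with δ x u in p | δ y v in q
    ... | true  | true  = ⊥-elim (ne (δ-true {x} {u} p , δ-true {y} {v} q))
    ... | true  | false = refl
    ... | false | _ = refl

    cnt-root : ∀ y → cnt D zero y ≡ 0
    cnt-root y = ℕ.m+n≡0⇒m≡0 _ (trans (sym (wt-+ (λ u v → bit (δ zero u ∧ δ y v)) (λ u v → bit (δ y u ∧ δ zero v)) D))
      (trans (Ornt-wt (both-sym zero y) o) (wt-edges-0 (both zero y) suc adj λ i j _ →
        cong₂ (λ a b → bit a + bit b) (δδ-false {zero} {y} {suc i} {suc j}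
            λ ()) (δδ-false {y} {zero} {suc i} {suc j} λ ()))))

    cnt-loop : ∀ v → cnt D (suc v) (suc v) ≡ 0
    cnt-loop v = ℕ.m+n≡0⇒m≡0 _ (trans (sym (wt-+ (λ a b → bit (δ x a ∧ δ x b)) (λ a b → bit (δ x a ∧ δ x b)) D))
      (trans (Ornt-wt (both-sym x x) o) (wt-edges-0 (both x x) suc adj λ i j ne →
        cong (λ a → bit a + bit a) (δδ-false {x} {x} {suc i} {suc j} λ (p , q) → ne
            (Fin.suc-injective (trans p (sym q)))))))
      where
      x : X
      x = suc v

    cnt-pair : ∀ p q → p ≢ q → cnt D (suc p) (suc q) + cnt D (suc q) (suc p) ≡ bit (adj p q)
    cnt-pair p q p≢q = half-inj (begin
      S + S ≡⟨ cong (λ x → x + x) (trans (sym (wt-+ (λ u v → bit (δ x u ∧ δ y v)) (λ u v → bit (δ y u ∧ δ x v)) D))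
          (Ornt-wt (both-sym x y) o)) ⟩
      wt (both x y) EG + wt (both x y) EG ≡⟨ wt-edges (both x y) suc adj (both-sym x y) adj-sym adj-irr ⟩
      ∑ (λ i → ∑ λ j → bit (adj i j) * both x y (suc i) (suc j)) ≡⟨ ∑-cong
          (λ i → trans (∑-cong λ j → ℕ.*-distribˡ-+ (bit (adj i j)) (bit (δ x (suc i) ∧ δ y (suc j))) _)
          (∑-+ (λ j → t p q i j) (λ j → t q p i j))) ⟩
      ∑ (λ i → ∑ (t p q i) + ∑ (t q p i)) ≡⟨ ∑-+ (λ i → ∑ (t p q i)) _ ⟩
      ∑ (λ i → ∑ (t p q i)) + ∑ (λ i → ∑ (t q p i)) ≡⟨ cong₂ _+_ (pick-t p q)
          (trans (pick-t q p) (cong bit (adj-sym q p))) ⟩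
      bit (adj p q) + bit (adj p q) ∎)
      where
      open ≡-Reasoning
      x y : X
      x = suc p
      y = suc q
      S = cnt D x y + cnt D y x
      t : Fin n → Fin n → Fin n → Fin n → ℕ
      t p q i j = bit (adj i j) * bit (δ (suc p) (suc i) ∧ δ (suc q) (suc j))
      off : ∀ p q i j → ¬ (i ≡ p × j ≡ q) → t p q i j ≡ 0
      off p q i j ne = trans (cong (λ b → bit (adj i j) * bit b)
          (δδ-false {suc p} {suc q} {suc i} {suc j} λ (e , f) → ne (Fin.suc-injective e , Fin.suc-injective f)))
          (ℕ.*-zeroʳ (bit (adj i j)))
      pick-t : ∀ p q → ∑ (λ i → ∑ (t p q i)) ≡ bit (adj p q)
      pick-t p q = trans (∑-single p λ i ne → ∑-zero′ λ j → off p q i j λ (e , _) → ne e)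
        (trans (∑-single q λ j ne → off p q p j λ (_ , f) → ne f)
          (trans (cong₂ (λ b c → bit (adj p q) * bit (b ∧ c)) (δ-refl (suc p)) (δ-refl (suc q))) (ℕ.*-identityʳ _)))

    inset : Fin n → Subset n
    inset v = tabulate λ i → ⌊ 1 ≤? cnt D (suc i) (suc v) ⌋

    ∈inset : ∀ {v i} → i ∈ inset v → 1 ≤ cnt D (suc i) (suc v)
    ∈inset {v} {i} i∈ with 1 ≤? cnt D (suc i) (suc v) | trans
        (sym (lookup∘tabulate (λ i → ⌊ 1 ≤? cnt D (suc i) (suc v) ⌋) i)) ([]=⇒lookup i∈)
    ... | yes p | _ = p

    inset∋ : ∀ {v i} → 1 ≤ cnt D (suc i) (suc v) → i ∈ inset v
    inset∋ {v} {i} p = lookup⇒[]= i (inset v) (trans (lookup∘tabulate (λ i → ⌊ 1 ≤? cnt D (suc i) (suc v) ⌋) i) tr)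
      where
      tr : ⌊ 1 ≤? cnt D (suc i) (suc v) ⌋ ≡ true
      tr with 1 ≤? cnt D (suc i) (suc v)
      ... | yes _ = refl
      ... | no np = ⊥-elim (np p)

    cnt≤1 : ∀ i v → cnt D (suc i) (suc v) ≤ 1
    cnt≤1 i v with i Fin.≟ v
    ... | yes refl = subst (_≤ 1) (sym (cnt-loop v)) z≤n
    ... | no ne = ℕ.≤-trans (ℕ.m≤m+n _ _) (ℕ.≤-trans (ℕ.≤-reflexive (cnt-pair i v ne)) (bit≤1 (adj i v)))

    inset-size : ∀ v → ∣ inset v ∣ ≡ indeg D (suc v)
    inset-size v = trans (∣∣≡∑ (inset v)) (trans (∑-cong eq)
        (sym (trans (indeg≡∑cnt D (suc v)) (cong (_+ ∑ (λ i → cnt D (suc i) (suc v))) (cnt-root (suc v))))))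
      where
      bin : ∀ c → c ≤ 1 → bit ⌊ 1 ≤? c ⌋ ≡ c
      bin zero    _ = refl
      bin (suc zero) _ = refl
      bin (suc (suc c)) (s≤s ())
      eq : ∀ i → bit (lookup (inset v) i) ≡ cnt D (suc i) (suc v)
      eq i = trans (cong bit (lookup∘tabulate (λ i → ⌊ 1 ≤? cnt D (suc i) (suc v) ⌋) i)) (bin _ (cnt≤1 i v))

    orientation⇒stars : (∀ v → k ∣ indeg D (suc v)) → HasStarDecomposition k G
    orientation⇒stars div = starDecomposition simple inset (λ v → subst (k ∣_) (sym (inset-size v)) (div v))
      (λ v x x∈ → symmetric x v (toM⇒Adj G (adj-of x v (∈inset x∈))))
      total anti
      where
      adj-of : ∀ x v → 1 ≤ cnt D (suc x) (suc v) → adj x v ≡ true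
      adj-of x v p with x Fin.≟ v
      ... | yes refl = ⊥-elim (ℕ.<⇒≢ p (sym (cnt-loop v)))
      ... | no ne with adj x v | cnt-pair x v ne
      ... | true  | _ = refl
      ... | false | eq = ⊥-elim (ℕ.<⇒≢ p (sym (ℕ.m+n≡0⇒m≡0 _ eq)))
      total : ∀ i j → Adj G i j → j ∈ inset i ⊎ i ∈ inset j
      total i j ij with i Fin.≟ j
      ... | yes refl = ⊥-elim (irreflexive i ij)
      ... | no ne with 1 ≤? cnt D (suc i) (suc j)
      ... | yes p = inj₂ (inset∋ p)
      ... | no np = inj₁ (inset∋ (ℕ.≤-reflexive (sym
          (trans (cong (_+ cnt D (suc j) (suc i)) (sym (ℕ.n<1⇒n≡0 (ℕ.≰⇒> np))))
          (trans (cnt-pair i j ne) (cong bit (Adj⇒toM G ij)))))))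
      anti : ∀ i j → j ∈ inset i → i ∈ inset j → ⊥
      anti i j j∈ i∈ with i Fin.≟ j
      ... | yes refl = ℕ.<⇒≢ (∈inset i∈) (sym (cnt-loop i))
      ... | no ne = ℕ.<⇒≱ (ℕ.+-mono-≤ (∈inset i∈) (∈inset j∈))
          (ℕ.≤-trans (ℕ.≤-reflexive (cnt-pair i j ne)) (bit≤1 (adj i j)))

∑-bit>0 : ∀ {n} (B : Fin n → Bool) → 0 < ∑ (bit ∘ B) → ∃ λ i → B i ≡ true
∑-bit>0 {suc n} B lt with B zero in eq
... | true  = zero , eq
... | false = let j , p = ∑-bit>0 (B ∘ suc) lt in suc j , p

∑-bit-≥1 : ∀ {n} (B : Fin n → Bool) i → B i ≡ true → 1 ≤ ∑ (bit ∘ B)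
∑-bit-≥1 B zero    eq rewrite eq = s≤s z≤n
∑-bit-≥1 B (suc i) eq = ℕ.≤-trans (∑-bit-≥1 (B ∘ suc) i eq) (ℕ.m≤n+m _ (bit (B zero)))

∑-bit-≥2 : ∀ {n} (B : Fin n → Bool) i j → i ≢ j → B i ≡ true → B j ≡ true → 2 ≤ ∑ (bit ∘ B)
∑-bit-≥2 B zero    zero    ne p q = ⊥-elim (ne refl)
∑-bit-≥2 B zero    (suc j) ne p q rewrite p = s≤s (∑-bit-≥1 (B ∘ suc) j q)
∑-bit-≥2 B (suc i) zero    ne p q rewrite q = s≤s (∑-bit-≥1 (B ∘ suc) i p)
∑-bit-≥2 B (suc i) (suc j) ne p q = ℕ.≤-trans (∑-bit-≥2 (B ∘ suc) i j (ne ∘ cong suc) p q) (ℕ.m≤n+m _ (bit (B zero)))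

∑-not : ∀ {n} (B : Fin n → Bool) → ∑ (bit ∘ B) + ∑ (bit ∘ not ∘ B) ≡ n
∑-not {n} B = trans (sym (∑-+ (bit ∘ B) (bit ∘ not ∘ B)))
    (trans (∑-cong (bit-not ∘ B)) (trans (∑-const n 1) (ℕ.*-identityʳ n)))

cutM-ext : ∀ {n} (a : Matrix n) {A B : Fin n → Bool} → (∀ i → A i ≡ B i) → cutM a A ≡ cutM a B
cutM-ext a eq = ∑-cong λ i → ∑-cong λ j → cong₂ (λ x y → bit (a i j ∧ (x ∧ not y))) (eq i) (eq j)

cutM-not : ∀ {n} (a : Matrix n) → Symmetric a → ∀ B → cutM a (not ∘ B) ≡ cutM a B
cutM-not a sm B = trans (∑-swap (λ i j → bit (a i j ∧ (not (B i) ∧ not (not (B j))))))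
    (∑-cong λ j → ∑-cong λ i → trans (cong (λ x → bit (x ∧ (not (B i) ∧ not (not (B j))))) (sm i j))
    (cong (λ x → bit (a j i ∧ x)) (bits (B i) (B j))))
  where
  bits : ∀ x y → not x ∧ not (not y) ≡ y ∧ not x
  bits true true = refl
  bits true false = refl
  bits false true = refl
  bits false false = refl

internal-≤ : ∀ {n} (a : Matrix n) → Irreflexive a → ∀ B → internal B a + ∑ (bit ∘ B) ≤ ∑ (bit ∘ B) * ∑ (bit ∘ B)
internal-≤ {n} a ir B = begin
  internal B a + s                                      ≡⟨ sym (∑-+ (λ i → ∑ λ j → bit (inside B a i j)) (bit ∘ B)) ⟩
  ∑ (λ i → ∑ (λ j → bit (inside B a i j)) + bit (B i))  ≤⟨ ∑-mono row ⟩
  ∑ (λ i → bit (B i) * s)                               ≡⟨ ∑-*ʳ (bit ∘ B) s ⟩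
  s * s                                                 ∎
  where
  open ℕ.≤-Reasoning
  s = ∑ (bit ∘ B)
  diag : Fin n → Fin n → ℕ
  diag i j = bit ⌊ j Fin.≟ i ⌋ * bit (B i)
  diag-off : ∀ i j → j ≢ i → diag i j ≡ 0
  diag-off i j ne with j Fin.≟ i
  ... | yes eq = ⊥-elim (ne eq)
  ... | no _   = refl
  diag-on : ∀ i → diag i i ≡ bit (B i)
  diag-on i with i Fin.≟ i
  ... | yes _  = ℕ.+-identityʳ _
  ... | no ne  = ⊥-elim (ne refl)
  term : ∀ i j → bit (inside B a i j) + diag i j ≤ bit (B i) * bit (B j)
  term i j with j Fin.≟ i
  ... | no _ = ℕ.≤-trans (ℕ.≤-reflexive (ℕ.+-identityʳ _)) (below (a i j) (B i) (B j))
    where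
    below : ∀ x y w → bit (x ∧ (y ∧ w)) ≤ bit y * bit w
    below true  y w = ℕ.≤-reflexive (bit-∧ y w)
    below false y w = z≤n
  ... | yes refl rewrite ir i with B i
  ... | true  = s≤s z≤n
  ... | false = z≤n
  row : ∀ i → ∑ (λ j → bit (inside B a i j)) + bit (B i) ≤ bit (B i) * s
  row i = begin
    ∑ (λ j → bit (inside B a i j)) + bit (B i)      ≡⟨ cong (∑ (λ j → bit (inside B a i j)) +_)
        (sym (trans (∑-single i (diag-off i)) (diag-on i))) ⟩
    ∑ (λ j → bit (inside B a i j)) + ∑ (diag i)     ≡⟨ sym (∑-+ (λ j → bit (inside B a i j)) (diag i)) ⟩
    ∑ (λ j → bit (inside B a i j) + diag i j)       ≤⟨ ∑-mono (term i) ⟩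
    ∑ (λ j → bit (B i) * bit (B j))                 ≡⟨ ∑-*ˡ (bit (B i)) (bit ∘ B) ⟩
    bit (B i) * s                                   ∎

-- Each of the s vertices of B has at most s - 1 neighbours in B, hence at least d + 1 - s outside;
-- stated without subtraction.
cutM-≥ : ∀ {n d} {a : Matrix n} → RegularM d a → ∀ B →
         d * ∑ (bit ∘ B) + ∑ (bit ∘ B) ≤ cutM a B + ∑ (bit ∘ B) * ∑ (bit ∘ B)
cutM-≥ {d = d} {a} r B = ℕ.≤-trans (ℕ.≤-reflexive
    (trans (cong (_+ ∑ (bit ∘ B)) (internal-eq r B)) (ℕ.+-assoc (cutM a B) (internal B a) _)))
  (ℕ.+-monoʳ-≤ (cutM a B) (internal-≤ a (RegularM.irr r) B))

cutM-single : ∀ {n d} {a : Matrix n} → RegularM d a → ∀ B → ∑ (bit ∘ B) ≡ 1 → cutM a B ≡ d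
cutM-single {d = d} {a} r B s≡1 = ℕ.≤-antisym
  (ℕ.≤-trans (ℕ.m≤m+n _ (internal B a)) (ℕ.≤-reflexive
      (trans (sym (internal-eq r B)) (trans (cong (d *_) s≡1) (ℕ.*-identityʳ d)))))
  (ℕ.+-cancelʳ-≤ 1 d _ (subst (λ x → x + 1 ≤ cutM a B + 1) (ℕ.*-identityʳ d)
      (subst (λ s → d * s + s ≤ cutM a B + s * s) s≡1 (cutM-≥ r B))))

-- Orientations of regular graphs

toks : ∀ {N m} → (Fin m → Fin N) → ℕ → List (Fin N)
toks {m = zero}  ι β = []
toks {m = suc m} ι β = replicate β (ι zero) ++ toks (ι ∘ suc) β

tok-toks : ∀ {N m} (ι : Fin m → Fin N) β B → Edges.tok N (toks ι β) B ≡ β * ∑ (bit ∘ B ∘ ι)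
tok-toks {m = zero}  ι β B = sym (ℕ.*-zeroʳ β)
tok-toks {N} {suc m} ι β B = trans (Edges.tok-++ N (replicate β (ι zero)) _ B)
  (trans (cong₂ _+_ (rep β) (tok-toks (ι ∘ suc) β B)) (sym (ℕ.*-distribˡ-+ β (bit (B (ι zero))) _)))
  where
  rep : ∀ β → Edges.tok N (replicate β (ι zero)) B ≡ β * bit (B (ι zero))
  rep zero    = refl
  rep (suc β) = cong (bit (B (ι zero)) +_) (rep β)

CutBound : ∀ {n} → ℕ → Matrix n → Set
CutBound c a = ∀ A → 2 ≤ ∑ (bit ∘ A) → 2 ≤ ∑ (bit ∘ not ∘ A) → c ≤ cutM a A

module Regular {n d : ℕ} (G : Digraph n) (simple : IsSimple G) (regular : IsRegular d G) (h : ℕ) where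
  open Orientation (suc n) zero h hiding (E; V; R; Q; step)
  open EdgeList (suc n) public
  open Oriented {n} {suc h} G simple public

  k = suc h

  rg : RegularM d adj
  rg = toM-regular {G = G} (simple , regular)

  V : PSet
  V zero    = false
  V (suc _) = true

  cutEG : ∀ B → cut EG B ≡ cutM adj (B ∘ suc)
  cutEG = cut-edges suc adj adj-sym adj-irr

  ∑-δ : ∀ v → ∑ (bit ∘ δ (suc v) ∘ suc) ≡ 1
  ∑-δ v = trans (∑-single v λ i ne → cong bit (δ-false {suc v} {suc i} (ne ∘ Fin.suc-injective)))
      (cong bit (δ-refl (suc v)))

  cut-vertex : ∀ v → cut EG (δ (suc v)) ≡ d
  cut-vertex v = trans (cutEG (δ (suc v))) (cutM-single rg (δ (suc v) ∘ suc) (∑-δ v))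

  module Balanced (β : ℕ) (β< : β < L) (d+β : L ∣ d + β) (βn : L ∣ β * n) (bound : CutBound K adj)
      (single≥ : K ≤ d + β) where

    Q : List X
    Q = toks suc β

    I : Inst
    I = inst V EG [] Q

    tokB : ∀ B → tok Q B ≡ β * ∑ (bit ∘ B ∘ suc)
    tokB = tok-toks suc β

    tokδ : ∀ v → tok Q (δ (suc v)) ≡ β
    tokδ v = trans (tokB (δ (suc v))) (trans (cong (β *_) (∑-δ v)) (ℕ.*-identityʳ β))

    parity-I : ∀ B → 2 ∣ deg I B + tok Q B
    parity-I B = ∣m+n∣m⇒∣n (subst (2 ∣_) eq (∣-trans 2∣L (∣-trans d+β (m∣m*n s)))) (internal-even rg (B ∘ suc))
      where
      s = ∑ (bit ∘ B ∘ suc)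
      c = internal (B ∘ suc) adj
      lem : ∀ a b c → (a + c) + b ≡ c + ((a + 0) + b)
      lem = ℕ-Solver.solve-∀
      eq : (d + β) * s ≡ c + (deg I B + tok Q B)
      eq = trans (ℕ.*-distribʳ-+ s d β) (trans (cong₂ _+_
          (trans (internal-eq rg (B ∘ suc)) (cong (_+ c) (sym (cutEG B)))) (sym (tokB B)))
          (lem (cut EG B) (tok Q B) c))

    -- Modulo L both β n and d + β vanish, so β (n - 1) ≡ -β ≡ d. This is the residue of the
    -- complement of a vertex.
    co-residue : ∀ m → suc m ≡ n → (β * m) % L ≡ d % L
    co-residue m refl = begin
      (β * m) % L             ≡⟨ sym (%-remove-+ʳ (β * m) d+β) ⟩
      (β * m + (d + β)) % L   ≡⟨ cong (_% L) (lem β m d) ⟩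
      (d + β * suc m) % L     ≡⟨ %-remove-+ʳ d βn ⟩
      d % L ∎
      where
      open ≡-Reasoning
      lem : ∀ b m d → b * m + (d + b) ≡ d + b * suc m
      lem = ℕ-Solver.solve-∀

    -- Single vertices are covered by `single≥` and sets with two vertices on both sides by `bound`.
    -- The complement of a vertex has Φ = d + d % L, which may be too small; the last hypothesis
    -- excludes or bounds this case.
    dense-at : ∀ B → Proper I B → ∀ p → B p ≡ true → 2 ≤ ∑ (bit ∘ not ∘ B ∘ suc) ⊎ K ≤ d + d % L → K ≤ Φ I B
    dense-at B (B⊆V , zero , () , _) p Bp _
    dense-at B (B⊆V , q , Vq , Bq) zero Bp _ = ⊥-elim (false≢true (B⊆V zero Bp))
    dense-at B (B⊆V , suc q , Vq , Bq) (suc p) Bp co = subst (K ≤_) (sym eqΦ) main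
      where
      s t : ℕ
      s = ∑ (bit ∘ B ∘ suc)
      t = ∑ (bit ∘ not ∘ B ∘ suc)
      eqΦ : Φ I B ≡ cutM adj (B ∘ suc) + (β * s) % L
      eqΦ = cong₂ (λ x y → x + y % L) (trans (ℕ.+-identityʳ _) (cutEG B)) (tokB B)
      s≥1 : 1 ≤ s
      s≥1 = ∑-bit-≥1 (B ∘ suc) p Bp
      t≥1 : 1 ≤ t
      t≥1 = ∑-bit-≥1 (not ∘ B ∘ suc) q (cong not Bq)
      main : K ≤ cutM adj (B ∘ suc) + (β * s) % L
      main with s ℕ.≟ 1
      ... | yes s≡1 = ℕ.≤-trans single≥ (ℕ.≤-reflexive (cong₂ _+_ (sym (cutM-single rg (B ∘ suc) s≡1))
                        (sym (trans (cong (_% L) (trans (cong (β *_) s≡1) (ℕ.*-identityʳ β))) (m<n⇒m%n≡m β<)))))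
      ... | no s≢1 with t ℕ.≟ 1
      ... | no t≢1 = ℕ.≤-trans (bound (B ∘ suc) (ℕ.≤∧≢⇒< s≥1 (s≢1 ∘ sym)) (ℕ.≤∧≢⇒< t≥1 (t≢1 ∘ sym))) (ℕ.m≤m+n _ _)
      ... | yes t≡1 = Sum.[ (λ t≥2 → ⊥-elim (ℕ.<⇒≢ t≥2 (sym t≡1))) , (λ le → ℕ.≤-trans le (ℕ.≤-reflexive (cong₂ _+_
              (sym (trans (sym (cutM-not adj adj-sym (B ∘ suc))) (cutM-single rg (not ∘ B ∘ suc) t≡1)))
              (sym (co-residue s (trans (ℕ.+-comm 1 s) (trans (cong (s +_) (sym t≡1)) (∑-not (B ∘ suc))))))))) ] co

    cutV : cut EG V ≡ 0
    cutV = trans (cutEG V) (∑-zero′ λ i → ∑-zero′ λ j → cong bit (∧-zeroʳ (adj i j)))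

    tokV : L ∣ tok Q V
    tokV = subst (L ∣_) (sym (trans (tokB V) (cong (β *_) (trans (∑-const n 1) (ℕ.*-identityʳ n))))) βn

    base : Base I
    base = record
      { Vz = refl ; noE = cutV ; rno = [] ; par = λ B _ → parity-I B
      ; rootφ = subst (_≤ K) (sym (cong₂ (λ x y → x + 0 + y) cutV (n∣m⇒m%n≡0 (tok Q V) L tokV))) z≤n
      ; root = Good-0 tokV }

    rootless : K ≤ d + d % L → Sol I
    rootless le = solve I zero (base , (λ B pr p Bp _ → dense-at B pr p Bp (inj₂ le)) , λ ())

    -- The complement of x₀ is not dense here, so exactly k of the edges at x₀ are directed into x₀ first.
    rooted : (x₀ : Fin n) → d + d % L ≤ K → d ≡ L + d % L → Sol I
    rooted x₀ le d≡ = glue o gs (solve (inner D) zero (inner-Base o base rootφ root , dense , λ ()))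
      where
      x : X
      x = suc x₀
      A : PSet
      A = V ∖ x
      A⊆V : A ⊆ V
      A⊆V = ∖-⊆ {V}
      part : δ x ⊕ A ≐ V
      part = ∖-⊕ {V} {x} refl
      nbr : ∃ λ j → adj x₀ j ≡ true
      nbr = ∑-bit>0 (adj x₀) (subst (0 <_) (sym (trans (RegularM.reg rg x₀) d≡)) (s≤s z≤n))
      r = proj₁ nbr
      r≢ : suc r ≢ x
      r≢ eq = clash (adj-irr x₀) (subst (λ y → adj x₀ y ≡ true) (Fin.suc-injective eq) (proj₂ nbr))
      Ar : A (suc r) ≡ true
      Ar = ∖-in {V} {x} {suc r} refl r≢
      open Contraction I {A} {suc r} A⊆V Ar (split A EG)
      cut-out : cut out (δ x) ≡ d
      cut-out = trans (sym (trans (≃cut splits (δ x)) (trans (cut-++ inn out (δ x)) (cong (_+ cut out (δ x)) inn0))))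
          (cut-vertex x₀)
        where
        inn0 : cut inn (δ x) ≡ 0
        inn0 = All⇒cut≡0 {A} {δ x} false (λ y Ay → δ-false {x} {y} (∖-≢ {V} {x} {y} Ay)) inn-in
      kk : k + k ≡ L
      kk = cong suc (ℕ.+-suc h h)
      k≤d : k ≤ cut out (δ x)
      k≤d = subst (k ≤_) (sym cut-out) (subst (k ≤_) (sym d≡)
          (ℕ.≤-trans (ℕ.m≤m+n k k) (ℕ.≤-trans (ℕ.≤-reflexive kk) (ℕ.m≤m+n L (d % L)))))
      oc = orient-cut out (δ x) k k≤d
      D = proj₁ oc
      o = proj₁ (proj₂ oc)
      ρ = d % L
      -- k incoming edges out of d = 2k + ρ give 2k - d.
      net-x : net D (δ x) ≡ neg (pos ρ)
      net-x = trans (proj₂ (proj₂ oc)) (trans (cong₂ (λ a b → a -ᶻ b) (trans (sym (ℤ.pos-+ k k)) (cong pos kk))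
          (trans (cong pos (trans cut-out d≡)) (ℤ.pos-+ L ρ))) (lem (pos L) (pos ρ)))
        where
        lem : ∀ l r → l -ᶻ (l +ᶻ r) ≡ neg r
        lem = ℤ-Solver.solve-∀
      net-V : net D V ≡ pos 0
      net-V = cut≡0⇒net≡0 D V (trans (Ornt-cut o V)
          (ℕ.m+n≡0⇒n≡0 (cut inn V) (trans (sym (cut-++ inn out V)) (trans (sym (≃cut splits V)) cutV))))
      net-A : net D A ≡ pos ρ
      net-A = trans (lem (net D (δ x)) (net D A))
          (trans (cong₂ _-ᶻ_ (trans (sym (net-⊕ {δ x} {A} {V} part D)) net-V) net-x) (lem₂ (pos ρ)))
        where
        lem : ∀ a b → b ≡ (a +ᶻ b) -ᶻ a
        lem = ℤ-Solver.solve-∀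
        lem₂ : ∀ r → pos 0 -ᶻ neg r ≡ r
        lem₂ = ℤ-Solver.solve-∀
      tokA% : tok Q A % L ≡ ρ
      tokA% = trans (cong (_% L) (tokB A)) (co-residue (∑ (bit ∘ A ∘ suc))
          (trans (cong (_+ ∑ (bit ∘ A ∘ suc)) (sym (∑-δ x₀))) (∑-not (δ x ∘ suc))))
      Cong-residue : ∀ t → Cong (pos (t % L)) t
      Cong-residue t = neg (pos (t / L)) , trans (lem (pos (t % L)) (pos (t / L)) (pos L))
          (cong (_+ᶻ neg (pos (t / L)) *ᶻ pos L)
          (sym (trans (cong pos (m≡m%n+[m/n]*n t L))
          (trans (ℤ.pos-+ (t % L) (t / L * L)) (cong (pos (t % L) +ᶻ_) (ℤ.pos-* (t / L) L))))))
        where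
        lem : ∀ r q l → r ≡ (r +ᶻ q *ᶻ l) +ᶻ neg q *ᶻ l
        lem = ℤ-Solver.solve-∀
      gs : ∀ v → V v ≡ true → A v ≡ false → Good (net D (δ v)) (tok Q (δ v))
      gs v Vv Av = subst (λ y → Good (net D (δ y)) (tok Q (δ y))) (sym v≡x)
          ((c , eqc) , subst (_≤ᶻ pos L₁) (sym net-x) (ℤ.≤-trans ℤ.neg-≤-pos (ℤ.+≤+ z≤n)))
        where
        v≡x : v ≡ x
        v≡x = decidable-stable (v Fin.≟ x) λ ne → clash Av (∖-in {V} {x} {v} Vv ne)
        open _∣_ d+β using () renaming (quotient to m ; equality to m≡)
        -- From L + ρ + β = d + β = m L follows -ρ = β + (1 - m) L.
        c : ℤ
        c = pos 1 -ᶻ pos m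
        lem : ∀ r b l m → l +ᶻ r +ᶻ b ≡ m *ᶻ l → neg r ≡ b +ᶻ (pos 1 -ᶻ m) *ᶻ l
        lem r b l m e = trans (lem₁ r b l) (trans (cong (λ y → b +ᶻ (l -ᶻ y)) e) (lem₂ b l m))
          where
          lem₁ : ∀ r b l → neg r ≡ b +ᶻ (l -ᶻ ((l +ᶻ r) +ᶻ b))
          lem₁ = ℤ-Solver.solve-∀
          lem₂ : ∀ b l m → b +ᶻ (l -ᶻ m *ᶻ l) ≡ b +ᶻ (pos 1 -ᶻ m) *ᶻ l
          lem₂ = ℤ-Solver.solve-∀
        eqc : net D (δ x) ≡ pos (tok Q (δ x)) +ᶻ c *ᶻ pos L
        eqc = trans net-x (trans (lem (pos ρ) (pos β) (pos L) (pos m)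
                (trans (cong (_+ᶻ pos β) (trans (sym (ℤ.pos-+ L ρ)) (cong pos (sym d≡))))
                    (trans (sym (ℤ.pos-+ d β)) (trans (cong pos m≡) (ℤ.pos-* m L)))))
                (cong (λ y → pos y +ᶻ c *ᶻ pos L) (sym (tokδ x₀))))
      rootφ : Φ I A ≤ K
      rootφ = subst (_≤ K) (sym (cong₂ _+_ (trans (ℕ.+-identityʳ _)
          (trans (sym (cutE-⊕ {δ x} {A} {V} part EG cutV)) (cut-vertex x₀))) tokA%)) le
      root : Good (net D A) (tok Q A)
      root = Good-resp (trans (cong pos tokA%) (sym net-A)) refl (Cong-residue (tok Q A) , ℤ.+≤+ (%≤L₁ (tok Q A)))
      -- A proper subset of A misses both x and a vertex of A, so complements of single vertices no
      -- longer occur.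
      dense : Dense (inner D) zero
      dense B (B⊆A , zero , () , _) p Bp _
      dense B (B⊆A , suc q , Aq , Bq) p Bp _ = subst (K ≤_) (sym (Φ-inner o B))
        (dense-at B ((λ v Bv → A⊆V v (B⊆A v Bv)) , suc q , refl , Bq) p Bp
          (inj₁ (∑-bit-≥2 (not ∘ B ∘ suc) q x₀ (λ eq → ∖-≢ {V} {x} {suc q} Aq (cong suc eq)) (cong not Bq)
            (cong not (¬true⇒false λ Bx → ∖-≢ {V} {x} {x} (B⊆A x Bx) refl)))))

    -- Twice the in-degree is d + net = d + β + c L = (m + c) 2k.
    finish : Sol I → HasStarDecomposition k G
    finish (D , o , g) = orientation⇒stars o div
      where
      div : ∀ v → k ∣ indeg D (suc v)
      div v = divides ℤ.∣ pos m +ᶻ c ∣ (trans (cong ℤ.∣_∣ eq) (ℤ.abs-* (pos m +ᶻ c) (pos k)))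
        where
        open _∣_ d+β using () renaming (quotient to m ; equality to m≡)
        x : X
        x = suc v
        c = proj₁ (proj₁ (g x refl))
        ii = indeg D x
        cut-δ : cut D (δ x) ≡ d
        cut-δ = trans (Ornt-cut o (δ x)) (cut-vertex v)
        net≡ : net D (δ x) ≡ pos β +ᶻ c *ᶻ pos L
        net≡ = trans (cong (λ F → net F (δ x)) (sym (++-identityʳ D)))
            (trans (proj₂ (proj₁ (g x refl))) (cong (λ y → pos y +ᶻ c *ᶻ pos L) (tokδ v)))
        lem : ∀ d b c l → (d +ᶻ (b +ᶻ c)) +ᶻ pos 0 ≡ (d +ᶻ b) +ᶻ c
        lem = ℤ-Solver.solve-∀
        lem₂ : ∀ m c k → m *ᶻ (k +ᶻ k) +ᶻ c *ᶻ (k +ᶻ k) ≡ ((m +ᶻ c) *ᶻ k) *ᶻ pos 2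
        lem₂ = ℤ-Solver.solve-∀
        lem₃ : ∀ i → (i +ᶻ i) ≡ i *ᶻ pos 2
        lem₃ = ℤ-Solver.solve-∀
        posL : pos L ≡ pos k +ᶻ pos k
        posL = trans (cong pos (cong suc (sym (ℕ.+-suc h h)))) (ℤ.pos-+ k k)
        eq : pos ii ≡ (pos m +ᶻ c) *ᶻ pos k
        eq = ℤ.*-cancelʳ-≡ (pos ii) _ (pos 2) (begin
          pos ii *ᶻ pos 2 ≡⟨ trans (sym (lem₃ (pos ii))) (sym (ℤ.pos-+ ii ii)) ⟩
          pos (ii + ii) ≡⟨ indeg-net D x ⟩
          (pos (cut D (δ x)) +ᶻ net D (δ x)) +ᶻ pos
              (cnt D x x + cnt D x x) ≡⟨ cong₂ (λ a b → a +ᶻ pos (b + b)) (cong₂ (λ a b → pos a +ᶻ b) cut-δ net≡)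
              (cnt-loop o v) ⟩
          (pos d +ᶻ (pos β +ᶻ c *ᶻ pos L)) +ᶻ pos 0 ≡⟨ lem (pos d) (pos β) (c *ᶻ pos L) (pos 0) ⟩
          (pos d +ᶻ pos β) +ᶻ c *ᶻ pos L ≡⟨ cong (_+ᶻ c *ᶻ pos L)
              (trans (sym (ℤ.pos-+ d β)) (trans (cong pos m≡) (ℤ.pos-* m L))) ⟩
          pos m *ᶻ pos L +ᶻ c *ᶻ pos L ≡⟨ cong (λ l → pos m *ᶻ l +ᶻ c *ᶻ l) posL ⟩
          pos m *ᶻ (pos k +ᶻ pos k) +ᶻ c *ᶻ (pos k +ᶻ pos k) ≡⟨ lem₂ (pos m) c (pos k) ⟩
          ((pos m +ᶻ c) *ᶻ pos k) *ᶻ pos 2 ∎)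
          where open ≡-Reasoning

L≡2k : ∀ h → Mod.L h ≡ 2 * suc h
L≡2k h = lem h
  where
  lem : ∀ h → suc (suc (h + h)) ≡ 2 * suc h
  lem = ℕ-Solver.solve-∀

odd⇒ : ∀ n → ¬ 2 ∣ n → 2 ∣ suc n
odd⇒ zero          odd = ⊥-elim (odd (divides 0 refl))
odd⇒ (suc zero)    odd = divides 1 refl
odd⇒ (suc (suc n)) odd with odd⇒ n (λ { (divides q eq) → odd (divides (suc q) (cong (2 +_) eq)) })
... | divides q eq = divides (suc q) (cong (2 +_) eq)

-- A connected graph has an orientation with prescribed parities of the in-degrees, provided the
-- parities add up correctly: contract an edge, and use it afterwards to correct one of its ends.
module Parity (N : ℕ) where
  open Edges N
  open EdgeList N

  hd : List Edge → PSet → ℕ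
  hd D B = wt (λ _ v → bit (B v)) D

  hd-++ : ∀ D D′ B → hd (D ++ D′) B ≡ hd D B + hd D′ B
  hd-++ D D′ B = wt-++ (λ _ v → bit (B v)) D D′

  hd-ext : ∀ {A B} → A ≐ B → ∀ D → hd D A ≡ hd D B
  hd-ext eq []            = refl
  hd-ext eq ((u , v) ∷ D) = cong₂ _+_ (cong bit (eq v)) (hd-ext eq D)

  hd-map : ∀ κ D B → hd (map (map² κ) D) B ≡ hd D (B ∘ κ)
  hd-map κ []            B = refl
  hd-map κ ((u , v) ∷ D) B = cong (bit (B (κ v)) +_) (hd-map κ D B)

  hd-⊕ : ∀ {A B C} → A ⊕ B ≐ C → ∀ D → hd D C ≡ hd D A + hd D B
  hd-⊕ p []            = refl
  hd-⊕ {A} {B} p ((u , v) ∷ D) = trans (cong₂ _+_ (p v) (hd-⊕ p D))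
      (+-interchange (bit (A v)) (bit (B v)) (hd D A) (hd D B))

  crossing : ∀ E B → 0 < cut E B → ∃₂ λ u v → ∃₂ λ E₁ E₂ → E ≡ E₁ ++ (u , v) ∷ E₂ × B u xor B v ≡ true
  crossing ((u , v) ∷ E) B lt with B u xor B v in eq
  ... | true  = u , v , [] , E , refl , eq
  ... | false = let x , y , E₁ , E₂ , e , p = crossing E B lt in x , y , _ ∷ E₁ , E₂ , cong (_ ∷_) e , p

  Ornt-split : ∀ E₁ {E₂ D} → Ornt (E₁ ++ E₂) D → ∃₂ λ D₁ D₂ → D ≡ D₁ ++ D₂ × Ornt E₁ D₁ × Ornt E₂ D₂
  Ornt-split []       o        = [] , _ , refl , [] , o
  Ornt-split (e ∷ E₁) (keep o) = let D₁ , D₂ , eq , o₁ , o₂ = Ornt-split E₁ o in _ , D₂ , cong (_ ∷_) eq , keep o₁ , o₂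
  Ornt-split (e ∷ E₁) (flip o) = let D₁ , D₂ , eq , o₁ , o₂ = Ornt-split E₁ o in _ , D₂ , cong (_ ∷_) eq , flip o₁ , o₂

  Inside : PSet → List Edge → Set
  Inside V = All (λ e → V (proj₁ e) ≡ true × V (proj₂ e) ≡ true)

  Connected : PSet → List Edge → Set
  Connected V E = ∀ B → B ⊆ V → (∃ λ p → B p ≡ true) → (∃ λ q → V q ≡ true × B q ≡ false) → 0 < cut E B

  hd-inside : ∀ {V E D} → Inside V E → Ornt E D → hd D V ≡ length E
  hd-inside []             []       = refl
  hd-inside ((p , q) ∷ ps) (keep o) rewrite q = cong suc (hd-inside ps o)
  hd-inside ((p , q) ∷ ps) (flip o) rewrite p = cong suc (hd-inside ps o)

  parity-orientation : ∀ m V E Q → size V < m → Inside V E → Connected V E → 2 ∣ length E + tok Q V →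
                       ∃ λ D → Ornt E D × ∀ v → V v ≡ true → 2 ∣ hd D (δ v) + tok Q (δ v)
  parity-orientation (suc m) V E Q sz ins conn ev with Fin.any? (λ p → V p ≟ᵇ true)
  ... | no none = E , Ornt-refl E , λ v Vv → ⊥-elim (none (v , Vv))
  ... | yes (p , Vp) with Fin.any? (λ q → (V q ≟ᵇ true) ×-dec ¬? (q Fin.≟ p))
  ... | no none = E , Ornt-refl E , λ v Vv → subst (2 ∣_)
      (cong₂ _+_ (trans (sym (hd-inside ins (Ornt-refl E))) (hd-ext (V≐ v Vv) E)) (tok-ext (V≐ v Vv) Q)) ev
    where
    V≐ = only⇒≐ {V} λ q Vq → decidable-stable (q Fin.≟ p) λ ne → none (q , Vq , ne)
  ... | yes (q , Vq , q≢p) with crossing E (δ p)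
      (conn (δ p) (λ x dx → subst (λ y → V y ≡ true) (sym (δ-true {p} {x} dx)) Vp) (p , δ-refl p)
      (q , Vq , δ-false {p} {q} q≢p))
  ... | u , v , E₁ , E₂ , refl , cr with All.++⁻ E₁ ins
  ... | ins₁ , ((Vu , Vv) ∷ ins₂) = build (parity-orientation m (shrunk) E′ Q′ small ins′ conn′ ev′)
    where
    u≢v : u ≢ v
    u≢v refl = clash (xor-same (δ p u)) cr
    A = ⁅ u , v ⁆
    Au : A u ≡ true
    Au rewrite δ-refl u = refl
    Av : A v ≡ true
    Av with δ u v
    ... | true  = refl
    ... | false = δ-refl v
    A-inv : ∀ x → A x ≡ true → x ≡ u ⊎ x ≡ v
    A-inv x a with δ u x in dx
    ... | true  = inj₁ (δ-true {u} {x} dx)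
    ... | false = inj₂ (δ-true {v} {x} a)
    A⊆V : A ⊆ V
    A⊆V x a with A-inv x a
    ... | inj₁ refl = Vu
    ... | inj₂ refl = Vv
    open Contract {V} {A} {u} A⊆V Au
    F = E₁ ++ E₂
    E′ = map (map² κ) F
    -- The extra token stands for the head of the contracted edge, which will fall on one of its two
    -- ends.
    Q′ = u ∷ map κ Q
    small : size (shrunk) < m
    small = ℕ.<-≤-trans (size-mono-< (shrunk-⊆) v (¬true⇒false λ s → u≢v (sym (shrunk-in Av s))) Vv) (ℕ.≤-pred sz)
    ins′ : Inside (shrunk) E′
    ins′ = All.map⁺ (All.map (λ {e} (p , q) → trans (shrunk-κ (proj₁ e)) p , trans (shrunk-κ (proj₂ e)) q)
        (All.++⁺ ins₁ ins₂))
    cutE : ∀ B → cut (E₁ ++ (u , v) ∷ E₂) (B ∘ κ) ≡ cut E′ B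
    cutE B = begin
      cut (E₁ ++ (u , v) ∷ E₂) (B ∘ κ) ≡⟨ cut-++ E₁ _ (B ∘ κ) ⟩
      cut E₁ (B ∘ κ) + (bit (B (κ u) xor B (κ v)) + cut E₂ (B ∘ κ)) ≡⟨ cong
          (λ y → cut E₁ (B ∘ κ) + (bit y + cut E₂ (B ∘ κ)))
          (trans (cong₂ (λ x y → B x xor B y) (κ-in {u} Au) (κ-in {v} Av)) (xor-same (B u))) ⟩
      cut E₁ (B ∘ κ) + cut E₂ (B ∘ κ) ≡⟨ sym (cut-++ E₁ E₂ (B ∘ κ)) ⟩
      cut F (B ∘ κ) ≡⟨ sym (cut-map κ F B) ⟩
      cut E′ B ∎
      where open ≡-Reasoning
    conn′ : Connected (shrunk) E′
    conn′ B B⊆ (x , Bx) (y , Vy , By) = subst (0 <_) (cutE B) (conn (B ∘ κ) (pull-⊆ B⊆)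
      (x , pull-self {B} x (B⊆ x Bx) Bx) (y , shrunk-⊆ y Vy , pull-self {B} y Vy By))
    tok′ : ∀ B → tok Q′ B ≡ bit (B u) + tok Q (B ∘ κ)
    tok′ B = cong (bit (B u) +_) (tok-map κ Q B)
    ev′ : 2 ∣ length E′ + tok Q′ (shrunk)
    ev′ = subst (2 ∣_) (trans (cong₂ _+_ len (sym (tok-ext (shrunk-κ) Q)))
        (trans (lem (length F) _) (cong₂ _+_ (sym (length-map (map² κ) F))
        (trans (cong (λ b → bit b + tok Q (shrunk ∘ κ)) (sym (shrunk-r))) (sym (tok′ (shrunk))))))) ev
      where
      len : length (E₁ ++ (u , v) ∷ E₂) ≡ suc (length F)
      len = trans (length-++ E₁) (trans (ℕ.+-suc (length E₁) (length E₂)) (cong suc (sym (length-++ E₁))))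
      lem : ∀ a b → suc a + b ≡ a + suc b
      lem = ℕ-Solver.solve-∀
    build : (∃ λ D → Ornt E′ D × ∀ x → shrunk x ≡ true → 2 ∣ hd D (δ x) + tok Q′ (δ x)) →
            ∃ λ D → Ornt (E₁ ++ (u , v) ∷ E₂) D × ∀ x → V x ≡ true → 2 ∣ hd D (δ x) + tok Q (δ x)
    build (D′ , o′ , g) with Ornt-map κ F o′
    ... | D , o , refl with Ornt-split E₁ o
    ... | D₁ , D₂ , refl , o₁ , o₂ = correct (2 ∣? a)
      where
      a b : ℕ
      a = hd (D₁ ++ D₂) (δ u) + tok Q (δ u)
      b = hd (D₁ ++ D₂) (δ v) + tok Q (δ v)
      hd-mid : ∀ e B → hd (D₁ ++ e ∷ D₂) B ≡ bit (B (proj₂ e)) + hd (D₁ ++ D₂) B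
      hd-mid e B = trans (hd-++ D₁ (e ∷ D₂) B) (trans (swapℕ (hd D₁ B) (bit (B (proj₂ e))) (hd D₂ B))
          (cong (bit (B (proj₂ e)) +_) (sym (hd-++ D₁ D₂ B))))
      -- Exactly one of `a` and `b` is odd; the edge will be directed towards that end.
      gA : 2 ∣ suc a + b
      gA = subst (2 ∣_) (begin
        hd (map (map² κ) (D₁ ++ D₂)) (δ u) + tok Q′
            (δ u) ≡⟨ cong₂ _+_ (trans (hd-map κ (D₁ ++ D₂) (δ u)) (hd-ext δκ-r (D₁ ++ D₂)))
            (trans (tok′ (δ u)) (cong₂ (λ y t → bit y + t) (δ-refl u) (tok-ext δκ-r Q))) ⟩
        hd (D₁ ++ D₂) A + suc (tok Q A) ≡⟨ cong₂ (λ x y → x + suc y) (hd-⊕ {δ u} {δ v} {A} (pair-⊕ u≢v) (D₁ ++ D₂))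
            (tok-⊕ {δ u} {δ v} {A} (pair-⊕ u≢v) Q) ⟩
        (hd (D₁ ++ D₂) (δ u) + hd (D₁ ++ D₂) (δ v)) + suc
            (tok Q (δ u) + tok Q (δ v)) ≡⟨ lem (hd (D₁ ++ D₂) (δ u)) (hd (D₁ ++ D₂) (δ v)) (tok Q (δ u))
            (tok Q (δ v)) ⟩
        suc a + b ∎) (g u (shrunk-r))
        where
        open ≡-Reasoning
        lem : ∀ a b c d → (a + b) + suc (c + d) ≡ suc (a + c) + (b + d)
        lem = ℕ-Solver.solve-∀
      other : ∀ x → V x ≡ true → A x ≡ false → 2 ∣ hd (D₁ ++ D₂) (δ x) + tok Q (δ x)
      other x Vx Ax = subst (2 ∣_) (cong₂ _+_ (trans (hd-map κ (D₁ ++ D₂) (δ x)) (hd-ext (δκ-out Ax) (D₁ ++ D₂)))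
          (trans (tok′ (δ x)) (cong₂ (λ y t → bit y + t) (δ-false {x} {u} λ { refl → clash Ax Au })
              (tok-ext (δκ-out Ax) Q))))
        (g x (trans (shrunk-out Ax) Vx))
      at : ∀ e c d → c ≡ bit (δ u (proj₂ e)) → d ≡ bit (δ v (proj₂ e)) → A (proj₂ e) ≡ true → 2 ∣ c + a → 2 ∣ d + b →
           ∀ x → V x ≡ true → 2 ∣ hd (D₁ ++ e ∷ D₂) (δ x) + tok Q (δ x)
      at e c d c≡ d≡ Ae ca db x Vx = subst (2 ∣_)
          (sym (trans (cong (_+ tok Q (δ x)) (hd-mid e (δ x))) (ℕ.+-assoc (bit (δ x (proj₂ e))) _ _)))
          (cases (≡true∨false (A x)))
        where
        cases : A x ≡ true ⊎ A x ≡ false → 2 ∣ bit (δ x (proj₂ e)) + (hd (D₁ ++ D₂) (δ x) + tok Q (δ x))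
        cases (inj₁ Ax) with A-inv x Ax
        ... | inj₁ refl = subst (λ y → 2 ∣ y + a) c≡ ca
        ... | inj₂ refl = subst (λ y → 2 ∣ y + b) d≡ db
        cases (inj₂ Ax) = subst (λ y → 2 ∣ bit y + (hd (D₁ ++ D₂) (δ x) + tok Q (δ x)))
            (sym (δ-false {x} {proj₂ e} λ { refl → clash Ax Ae })) (other x Vx Ax)
      δuv : δ u v ≡ false
      δuv = δ-false {u} {v} (u≢v ∘ sym)
      δvu : δ v u ≡ false
      δvu = δ-false {v} {u} u≢v
      correct : Dec (2 ∣ a) → ∃ λ D → Ornt (E₁ ++ (u , v) ∷ E₂) D × ∀ x → V x ≡ true → 2 ∣ hd D (δ x) + tok Q (δ x)
      correct (yes even) = _ , Ornt-++ o₁ (keep o₂) ,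
        at (u , v) 0 1 (cong bit (sym δuv)) (cong bit (sym (δ-refl v))) Av even
            (∣m+n∣m⇒∣n (subst (2 ∣_) (sym (ℕ.+-suc a b)) gA) even)
      correct (no odd) = _ , Ornt-++ o₁ (flip o₂) ,
        at (v , u) 1 0 (cong bit (sym (δ-refl u))) (cong bit (sym δvu)) Au (odd⇒ a odd) (∣m+n∣m⇒∣n gA (odd⇒ a odd))

module Cases {n d : ℕ} (G : Digraph n) (simple : IsSimple G) (regular : IsRegular d G) where

  open Oriented {n} {1} G simple using (adj)

  star-k≡1 : HasStarDecomposition 1 G
  star-k≡1 = Oriented.orientation⇒stars {n} {1} G simple (Edges.Ornt-refl (suc n) _) (λ v → 1∣ _)

  star-main : ∀ h → 2 * suc h < d → 0 < n → 2 * suc h ∣ d * n → CutBound (Mod.K h) adj →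
      HasStarDecomposition (suc h) G
  star-main h lt (s≤s z≤n) dvd bound = B.finish sol
    where
    open Mod h
    r β : ℕ
    r = d % L
    -- Reduced once more because `L ∸ r` is L itself when r = 0.
    β = (L ∸ r) % L
    L<d : L < d
    L<d = subst (_< d) (sym (L≡2k h)) lt
    d+β : L ∣ d + β
    d+β = ∣m+n∣m⇒∣n (subst (L ∣_) eq (n∣m*n (suc (d / L)))) (n∣m*n ((L ∸ r) / L))
      where
      c = L ∸ r
      lem : ∀ q r b p → q + r + (b + p) ≡ p + (r + q + b)
      lem = ℕ-Solver.solve-∀
      eq : suc (d / L) * L ≡ c / L * L + (d + β)
      eq = begin
        L + d / L * L                     ≡⟨ ℕ.+-comm L _ ⟩
        d / L * L + L                     ≡⟨ cong (d / L * L +_) (sym (ℕ.m+[n∸m]≡n (ℕ.<⇒≤ (m%n<n d L)))) ⟩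
        d / L * L + (r + c)               ≡⟨ sym (ℕ.+-assoc (d / L * L) r c) ⟩
        d / L * L + r + c                 ≡⟨ cong (d / L * L + r +_) (m≡m%n+[m/n]*n c L) ⟩
        d / L * L + r + (β + c / L * L)   ≡⟨ lem (d / L * L) r β (c / L * L) ⟩
        c / L * L + (r + d / L * L + β)   ≡⟨ cong (λ y → c / L * L + (y + β)) (sym (m≡m%n+[m/n]*n d L)) ⟩
        c / L * L + (d + β)               ∎
        where open ≡-Reasoning
    βn : L ∣ β * n
    βn = ∣m+n∣m⇒∣n (subst (L ∣_) (ℕ.*-distribʳ-+ n d β) (∣m⇒∣m*n n d+β)) (subst (_∣ d * n) (sym (L≡2k h)) dvd)
    -- d + β is a multiple of L beyond L, hence at least 2L.
    single≥ : K ≤ d + β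
    single≥ = multiple≥K d+β (ℕ.<-≤-trans L<d (ℕ.m≤m+n d β))
    module B = Regular.Balanced G simple regular h β (m%n<n (L ∸ r) L) d+β βn bound single≥
    sol : Orientation.Sol (suc n) zero h B.I
    sol with K ≤? d + r
    ... | yes le = B.rootless le
    -- Here d < K < 2L, and L < d, so the quotient of d by L is 1.
    ... | no ¬le = B.rooted zero (ℕ.<⇒≤ (ℕ.≰⇒> ¬le)) (go (d / L) (m≡m%n+[m/n]*n d L))
      where
      go : ∀ q → d ≡ r + q * L → d ≡ L + r
      go zero eq = ⊥-elim (ℕ.<⇒≱ (m%n<n d L) (ℕ.≤-trans (ℕ.<⇒≤ L<d) (ℕ.≤-reflexive (trans eq (ℕ.+-identityʳ r)))))
      go (suc zero) eq = trans eq (trans (ℕ.+-comm r (1 * L)) (cong (_+ r) (ℕ.*-identityˡ L)))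
      go (suc (suc q)) eq = ⊥-elim (¬le (ℕ.≤-trans
          (ℕ.≤-trans (K≤2L q) (ℕ.≤-trans (ℕ.m≤n+m _ r) (ℕ.≤-reflexive (sym eq)))) (ℕ.m≤m+n d r)))

  -- An Eulerian orientation: no vertex has positive net degree, and the net degrees add up to 0.
  star-euler : ∀ k .{{_ : NonZero k}} → d ≡ 2 * k → CutBound 2 adj → HasStarDecomposition k G
  star-euler k@(suc k-1) d≡ bound = Oriented.orientation⇒stars {n} {k} G simple o div
    where
    open Edges (suc n)
    open EdgeList (suc n) using (indeg; indeg-net)
    V = Regular.V G simple regular 0
    2≤d : 2 ≤ d
    2≤d = subst (2 ≤_) (sym d≡) (ℕ.*-monoʳ-≤ 2 (s≤s (z≤n {k-1})))
    -- h = 0 and no tokens: net degrees are even and at most 1, hence at most 0.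
    module B = Regular.Balanced G simple regular 0 0 (s≤s z≤n)
        (subst (2 ∣_) (sym (trans (ℕ.+-identityʳ d) d≡)) (m∣m*n k)) (divides 0 refl) bound
                  (ℕ.≤-trans 2≤d (ℕ.m≤m+n d 0))
    sol = B.rootless (ℕ.≤-trans 2≤d (ℕ.m≤m+n d (d % 2)))
    D = proj₁ sol
    o = proj₁ (proj₂ sol)
    ≤0 : ∀ v → net D (δ (suc v)) ≤ᶻ pos 0
    ≤0 v = subst (λ F → net F (δ (suc v)) ≤ᶻ pos 0) (++-identityʳ D)
        (Mod.balanced≤0 0 (proj₂ (proj₂ sol) (suc v) refl) (subst (2 ∣_) (sym (B.tokδ v)) (divides 0 refl)))
    net-V : net D V ≡ pos 0
    net-V = cut≡0⇒net≡0 D V (trans (Ornt-cut o V) B.cutV)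
    net≡0 : ∀ v → net D (δ (suc v)) ≡ pos 0
    net≡0 v = ℤ.≤-antisym (≤0 v) (subst (pos 0 ≤ᶻ_) (sym eq) (ℤ.neg-mono-≤ rest))
      where
      U = V ∖ suc v
      rest : net D U ≤ᶻ pos 0
      rest = net-nonpositive D V (λ { zero () ; (suc v) _ → ≤0 v }) (suc (size U)) U (∖-⊆ {V}) ℕ.≤-refl
      lem : ∀ a b → a ≡ (a +ᶻ b) +ᶻ neg b
      lem = ℤ-Solver.solve-∀
      eq : net D (δ (suc v)) ≡ neg (net D U)
      eq = trans (lem (net D (δ (suc v))) (net D U))
          (trans (cong (_+ᶻ neg (net D U)) (trans (sym (net-⊕ {δ (suc v)} {U} {V} (∖-⊕ {V} {suc v} refl) D)) net-V))
          (ℤ.+-identityˡ _))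
    div : ∀ v → k ∣ indeg D (suc v)
    div v = divides 1 (trans (ℕ.*-cancelˡ-≡ _ k 2 (trans (lem (indeg D x)) (trans (ℤ.+-injective eq) d≡)))
        (sym (ℕ.+-identityʳ k)))
      where
      x : X
      x = suc v
      lem : ∀ a → 2 * a ≡ a + a
      lem = ℕ-Solver.solve-∀
      cut-δ : cut D (δ x) ≡ d
      cut-δ = trans (Ornt-cut o (δ x)) (Regular.cut-vertex G simple regular 0 v)
      eq : pos (indeg D x + indeg D x) ≡ pos d
      eq = trans (indeg-net D x) (trans (cong₂ (λ a b → a +ᶻ pos (b + b))
          (cong₂ (λ a b → pos a +ᶻ b) cut-δ (net≡0 v)) (Oriented.cnt-loop {n} {1} G simple o v))
          (trans (ℤ.+-identityʳ _) (ℤ.+-identityʳ _)))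

  -- In-degrees need only be even, and the number of edges, 3n / 2, is even because 4 divides 3n. A
  -- single vertex or its complement has cut 3, so `bound` gives connectivity.
  star-32 : d ≡ 3 → 4 ∣ 3 * n → CutBound 1 adj → HasStarDecomposition 2 G
  star-32 d≡3 4∣3n bound = Oriented.orientation⇒stars {n} {2} G simple (proj₁ (proj₂ sol))
      λ v → subst (2 ∣_) (ℕ.+-identityʳ _) (proj₂ (proj₂ sol) (suc v) refl)
    where
    open Parity (suc n)
    open EdgeList (suc n)
    open Oriented {n} {2} G simple using (adj-sym; adj-irr; EG)
    open Edges (suc n)
    V = Regular.V G simple regular 0
    cutEG = Regular.cutEG G simple regular 0
    rg = toM-regular {G = G} (simple , regular)
    ins : Inside V EG
    ins = All-edges suc adj λ _ _ → refl , refl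
    conn : Connected V EG
    conn B B⊆V (zero , Bp) _ = ⊥-elim (false≢true (B⊆V zero Bp))
    conn B B⊆V (suc p , Bp) (suc q , _ , Bq) = subst (0 <_) (sym (cutEG B)) main
      where
      s t : ℕ
      s = ∑ (bit ∘ B ∘ suc)
      t = ∑ (bit ∘ not ∘ B ∘ suc)
      main : 0 < cutM adj (B ∘ suc)
      main with s ℕ.≟ 1
      ... | yes s≡1 = subst (0 <_) (sym (trans (cutM-single rg (B ∘ suc) s≡1) d≡3)) (s≤s z≤n)
      ... | no s≢1 with t ℕ.≟ 1
      ... | no t≢1 = bound (B ∘ suc) (ℕ.≤∧≢⇒< (∑-bit-≥1 (B ∘ suc) p Bp) (s≢1 ∘ sym))
          (ℕ.≤∧≢⇒< (∑-bit-≥1 (not ∘ B ∘ suc) q (cong not Bq)) (t≢1 ∘ sym))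
      ... | yes t≡1 = subst (0 <_) (sym (trans (trans (sym (cutM-not adj adj-sym (B ∘ suc)))
          (cutM-single rg (not ∘ B ∘ suc) t≡1)) d≡3)) (s≤s z≤n)
    len : 2 ∣ length EG
    len = *-cancelˡ-∣ 2 (subst (4 ∣_) (sym (trans eq₁ (wt-edges (λ _ _ → 1) suc adj (λ _ _ → refl) adj-sym adj-irr)))
        (subst (4 ∣_) (sym eq₂) 4∣3n))
      where
      wt1 : ∀ E → wt (λ _ _ → 1) E ≡ length E
      wt1 []      = refl
      wt1 (e ∷ E) = cong suc (wt1 E)
      eq₁ : 2 * length EG ≡ wt (λ _ _ → 1) EG + wt (λ _ _ → 1) EG
      eq₁ = trans (cong (length EG +_) (ℕ.+-identityʳ _)) (cong₂ _+_ (sym (wt1 EG)) (sym (wt1 EG)))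
      eq₂ : ∑ (λ i → ∑ λ j → bit (adj i j) * 1) ≡ 3 * n
      eq₂ = trans (∑-cong λ i → trans (∑-cong λ j → ℕ.*-identityʳ (bit (adj i j))) (trans (RegularM.reg rg i) d≡3))
          (trans (∑-const n 3) (ℕ.*-comm n 3))
    sol = parity-orientation (suc (size V)) V EG [] ℕ.≤-refl ins conn (subst (2 ∣_) (sym (ℕ.+-identityʳ _)) len)

-- Binomial coefficients

binom : ℕ → ℕ → ℕ
binom n       zero    = 1
binom zero    (suc k) = 0
binom (suc n) (suc k) = binom n k + binom n (suc k)

binom-> : ∀ n k → n < k → binom n k ≡ 0
binom-> zero    (suc k) lt       = refl
binom-> (suc n) (suc k) (s≤s lt) = cong₂ _+_ (binom-> n k lt) (binom-> n (suc k) (ℕ.m≤n⇒m≤1+n lt))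

binom-nn : ∀ n → binom n n ≡ 1
binom-nn zero    = refl
binom-nn (suc n) = cong₂ _+_ (binom-nn n) (binom-> n (suc n) ℕ.≤-refl)

binom>0 : ∀ n k → k ≤ n → 0 < binom n k
binom>0 n       zero    le       = s≤s z≤n
binom>0 (suc n) (suc k) (s≤s le) = ℕ.≤-trans (binom>0 n k le) (ℕ.m≤m+n _ _)

binom-1 : ∀ n → binom n 1 ≡ n
binom-1 zero    = refl
binom-1 (suc n) = cong suc (binom-1 n)

binom-absorb : ∀ n k → binom (suc n) (suc k) * suc k ≡ suc n * binom n k
binom-absorb n       zero    = cong (λ b → suc b * 1) (binom-1 n)
binom-absorb zero    (suc k) = refl
binom-absorb (suc n) (suc k) = begin
  (a + b) * suc (suc k)             ≡⟨ lem a b k ⟩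
  a * suc k + (a + b * suc (suc k)) ≡⟨ cong₂ (λ x y → x + (a + y)) (binom-absorb n k) (binom-absorb n (suc k)) ⟩
  suc n * binom n k + (a + suc n * binom n (suc k)) ≡⟨ lem₂ (binom n k) (binom n (suc k)) n ⟩
  suc (suc n) * a ∎
  where
  open ≡-Reasoning
  a = binom (suc n) (suc k)
  b = binom (suc n) (suc (suc k))
  lem : ∀ a b k → (a + b) * suc (suc k) ≡ a * suc k + (a + b * suc (suc k))
  lem = ℕ-Solver.solve-∀
  lem₂ : ∀ x y n → suc n * x + ((x + y) + suc n * y) ≡ suc (suc n) * (x + y)
  lem₂ = ℕ-Solver.solve-∀

binom-step : ∀ n k → binom n (suc k) * suc k ≡ binom n k * (n ∸ k)
binom-step zero    zero    = refl
binom-step zero    (suc k) = refl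
binom-step (suc n) zero    = trans (binom-absorb n zero) (ℕ.*-comm (suc n) 1)
binom-step (suc n) (suc k) = begin
  (a + b) * suc (suc k)       ≡⟨ lem a b k ⟩
  a * suc k + a + b * suc (suc k) ≡⟨ cong₂ (λ x y → x + a + y) (binom-step n k) (binom-step n (suc k)) ⟩
  binom n k * (n ∸ k) + a + a * (n ∸ suc k) ≡⟨ ℕ.+-assoc (binom n k * (n ∸ k)) a _ ⟩
  binom n k * (n ∸ k) + (a + a * (n ∸ suc k)) ≡⟨ cong (binom n k * (n ∸ k) +_) tail ⟩
  binom n k * (n ∸ k) + a * (n ∸ k) ≡⟨ sym (ℕ.*-distribʳ-+ (n ∸ k) (binom n k) a) ⟩
  (binom n k + a) * (n ∸ k) ∎
  where
  open ≡-Reasoning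
  a = binom n (suc k)
  b = binom n (suc (suc k))
  lem : ∀ a b k → (a + b) * suc (suc k) ≡ a * suc k + a + b * suc (suc k)
  lem = ℕ-Solver.solve-∀
  tail : a + a * (n ∸ suc k) ≡ a * (n ∸ k)
  tail with suc k ≤? n
  ... | yes le = trans (sym (ℕ.*-suc a (n ∸ suc k))) (cong (a *_) (sym (ℕ.+-∸-assoc 1 le)))
  ... | no ¬le rewrite binom-> n (suc k) (ℕ.≰⇒> ¬le) = refl

-- The left side is one term of Vandermonde's convolution for the right side.
binom-superadd : ∀ a b i j → binom a i * binom b j ≤ binom (a + b) (i + j)
binom-superadd a       b zero    j = ℕ.≤-trans (ℕ.≤-reflexive (ℕ.+-identityʳ _)) (up a)
  where
  up : ∀ a → binom b j ≤ binom (a + b) j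
  up zero    = ℕ.≤-refl
  up (suc a) = ℕ.≤-trans (up a) (mono (a + b) j)
    where
    mono : ∀ n k → binom n k ≤ binom (suc n) k
    mono n zero    = ℕ.≤-refl
    mono n (suc k) = ℕ.m≤n+m _ _
binom-superadd zero    b (suc i) j = z≤n
binom-superadd (suc a) b (suc i) j = ℕ.≤-trans (ℕ.≤-reflexive
    (ℕ.*-distribʳ-+ (binom b j) (binom a i) (binom a (suc i))))
  (ℕ.+-mono-≤ (binom-superadd a b i j) (binom-superadd a b (suc i) j))

-- A polynomial bound in J for fixed c; it will be applied to cut sizes c below 2d.
binom-upper : ∀ c J → binom (J + c) J ≤ suc J ^ c
binom-upper c       zero    = ℕ.≤-reflexive (sym (ℕ.^-zeroˡ c))
binom-upper zero    (suc J) = ℕ.≤-reflexive (trans (cong (λ x → binom x (suc J)) (ℕ.+-identityʳ (suc J)))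
    (binom-nn (suc J)))
binom-upper (suc c) (suc J) = begin
  binom (J + suc c) J + binom (J + suc c) (suc J) ≡⟨ cong (λ x → binom (J + suc c) J + binom x (suc J))
      (ℕ.+-suc J c) ⟩
  binom (J + suc c) J + binom (suc J + c) (suc J) ≤⟨ ℕ.+-mono-≤ (binom-upper (suc c) J) (binom-upper c (suc J)) ⟩
  suc J * suc J ^ c + suc (suc J) ^ c ≤⟨ ℕ.+-monoˡ-≤ _ (ℕ.*-monoʳ-≤ (suc J) (ℕ.^-monoˡ-≤ c (ℕ.n≤1+n (suc J)))) ⟩
  suc J * suc (suc J) ^ c + suc (suc J) ^ c ≡⟨ ℕ.+-comm (suc J * suc (suc J) ^ c) _ ⟩
  suc (suc J) * suc (suc J) ^ c ∎
  where open ℕ.≤-Reasoning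

sumTo : ℕ → (ℕ → ℕ) → ℕ
sumTo zero    f = 0
sumTo (suc n) f = f 0 + sumTo n (f ∘ suc)

sumTo-cong : ∀ n {f g} → (∀ i → f i ≡ g i) → sumTo n f ≡ sumTo n g
sumTo-cong zero    eq = refl
sumTo-cong (suc n) eq = cong₂ _+_ (eq 0) (sumTo-cong n (eq ∘ suc))

sumTo-mono : ∀ n {f g} → (∀ i → i < n → f i ≤ g i) → sumTo n f ≤ sumTo n g
sumTo-mono zero    le = z≤n
sumTo-mono (suc n) le = ℕ.+-mono-≤ (le 0 (s≤s z≤n)) (sumTo-mono n (λ i i<n → le (suc i) (s≤s i<n)))

sumTo-+ : ∀ n f g → sumTo n (λ i → f i + g i) ≡ sumTo n f + sumTo n g
sumTo-+ zero    f g = refl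
sumTo-+ (suc n) f g = trans (cong (f 0 + g 0 +_) (sumTo-+ n (f ∘ suc) (g ∘ suc))) (+-interchange (f 0) (g 0) _ _)

sumTo-* : ∀ n c f → sumTo n (λ i → c * f i) ≡ c * sumTo n f
sumTo-* zero    c f = sym (ℕ.*-zeroʳ c)
sumTo-* (suc n) c f = trans (cong (c * f 0 +_) (sumTo-* n c (f ∘ suc))) (sym (ℕ.*-distribˡ-+ c (f 0) _))

sumTo-const : ∀ n c → sumTo n (λ _ → c) ≡ n * c
sumTo-const zero    c = refl
sumTo-const (suc n) c = cong (c +_) (sumTo-const n c)

sumTo-last : ∀ n f → sumTo (suc n) f ≡ sumTo n f + f n
sumTo-last zero    f = ℕ.+-identityʳ (f 0)
sumTo-last (suc n) f = trans (cong (f 0 +_) (sumTo-last n (f ∘ suc))) (sym (ℕ.+-assoc (f 0) _ _))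

-- The usual convolution with binom s i read as binom s (s - i).
vandermonde : ∀ s m j → sumTo (suc s) (λ i → binom s i * binom m (i + j)) ≡ binom (s + m) (s + j)
vandermonde zero    m j = trans (ℕ.+-identityʳ _) (ℕ.+-identityʳ _)
vandermonde (suc s) m j = begin
  sumTo (suc (suc s)) (λ i → binom (suc s) i * binom m (i + j))
    ≡⟨ cong (binom m j + 0 +_) (trans (sumTo-cong (suc s)
        (λ i → ℕ.*-distribʳ-+ (binom m (suc i + j)) (binom s i) (binom s (suc i))))
        (sumTo-+ (suc s) (λ i → binom s i * binom m (suc i + j)) (λ i → binom s (suc i) * binom m (suc i + j)))) ⟩
  binom m j + 0 + (sumTo (suc s) (λ i → binom s i * binom m (suc i + j)) + sumTo (suc s)
      (λ i → binom s (suc i) * binom m (suc i + j)))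
    ≡⟨ lem (binom m j + 0) (sumTo (suc s) (λ i → binom s i * binom m (suc i + j))) _ ⟩
  sumTo (suc s) (λ i → binom s i * binom m (suc i + j)) + sumTo (suc (suc s)) f
    ≡⟨ cong₂ _+_ (trans (sumTo-cong (suc s) (λ i → cong (λ x → binom s i * binom m x) (sym (ℕ.+-suc i j))))
        (vandermonde s m (suc j)))
                 (trans (sumTo-last (suc s) f) (trans
                     (cong (λ x → sumTo (suc s) f + x * binom m (suc s + j)) (binom-> s (suc s) ℕ.≤-refl))
                     (trans (ℕ.+-identityʳ _) (vandermonde s m j)))) ⟩
  binom (s + m) (s + suc j) + binom (s + m) (s + j) ≡⟨ cong (λ x → binom (s + m) x + binom (s + m) (s + j))
      (ℕ.+-suc s j) ⟩
  binom (s + m) (suc (s + j)) + binom (s + m) (s + j) ≡⟨ ℕ.+-comm (binom (s + m) (suc (s + j))) _ ⟩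
  binom (suc s + m) (suc s + j) ∎
  where
  open ≡-Reasoning
  f : ℕ → ℕ
  f i = binom s i * binom m (i + j)
  lem : ∀ a b c → a + (b + c) ≡ b + (a + c)
  lem = ℕ-Solver.solve-∀

-- Among t blocks of m elements, one element can be chosen from each.
binom-lower : ∀ t m → m ^ t ≤ binom (t * m) t
binom-lower zero    m = ℕ.≤-refl
binom-lower (suc t) m = ℕ.≤-trans (ℕ.*-mono-≤ (ℕ.≤-reflexive (sym (binom-1 m))) (binom-lower t m))
    (binom-superadd m (t * m) 1 t)

*-^ : ∀ a b n → (a * b) ^ n ≡ a ^ n * b ^ n
*-^ a b zero    = refl
*-^ a b (suc n) = trans (cong (a * b *_) (*-^ a b n)) (lem a b (a ^ n) (b ^ n))
  where
  lem : ∀ a b c d → a * b * (c * d) ≡ a * c * (b * d)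
  lem = ℕ-Solver.solve-∀

private variable
  A : Set

sumL : (A → ℕ) → List A → ℕ
sumL f []       = 0
sumL f (x ∷ xs) = f x + sumL f xs

count : (A → Bool) → List A → ℕ
count P = sumL (bit ∘ P)

count≤length : ∀ (P : A → Bool) xs → count P xs ≤ length xs
count≤length P []       = z≤n
count≤length P (x ∷ xs) = ℕ.+-mono-≤ (bit≤1 (P x)) (count≤length P xs)

sumL-mono : ∀ {f g : A → ℕ} xs → (∀ x → x ∈ᴸ xs → f x ≤ g x) → sumL f xs ≤ sumL g xs
sumL-mono []       le = z≤n
sumL-mono (x ∷ xs) le = ℕ.+-mono-≤ (le x (here refl)) (sumL-mono xs (λ y y∈ → le y (there y∈)))

sumL-+ : ∀ (f g : A → ℕ) xs → sumL (λ x → f x + g x) xs ≡ sumL f xs + sumL g xs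
sumL-+ f g []       = refl
sumL-+ f g (x ∷ xs) = trans (cong (f x + g x +_) (sumL-+ f g xs)) (+-interchange (f x) (g x) (sumL f xs) (sumL g xs))

sumL-*ˡ : ∀ c (f : A → ℕ) xs → sumL (λ x → c * f x) xs ≡ c * sumL f xs
sumL-*ˡ c f []       = sym (ℕ.*-zeroʳ c)
sumL-*ˡ c f (x ∷ xs) = trans (cong (c * f x +_) (sumL-*ˡ c f xs)) (sym (ℕ.*-distribˡ-+ c (f x) (sumL f xs)))

sumL-*ʳ : ∀ (f : A → ℕ) c xs → sumL (λ x → f x * c) xs ≡ sumL f xs * c
sumL-*ʳ f c []       = refl
sumL-*ʳ f c (x ∷ xs) = trans (cong (f x * c +_) (sumL-*ʳ f c xs)) (sym (ℕ.*-distribʳ-+ c (f x) (sumL f xs)))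

sumL-zero : ∀ (xs : List A) → sumL (λ _ → 0) xs ≡ 0
sumL-zero []       = refl
sumL-zero (x ∷ xs) = sumL-zero xs

sumL-∑ : ∀ {n} (f : A → Fin n → ℕ) xs → sumL (λ x → ∑ (f x)) xs ≡ ∑ (λ i → sumL (λ x → f x i) xs)
sumL-∑ {n = n} f []       = sym (∑-zero n)
sumL-∑ f (x ∷ xs) = trans (cong (∑ (f x) +_) (sumL-∑ f xs)) (sym (∑-+ (f x) _))

-- Counting regular graphs

∈-split : ∀ {x : A} {ys} → x ∈ᴸ ys → ∃₂ λ as bs → ys ≡ as ++ x ∷ bs
∈-split (here refl) = [] , _ , refl
∈-split (there p)   = let as , bs , eq = ∈-split p in _ ∷ as , bs , cong (_ ∷_) eq

∈-remove : ∀ {x y : A} as {bs} → y ∈ᴸ as ++ x ∷ bs → x ≢ y → y ∈ᴸ as ++ bs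
∈-remove []       (here eq)   ne = ⊥-elim (ne (sym eq))
∈-remove []       (there p)   ne = p
∈-remove (a ∷ as) (here eq)   ne = here eq
∈-remove (a ∷ as) (there p)   ne = there (∈-remove as p ne)

unique-length : ∀ {xs ys : List A} → Unique xs → (∀ x → x ∈ᴸ xs → x ∈ᴸ ys) → length xs ≤ length ys
unique-length []       sub = z≤n
unique-length {xs = x ∷ xs} (x∉ ∷ u) sub with ∈-split (sub x (here refl))
... | as , bs , refl = ℕ.≤-trans (s≤s (unique-length u λ y y∈ → ∈-remove as (sub y (there y∈)) (All.lookup x∉ y∈)))
    (ℕ.≤-reflexive (trans (cong suc (length-++ as))
        (trans (sym (ℕ.+-suc (length as) (length bs))) (sym (length-++ as)))))

true? : (P : A → Bool) → Decidable (λ x → P x ≡ true)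
true? P x = P x ≟ᵇ true

count≡length : ∀ (P : A → Bool) xs → count P xs ≡ length (filter (true? P) xs)
count≡length P []       = refl
count≡length P (x ∷ xs) with P x
... | true  = cong suc (count≡length P xs)
... | false = count≡length P xs

count-injection : ∀ {P Q : A → Bool} {f : A → A} {xs} → Unique xs → (∀ {x y} → f x ≡ f y → x ≡ y) →
                  (∀ x → x ∈ᴸ xs → P x ≡ true → f x ∈ᴸ xs × Q (f x) ≡ true) → count P xs ≤ count Q xs
count-injection {P = P} {Q} {f} {xs} u inj maps = begin
  count P xs                             ≡⟨ count≡length P xs ⟩
  length (filter (true? P) xs)           ≡⟨ sym (length-map f (filter (true? P) xs)) ⟩
  length (map f (filter (true? P) xs))   ≤⟨ unique-length (Unique.map⁺ inj (Unique.filter⁺ (true? P) u)) sub ⟩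
  length (filter (true? Q) xs)           ≡⟨ sym (count≡length Q xs) ⟩
  count Q xs                             ∎
  where
  open ℕ.≤-Reasoning
  sub : ∀ y → y ∈ᴸ map f (filter (true? P) xs) → y ∈ᴸ filter (true? Q) xs
  sub y y∈ with ∈-map⁻ f y∈
  ... | x , x∈ , refl = let p , q = ∈-filter⁻ (true? P) {xs = xs} x∈ ; r , s = maps x p q in ∈-filter⁺ (true? Q) r s

∈-regularGraphs⁻ : ∀ {n d} {G : Digraph n} → G ∈ᴸ regularGraphs n d → IsRegularGraph d G
∈-regularGraphs⁻ {n} {d} G∈ = proj₂ (∈-filter⁻ (isRegularGraph? d) {xs = vectors (subsets n) n} G∈)

∈-regularGraphs⁺ : ∀ {n d} {G : Digraph n} → IsRegularGraph d G → G ∈ᴸ regularGraphs n d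
∈-regularGraphs⁺ {d = d} {G} p = ∈-filter⁺ (isRegularGraph? d) (vectors-complete subsets-complete G) p

module _ {n : ℕ} where

  fromM : Matrix n → Digraph n
  fromM a = tabulate λ i → tabulate (a i)

  toM-fromM : ∀ a i j → toM (fromM a) i j ≡ a i j
  toM-fromM a i j = trans (cong (λ r → lookup r j) (lookup∘tabulate (λ i → tabulate (a i)) i))
      (lookup∘tabulate (a i) j)

  toM-injective : ∀ {G H : Digraph n} → (∀ i j → toM G i j ≡ toM H i j) → G ≡ H
  toM-injective {G} {H} eq = trans (sym (tabulate∘lookup G))
      (trans (tabulate-cong (λ i → trans (sym (tabulate∘lookup (lookup G i)))
      (trans (tabulate-cong (eq i)) (tabulate∘lookup (lookup H i))))) (tabulate∘lookup H))

  fromM-regular : ∀ {d a} → RegularM d a → IsRegularGraph d (fromM a)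
  fromM-regular {d} {a} r = record
    { irreflexive = λ i p → clash (irr i) (trans (sym (toM-fromM a i i)) ([]=⇒lookup p))
    ; symmetric = λ i j p → lookup⇒[]= i (lookup (fromM a) j)
        (trans (toM-fromM a j i) (trans (symm j i) (trans (sym (toM-fromM a i j)) ([]=⇒lookup p)))) } ,
    λ i → trans (∣∣≡∑ (lookup (fromM a) i)) (trans (∑-cong (λ j → cong bit (toM-fromM a i j))) (reg i))
    where open RegularM r

  pairM : Fin n → Fin n → Matrix n
  pairM p q i j = (⌊ i Fin.≟ p ⌋ ∧ ⌊ j Fin.≟ q ⌋) ∨ (⌊ i Fin.≟ q ⌋ ∧ ⌊ j Fin.≟ p ⌋)

  toggle : Fin n → Fin n → Matrix n → Matrix n
  toggle p q a i j = a i j xor pairM p q i j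

  ≟-yes : ∀ (p : Fin n) → ⌊ p Fin.≟ p ⌋ ≡ true
  ≟-yes p with p Fin.≟ p
  ... | yes _ = refl
  ... | no ne = ⊥-elim (ne refl)

  ≟-no : ∀ {p q : Fin n} → p ≢ q → ⌊ p Fin.≟ q ⌋ ≡ false
  ≟-no {p} {q} ne with p Fin.≟ q
  ... | yes e = ⊥-elim (ne e)
  ... | no _ = refl

  pairM-sym : ∀ p q → Symmetric (pairM p q)
  pairM-sym p q i j = trans (∨-comm (⌊ i Fin.≟ p ⌋ ∧ ⌊ j Fin.≟ q ⌋) _)
      (cong₂ _∨_ (∧-comm ⌊ i Fin.≟ q ⌋ _) (∧-comm ⌊ i Fin.≟ p ⌋ _))

  pairM-true : ∀ {p q i j} → pairM p q i j ≡ true → (i ≡ p × j ≡ q) ⊎ (i ≡ q × j ≡ p)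
  pairM-true {p} {q} {i} {j} eq with i Fin.≟ p | j Fin.≟ q | i Fin.≟ q | j Fin.≟ p | eq
  ... | yes a | yes b | _     | _     | _ = inj₁ (a , b)
  ... | yes _ | no  _ | yes c | yes d | _ = inj₂ (c , d)
  ... | no  _ | _     | yes c | yes d | _ = inj₂ (c , d)

  pairM-false : ∀ {p q i j} → ¬ (i ≡ p × j ≡ q) → ¬ (i ≡ q × j ≡ p) → pairM p q i j ≡ false
  pairM-false n₁ n₂ = ¬true⇒false λ eq → Sum.[ n₁ , n₂ ] (pairM-true eq)

  toggle-sym : ∀ {p q a} → Symmetric a → Symmetric (toggle p q a)
  toggle-sym {p} {q} sm i j = cong₂ _xor_ (sm i j) (pairM-sym p q i j)

  toggle-irr : ∀ {p q a} → p ≢ q → Irreflexive a → Irreflexive (toggle p q a)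
  toggle-irr {p} {q} p≢q ir i = cong₂ _xor_ (ir i)
      (pairM-false {p} {q} {i} {i} (λ (x , y) → p≢q (trans (sym x) y)) (λ (x , y) → p≢q (trans (sym y) x)))

  toggle-off : ∀ {p q a i j} → ¬ (i ≡ p × j ≡ q) → ¬ (i ≡ q × j ≡ p) → toggle p q a i j ≡ a i j
  toggle-off {a = a} {i} {j} n₁ n₂ = trans (cong (a i j xor_) (pairM-false n₁ n₂)) (xor-identityʳ (a i j))

  -- Degrees and cut sizes are both weights (`degree≡weight`, `cutM≡weight`), so one computation of
  -- the effect of a toggle yields regularity and the change of the cut.
  weight : (Fin n → Fin n → ℕ) → Matrix n → ℕ
  weight w a = ∑ λ i → ∑ λ j → bit (a i j) * w i j

  weight-pair : ∀ {p q} → p ≢ q → ∀ w → weight w (pairM p q) ≡ w p q + w q p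
  weight-pair {p} {q} p≢q w = trans (∑-cong λ i → trans (∑-cong (λ j → pt i j)) (∑-+ (t p q i) (t q p i)))
    (trans (∑-+ (λ i → ∑ (t p q i)) _) (cong₂ _+_ (pick p q) (pick q p)))
    where
    t : Fin n → Fin n → Fin n → Fin n → ℕ
    t p q i j = bit (⌊ i Fin.≟ p ⌋ ∧ ⌊ j Fin.≟ q ⌋) * w i j
    pick : ∀ p q → ∑ (λ i → ∑ (t p q i)) ≡ w p q
    pick p q = trans (∑-single p λ i ne → ∑-zero′ λ j → cong (λ b → bit (b ∧ ⌊ j Fin.≟ q ⌋) * w i j) (≟-no ne))
      (trans (∑-single q λ j ne → trans (cong₂ (λ b c → bit (b ∧ c) * w p j) (≟-yes p) (≟-no ne)) refl)
        (trans (cong₂ (λ b c → bit (b ∧ c) * w p q) (≟-yes p) (≟-yes q)) (ℕ.+-identityʳ _)))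
    pt : ∀ i j → bit (pairM p q i j) * w i j ≡ t p q i j + t q p i j
    pt i j with i Fin.≟ p | i Fin.≟ q
    ... | yes x | yes y = ⊥-elim (p≢q (trans (sym x) y))
    ... | yes _ | no _ with j Fin.≟ q
    ... | yes _ = sym (ℕ.+-identityʳ _)
    ... | no _ = refl
    pt i j | no _ | yes _ = refl
    pt i j | no _ | no _ = refl

  weight-add : ∀ {p q a} → p ≢ q → Symmetric a → a p q ≡ false → ∀ w →
      weight w (toggle p q a) ≡ weight w a + (w p q + w q p)
  weight-add {p} {q} {a} p≢q sm apq w = trans (∑-cong λ i → trans (∑-cong (λ j → pt i j))
      (∑-+ (λ j → bit (a i j) * w i j) _))
    (trans (∑-+ (λ i → ∑ λ j → bit (a i j) * w i j) _) (cong (weight w a +_) (weight-pair p≢q w)))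
    where
    pt : ∀ i j → bit (toggle p q a i j) * w i j ≡ bit (a i j) * w i j + bit (pairM p q i j) * w i j
    pt i j with pairM p q i j in eq
    ... | false with a i j
    ... | true  = sym (ℕ.+-identityʳ _)
    ... | false = refl
    pt i j | true with pairM-true {p} {q} {i} {j} eq
    ... | inj₁ (refl , refl) rewrite apq = refl
    ... | inj₂ (refl , refl) rewrite sm q p | apq = refl

  weight-remove : ∀ {p q a} → p ≢ q → Symmetric a → a p q ≡ true → ∀ w →
      weight w (toggle p q a) + (w p q + w q p) ≡ weight w a
  weight-remove {p} {q} {a} p≢q sm apq w = sym (trans
      (∑-cong λ i → trans (∑-cong (λ j → pt i j)) (∑-+ (λ j → bit (toggle p q a i j) * w i j) _))
    (trans (∑-+ (λ i → ∑ λ j → bit (toggle p q a i j) * w i j) _)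
        (cong (weight w (toggle p q a) +_) (weight-pair p≢q w))))
    where
    pt : ∀ i j → bit (a i j) * w i j ≡ bit (toggle p q a i j) * w i j + bit (pairM p q i j) * w i j
    pt i j with pairM p q i j in eq
    ... | false with a i j
    ... | true  = sym (ℕ.+-identityʳ _)
    ... | false = refl
    pt i j | true with pairM-true {p} {q} {i} {j} eq
    ... | inj₁ (refl , refl) rewrite apq = refl
    ... | inj₂ (refl , refl) rewrite sm q p | apq = refl

  degree≡weight : ∀ a v → ∑ (bit ∘ a v) ≡ weight (λ i j → bit ⌊ i Fin.≟ v ⌋) a
  degree≡weight a v = sym (trans (∑-single v λ i ne → ∑-zero′ λ j → trans
      (cong (λ b → bit (a i j) * bit b) (≟-no ne)) (ℕ.*-zeroʳ (bit (a i j))))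
    (∑-cong λ j → trans (cong (λ b → bit (a v j) * bit b) (≟-yes v)) (ℕ.*-identityʳ _)))

  cutM≡weight : ∀ a B → cutM a B ≡ weight (λ i j → bit (B i ∧ not (B j))) a
  cutM≡weight a B = ∑-cong λ i → ∑-cong λ j → bit-∧ (a i j) (B i ∧ not (B j))

⌊⌋-true : ∀ {p} {P : Set p} (P? : Dec P) → ⌊ P? ⌋ ≡ true → P
⌊⌋-true (yes p) _ = p

true-⌊⌋ : ∀ {p} {P : Set p} (P? : Dec P) → P → ⌊ P? ⌋ ≡ true
true-⌊⌋ (yes _) _ = refl
true-⌊⌋ (no np) p = ⊥-elim (np p)

∧-true : ∀ {a b} → a ∧ b ≡ true → a ≡ true × b ≡ true
∧-true {true} {true} _ = refl , refl

not-true : ∀ {a} → not a ≡ true → a ≡ false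
not-true {false} _ = refl

∑∑-+ : ∀ {m k} (f g : Fin m → Fin k → ℕ) → ∑ (λ u → ∑ λ v → f u v + g u v) ≡ ∑ (λ u → ∑ (f u)) + ∑ (λ u → ∑ (g u))
∑∑-+ f g = trans (∑-cong λ u → ∑-+ (f u) (g u)) (∑-+ (λ u → ∑ (f u)) _)

-- Switchings.

module _ {n : ℕ} where

  switch : Fin n → Fin n → Fin n → Fin n → Matrix n → Matrix n
  switch x y u v a = toggle y v (toggle x u (toggle u v (toggle x y a)))

  switchG : Fin n → Fin n → Fin n → Fin n → Digraph n → Digraph n
  switchG x y u v G = fromM (switch x y u v (toM G))

  -- For fixed x, y, u, v the switching adds a fixed matrix modulo 2, so it is injective on all
  -- matrices, whether or not the quadruple is valid.
  switchG-injective : ∀ x y u v {G H} → switchG x y u v G ≡ switchG x y u v H → G ≡ H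
  switchG-injective x y u v {G} {H} eq = toM-injective λ i j →
    xor-cancel (xor-cancel (xor-cancel (xor-cancel
        (trans (sym (toM-fromM (switch x y u v (toM G)) i j))
        (trans (cong (λ K → toM K i j) eq) (toM-fromM (switch x y u v (toM H)) i j))))))
    where
    xor-cancel : ∀ {a b t} → a xor t ≡ b xor t → a ≡ b
    xor-cancel {true}  {true}  {t} _ = refl
    xor-cancel {false} {false} {t} _ = refl
    xor-cancel {true}  {false} {true}  ()
    xor-cancel {true}  {false} {false} ()
    xor-cancel {false} {true}  {true}  ()
    xor-cancel {false} {true}  {false} ()

  outside : (Fin n → Bool) → Matrix n → Fin n → Fin n → Bool
  outside B a u v = inside (not ∘ B) a u v

  across : (Fin n → Bool) → Matrix n → Fin n → Fin n → Bool
  across B a x u = a x u ∧ (B x ∧ not (B u))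

  free : Matrix n → (x y u v : Fin n) → Bool
  free a x y u v = not (a x u) ∧ not (a y v)

  module Switch {d} {a : Matrix n} (r : RegularM d a) (B : Fin n → Bool) {x y u v : Fin n}
    (axy : a x y ≡ true) (Bx : B x ≡ true) (By : B y ≡ true) (auv : a u v ≡ true) (Bu : B u ≡ false)
        (Bv : B v ≡ false)
    (axu : a x u ≡ false) (ayv : a y v ≡ false) where
    open RegularM r

    sides : ∀ {p q} → B p ≡ true → B q ≡ false → p ≢ q
    sides bp bq refl = clash bq bp

    x≢y : x ≢ y
    x≢y refl = clash (irr x) axy
    u≢v : u ≢ v
    u≢v refl = clash (irr u) auv

    a₁ = toggle x y a
    a₂ = toggle u v a₁
    a₃ = toggle x u a₂
    a₄ = toggle y v a₃

    s₁ : Symmetric a₁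
    s₁ = toggle-sym {n} {x} {y} symm
    s₂ : Symmetric a₂
    s₂ = toggle-sym {n} {u} {v} s₁
    s₃ : Symmetric a₃
    s₃ = toggle-sym {n} {x} {u} s₂

    uv₁ : a₁ u v ≡ true
    uv₁ = trans (toggle-off {n} {x} {y} {a} (λ (e , _) → sides Bx Bu (sym e)) (λ (e , _) → sides By Bu (sym e))) auv

    xu₂ : a₂ x u ≡ false
    xu₂ = trans (toggle-off {n} {u} {v} {a₁} (λ (e , _) → sides Bx Bu e) (λ (e , _) → sides Bx Bv e))
         (trans (toggle-off {n} {x} {y} {a} (λ (_ , e) → sides By Bu (sym e)) (λ (e , _) → x≢y e)) axu)

    yv₃ : a₃ y v ≡ false
    yv₃ = trans (toggle-off {n} {x} {u} {a₂} (λ (e , _) → x≢y (sym e)) (λ (e , _) → sides By Bu e))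
         (trans (toggle-off {n} {u} {v} {a₁} (λ (e , _) → sides By Bu e) (λ (e , _) → sides By Bv e))
         (trans (toggle-off {n} {x} {y} {a} (λ (e , _) → x≢y (sym e)) (λ (_ , e) → sides Bx Bv (sym e))) ayv))

    switch-weight : ∀ w → weight w a₄ + ((w x y + w y x) + (w u v + w v u)) ≡ weight w a
        + ((w x u + w u x) + (w y v + w v y))
    switch-weight w = begin
      weight w a₄ + (xy + uv)            ≡⟨ cong (_+ (xy + uv)) (weight-add (sides By Bv) s₃ yv₃ w) ⟩
      weight w a₃ + yv + (xy + uv)       ≡⟨ cong (λ t → t + yv + (xy + uv)) (weight-add (sides Bx Bu) s₂ xu₂ w) ⟩
      weight w a₂ + xu + yv + (xy + uv)  ≡⟨ lem (weight w a₂) xu yv xy uv ⟩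
      weight w a₂ + uv + xy + (xu + yv)  ≡⟨ cong (λ t → t + xy + (xu + yv)) (weight-remove u≢v s₁ uv₁ w) ⟩
      weight w a₁ + xy + (xu + yv)       ≡⟨ cong (_+ (xu + yv)) (weight-remove x≢y symm axy w) ⟩
      weight w a + (xu + yv)             ∎
      where
      open ≡-Reasoning
      xy = w x y + w y x
      uv = w u v + w v u
      xu = w x u + w u x
      yv = w y v + w v y
      lem : ∀ w a b c d → w + a + b + (c + d) ≡ w + d + c + (a + b)
      lem = ℕ-Solver.solve-∀

    switch-regular : RegularM d a₄
    switch-regular = record
      { symm = toggle-sym {n} {y} {v} s₃
      ; irr = toggle-irr {n} {y} {v} {a₃} (sides By Bv)
          (toggle-irr {n} {x} {u} {a₂} (sides Bx Bu)
          (toggle-irr {n} {u} {v} {a₁} u≢v (toggle-irr {n} {x} {y} {a} x≢y irr)))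
      ; reg = λ z → trans (degree≡weight a₄ z) (trans
          (ℕ.+-cancelʳ-≡ _ _ _ (trans (switch-weight (w z))
          (cong (weight (w z) a +_) (lem (i z x) (i z y) (i z u) (i z v)))))
          (trans (sym (degree≡weight a z)) (reg z))) }
      where
      i : Fin n → Fin n → ℕ
      i z p = bit ⌊ p Fin.≟ z ⌋
      w : Fin n → Fin n → Fin n → ℕ
      w z p q = i z p
      lem : ∀ a b c d → (a + c) + (b + d) ≡ (a + b) + (c + d)
      lem = ℕ-Solver.solve-∀

    switch-cut : cutM a₄ B ≡ 2 + cutM a B
    switch-cut = trans (cutM≡weight a₄ B) (trans (eq (switch-weight (λ i j → bit (B i ∧ not (B j)))))
        (cong (2 +_) (sym (cutM≡weight a B))))
      where
      W = weight (λ i j → bit (B i ∧ not (B j)))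
      eq : W a₄ + ((bit (B x ∧ not (B y)) + bit (B y ∧ not (B x)))
          + (bit (B u ∧ not (B v)) + bit (B v ∧ not (B u)))) ≡
           W a + ((bit (B x ∧ not (B u)) + bit (B u ∧ not (B x))) + (bit (B y ∧ not (B v)) + bit
               (B v ∧ not (B y)))) → W a₄ ≡ 2 + W a
      eq e rewrite Bx | By | Bu | Bv = trans (sym (ℕ.+-identityʳ _)) (trans e (ℕ.+-comm (W a) 2))

    switch-xu : a₄ x u ≡ true
    switch-xu = trans (toggle-off {n} {y} {v} {a₃} (λ (e , _) → x≢y e) (λ (e , _) → sides Bx Bv e))
        (cong₂ _xor_ xu₂ on)
      where
      on : pairM x u x u ≡ true
      on rewrite ≟-yes x | ≟-yes u = refl

    switch-yv : a₄ y v ≡ true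
    switch-yv = cong₂ _xor_ yv₃ on
      where
      on : pairM y v y v ≡ true
      on rewrite ≟-yes y | ≟-yes v = refl

  -- At most d² of the directed edges start at a neighbour of x, and at most d² end at a neighbour of y.
  outside-free : ∀ {d a} → RegularM d a → ∀ B x y →
      internal (not ∘ B) a ≤ ∑ (λ u → ∑ λ v → bit (outside B a u v ∧ free a x y u v)) + (d * d + d * d)
  outside-free {d} {a} r B x y = begin
    internal (not ∘ B) a ≤⟨ ∑-mono (λ u → ∑-mono λ v → bits (a u v) (not (B u) ∧ not (B v)) (a x u) (a y v)) ⟩
    ∑ (λ u → ∑ λ v → bit (outside B a u v ∧ free a x y u v) + (bit (a x u) * bit (a u v) + bit (a y v) * bit
        (a u v))) ≡⟨ trans (∑∑-+ (λ u v → bit (outside B a u v ∧ free a x y u v)) _)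
        (cong (∑ (λ u → ∑ λ v → bit (outside B a u v ∧ free a x y u v)) +_)
        (∑∑-+ (λ u v → bit (a x u) * bit (a u v)) _)) ⟩
    ∑ (λ u → ∑ λ v → bit (outside B a u v ∧ free a x y u v)) + (∑ (λ u → ∑ λ v → bit (a x u) * bit (a u v)) + ∑
        (λ u → ∑ λ v → bit (a y v) * bit (a u v))) ≡⟨ cong
        (∑ (λ u → ∑ λ v → bit (outside B a u v ∧ free a x y u v)) +_)
        (cong₂ _+_ (nb x) (trans (∑-swap (λ u v → bit (a y v) * bit (a u v)))
        (trans (∑-cong λ v → ∑-cong λ u → cong (λ b → bit (a y v) * bit b) (symm u v)) (nb y)))) ⟩
    ∑ (λ u → ∑ λ v → bit (outside B a u v ∧ free a x y u v)) + (d * d + d * d) ∎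
    where
    open ℕ.≤-Reasoning
    open RegularM r
    nb : ∀ x → ∑ (λ u → ∑ λ v → bit (a x u) * bit (a u v)) ≡ d * d
    nb x = trans (∑-cong λ u → trans (∑-*ˡ (bit (a x u)) (bit ∘ a u)) (cong (bit (a x u) *_) (reg u)))
        (trans (∑-*ʳ (bit ∘ a x) d) (cong (_* d) (reg x)))
    bits : ∀ e o p q → bit (e ∧ o) ≤ bit ((e ∧ o) ∧ (not p ∧ not q)) + (bit p * bit e + bit q * bit e)
    bits false o p q = z≤n
    bits true false p q = z≤n
    bits true true false false = s≤s z≤n
    bits true true false true = s≤s z≤n
    bits true true true q = s≤s z≤n

module SwitchCount {n d : ℕ} (B : Fin n → Bool) where
  R = regularGraphs n d

  Pc : ℕ → Digraph n → Bool
  Pc c G = ⌊ cutM (toM G) B ℕ.≟ c ⌋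

  N : ℕ → ℕ
  N c = count (Pc c) R

  valid : Matrix n → (x y u v : Fin n) → Bool
  valid a x y u v = inside B a x y ∧ (outside B a u v ∧ free a x y u v)

  valid′ : Matrix n → (x y u v : Fin n) → Bool
  valid′ a x y u v = across B a x u ∧ across B a y v

  ∑⁴ : (Fin n → Fin n → Fin n → Fin n → ℕ) → ℕ
  ∑⁴ f = ∑ λ x → ∑ λ y → ∑ λ u → ∑ λ v → f x y u v

  ∑⁴-mono : ∀ {f g} → (∀ x y u v → f x y u v ≤ g x y u v) → ∑⁴ f ≤ ∑⁴ g
  ∑⁴-mono le = ∑-mono λ x → ∑-mono λ y → ∑-mono λ u → ∑-mono λ v → le x y u v

  sumL-∑⁴ : ∀ {A : Set} (f : A → Fin n → Fin n → Fin n → Fin n → ℕ) xs →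
      sumL (λ G → ∑⁴ (f G)) xs ≡ ∑⁴ (λ x y u v → sumL (λ G → f G x y u v) xs)
  sumL-∑⁴ f xs = trans (sumL-∑ (λ G x → ∑ λ y → ∑ λ u → ∑ λ v → f G x y u v) xs) (∑-cong λ x →
    trans (sumL-∑ (λ G y → ∑ λ u → ∑ λ v → f G x y u v) xs) (∑-cong λ y →
    trans (sumL-∑ (λ G u → ∑ λ v → f G x y u v) xs) (∑-cong λ u → sumL-∑ (λ G v → f G x y u v) xs)))

  switch-count : ∀ c x y u v → count (λ G → Pc c G ∧ valid (toM G) x y u v) R ≤ count (λ G →
      Pc (2 + c) G ∧ valid′ (toM G) x y u v) R
  switch-count c x y u v = count-injection {f = switchG x y u v} (regularGraphs-unique n d)
      (switchG-injective x y u v) maps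
    where
    maps : ∀ G → G ∈ᴸ R → Pc c G ∧ valid (toM G) x y u v ≡ true → switchG x y u v G ∈ᴸ R ×
        Pc (2 + c) (switchG x y u v G) ∧ valid′ (toM (switchG x y u v G)) x y u v ≡ true
    maps G G∈ ok with ∧-true ok
    ... | cut≡c , ok₁ with ∧-true ok₁
    ... | in′ , ok₂ with ∧-true in′ | ∧-true ok₂
    ... | axy , bxy | out′ , fr with ∧-true bxy | ∧-true out′ | ∧-true fr
    ... | Bx , By | auv , buv | nxu , nyv with ∧-true buv
    ... | Bu , Bv = ∈-regularGraphs⁺ {G = switchG x y u v G} (fromM-regular switch-regular) , cong₂ _∧_
            (true-⌊⌋ (cutM (toM H) B ℕ.≟ 2 + c) (trans
                (∑-cong λ i → ∑-cong λ j → cong (λ b → bit (b ∧ (B i ∧ not (B j)))) (toM-fromM a₄ i j))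
                (trans switch-cut (cong (2 +_) (⌊⌋-true (cutM (toM G) B ℕ.≟ c) cut≡c)))))
            (cong₂ _∧_ (cong₂ _∧_ (trans (toM-fromM a₄ x u) switch-xu) (cong₂ (λ p q → p ∧ not q) Bx (not-true Bu)))
                (cong₂ _∧_ (trans (toM-fromM a₄ y v) switch-yv) (cong₂ (λ p q → p ∧ not q) By (not-true Bv))))
      where
      H = switchG x y u v G
      open Switch (toM-regular (∈-regularGraphs⁻ {G = G} G∈)) B axy Bx By auv (not-true Bu) (not-true Bv)
          (not-true nxu) (not-true nyv)

  -- Each of the at least I ordered pairs inside B combines with all outer pairs except the at most
  -- 2d² that `outside-free` excludes.
  valid-many : ∀ {a c I O} → RegularM d a → cutM a B ≡ c → I + c ≤ d * ∑ (bit ∘ B) →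
      O + c + (d * d + d * d) ≤ d * ∑ (bit ∘ not ∘ B) →
               I * O ≤ ∑⁴ (λ x y u v → bit (valid a x y u v))
  valid-many {a} {c} {I} {O} r cut≡ I≤ O≤ = begin
    I * O ≤⟨ ℕ.*-monoˡ-≤ O I≤int ⟩
    internal B a * O ≡⟨ sym (trans (∑-cong λ x → ∑-*ʳ (λ y → bit (inside B a x y)) O)
        (∑-*ʳ (λ x → ∑ λ y → bit (inside B a x y)) O)) ⟩
    ∑ (λ x → ∑ λ y → bit (inside B a x y) * O) ≤⟨ ∑-mono
        (λ x → ∑-mono λ y → ℕ.*-monoʳ-≤ (bit (inside B a x y)) (O≤free x y)) ⟩
    ∑ (λ x → ∑ λ y → bit (inside B a x y) * ∑ (λ u → ∑ λ v → bit (outside B a u v ∧ free a x y u v))) ≡⟨ ∑-cong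
        (λ x → ∑-cong λ y → sym (expand x y)) ⟩
    ∑⁴ (λ x y u v → bit (valid a x y u v)) ∎
    where
    open ℕ.≤-Reasoning
    open RegularM r
    I≤int : I ≤ internal B a
    I≤int = ℕ.+-cancelʳ-≤ c I _ (ℕ.≤-trans I≤ (ℕ.≤-reflexive
        (trans (internal-eq r B) (trans (ℕ.+-comm (cutM a B) _) (cong (internal B a +_) cut≡)))))
    O≤free : ∀ x y → O ≤ ∑ (λ u → ∑ λ v → bit (outside B a u v ∧ free a x y u v))
    O≤free x y = ℕ.+-cancelʳ-≤ (c + (d * d + d * d)) O _
        (ℕ.≤-trans (ℕ.≤-reflexive (sym (ℕ.+-assoc O c _))) (ℕ.≤-trans O≤ (begin
      d * ∑ (bit ∘ not ∘ B) ≡⟨ trans (internal-eq r (not ∘ B))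
          (cong (_+ internal (not ∘ B) a) (trans (cutM-not a symm B) cut≡)) ⟩
      c + internal (not ∘ B) a ≤⟨ ℕ.+-monoʳ-≤ c (outside-free r B x y) ⟩
      c + (S + (d * d + d * d)) ≡⟨ lem c S (d * d + d * d) ⟩
      S + (c + (d * d + d * d)) ∎)))
      where
      S = ∑ (λ u → ∑ λ v → bit (outside B a u v ∧ free a x y u v))
      lem : ∀ a b c → a + (b + c) ≡ b + (a + c)
      lem = ℕ-Solver.solve-∀
    expand : ∀ x y → ∑ (λ u → ∑ λ v → bit (valid a x y u v)) ≡ bit (inside B a x y) * ∑ (λ u → ∑ λ v →
        bit (outside B a u v ∧ free a x y u v))
    expand x y = trans (∑-cong λ u → trans (∑-cong λ v → bit-∧ (inside B a x y) (outside B a u v ∧ free a x y u v))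
        (∑-*ˡ (bit (inside B a x y)) (λ v → bit (outside B a u v ∧ free a x y u v))))
        (∑-*ˡ (bit (inside B a x y)) (λ u → ∑ λ v → bit (outside B a u v ∧ free a x y u v)))

  valid′-few : ∀ a → ∑⁴ (λ x y u v → bit (valid′ a x y u v)) ≡ cutM a B * cutM a B
  valid′-few a = begin
    ∑⁴ (λ x y u v → bit (valid′ a x y u v)) ≡⟨ ∑-cong
        (λ x → ∑-cong λ y → trans (∑-cong λ u → trans (∑-cong λ v → bit-∧ (across B a x u) (across B a y v))
        (∑-*ˡ (bit (across B a x u)) (λ v → bit (across B a y v)))) (∑-*ʳ (λ u → bit (across B a x u)) (P y))) ⟩
    ∑ (λ x → ∑ λ y → P x * P y) ≡⟨ trans (∑-cong λ x → ∑-*ˡ (P x) P) (∑-*ʳ P (∑ P)) ⟩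
    cutM a B * cutM a B ∎
    where
    open ≡-Reasoning
    P : Fin n → ℕ
    P x = ∑ λ u → bit (across B a x u)

  -- Double counting of graphs with quadruples: for each fixed quadruple switching is injective, a
  -- graph with cut c has at least I O valid quadruples, and a graph with cut c + 2 has (c + 2)²
  -- quadruples made of two crossing edges.
  switching : ∀ c I O → I + c ≤ d * ∑ (bit ∘ B) → O + c + (d * d + d * d) ≤ d * ∑ (bit ∘ not ∘ B) →
              N c * (I * O) ≤ N (2 + c) * ((2 + c) * (2 + c))
  switching c I O I≤ O≤ = begin
    N c * (I * O) ≡⟨ sym (sumL-*ʳ (bit ∘ Pc c) (I * O) R) ⟩
    sumL (λ G → bit (Pc c G) * (I * O)) R ≤⟨ sumL-mono R lower ⟩
    sumL (λ G → ∑⁴ λ x y u v → bit (Pc c G ∧ valid (toM G) x y u v)) R ≡⟨ sumL-∑⁴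
        (λ G x y u v → bit (Pc c G ∧ valid (toM G) x y u v)) R ⟩
    ∑⁴ (λ x y u v → count (λ G → Pc c G ∧ valid (toM G) x y u v) R) ≤⟨ ∑⁴-mono (switch-count c) ⟩
    ∑⁴ (λ x y u v → count (λ G → Pc (2 + c) G ∧ valid′ (toM G) x y u v) R) ≡⟨ sym
        (sumL-∑⁴ (λ G x y u v → bit (Pc (2 + c) G ∧ valid′ (toM G) x y u v)) R) ⟩
    sumL (λ G → ∑⁴ λ x y u v → bit (Pc (2 + c) G ∧ valid′ (toM G) x y u v)) R ≤⟨ sumL-mono R upper ⟩
    sumL (λ G → bit (Pc (2 + c) G) * ((2 + c) * (2 + c))) R ≡⟨ sumL-*ʳ (bit ∘ Pc (2 + c)) _ R ⟩
    N (2 + c) * ((2 + c) * (2 + c)) ∎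
    where
    open ℕ.≤-Reasoning
    pull : ∀ b (f : Fin n → Fin n → Fin n → Fin n → Bool) →
        ∑⁴ (λ x y u v → bit (b ∧ f x y u v)) ≡ bit b * ∑⁴ (λ x y u v → bit (f x y u v))
    pull b f = trans (∑-cong λ x → trans (∑-cong λ y → trans
        (∑-cong λ u → trans (∑-cong λ v → bit-∧ b (f x y u v)) (∑-*ˡ (bit b) (λ v → bit (f x y u v))))
        (∑-*ˡ (bit b) (λ u → ∑ λ v → bit (f x y u v)))) (∑-*ˡ (bit b) (λ y → ∑ λ u → ∑ λ v → bit (f x y u v))))
        (∑-*ˡ (bit b) (λ x → ∑ λ y → ∑ λ u → ∑ λ v → bit (f x y u v)))
    lower : ∀ G → G ∈ᴸ R → bit (Pc c G) * (I * O) ≤ ∑⁴ (λ x y u v → bit (Pc c G ∧ valid (toM G) x y u v))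
    lower G G∈ = ℕ.≤-trans (go (cutM (toM G) B ℕ.≟ c)) (ℕ.≤-reflexive (sym (pull (Pc c G) (valid (toM G)))))
      where
      go : (D : Dec (cutM (toM G) B ≡ c)) → bit ⌊ D ⌋ * (I * O) ≤ bit ⌊ D ⌋ * ∑⁴ (λ x y u v →
          bit (valid (toM G) x y u v))
      go (yes eq) = ℕ.*-monoʳ-≤ 1 (valid-many (toM-regular (∈-regularGraphs⁻ {G = G} G∈)) eq I≤ O≤)
      go (no _)   = z≤n
    upper : ∀ G → G ∈ᴸ R → ∑⁴ (λ x y u v → bit (Pc (2 + c) G ∧ valid′ (toM G) x y u v)) ≤ bit (Pc (2 + c) G)
        * ((2 + c) * (2 + c))
    upper G G∈ = ℕ.≤-trans (ℕ.≤-reflexive (pull (Pc (2 + c) G) (valid′ (toM G)))) (go (cutM (toM G) B ℕ.≟ 2 + c))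
      where
      go : (D : Dec (cutM (toM G) B ≡ 2 + c)) → bit ⌊ D ⌋ * ∑⁴ (λ x y u v →
          bit (valid′ (toM G) x y u v)) ≤ bit ⌊ D ⌋ * ((2 + c) * (2 + c))
      go (yes eq) = ℕ.*-monoʳ-≤ 1 (ℕ.≤-reflexive (trans (valid′-few (toM G)) (cong₂ _*_ eq eq)))
      go (no _)   = z≤n

-- The union bound

-- The cut size after J switchings, recursive so that one more switching adds 2 by definition.
idx : ℕ → ℕ → ℕ
idx c zero    = c
idx c (suc J) = 2 + idx c J

idx-eq : ∀ c J → idx c J ≡ 2 * J + c
idx-eq c zero    = refl
idx-eq c (suc J) = trans (cong (2 +_) (idx-eq c J)) (lem J c)
  where
  lem : ∀ J c → 2 + (2 * J + c) ≡ 2 * suc J + c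
  lem = ℕ-Solver.solve-∀

module Chain {n d : ℕ} (B : Fin n → Bool) where
  open SwitchCount {n} {d} B public

  s m : ℕ
  s = ∑ (bit ∘ B)
  m = ∑ (bit ∘ not ∘ B)

  -- Since 2 (Λ - J) + (c + 2J) does not depend on J, the two hypotheses serve for every switching.
  -- Replacing the cost (2J + 2 + c)² by 4 (J + 1 + c)² and dividing by 4 (J + 1)² makes all factors
  -- quotients of consecutive binomial coefficients.
  chain : ∀ Λ P c → 2 * Λ + c ≤ d * s → 2 * P + c + (d * d + d * d) ≤ d * m →
          ∀ J → N c * (binom Λ J * binom P J) ≤ N (idx c J) * (binom (J + c) J * binom (J + c) J)
  chain Λ P c hΛ hP zero    = ℕ.≤-refl
  chain Λ P c hΛ hP (suc J) with J <? Λ | J <? P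
  -- Past Λ or P the left side vanishes; otherwise `Λ ∸ J` and `P ∸ J` are true differences.
  ... | no J≥Λ | _ = ℕ.≤-trans (ℕ.≤-reflexive (trans
      (cong (λ x → N c * (x * binom P (suc J))) (binom-> Λ (suc J) (s≤s (ℕ.≮⇒≥ J≥Λ)))) (ℕ.*-zeroʳ (N c)))) z≤n
  ... | yes _ | no J≥P = ℕ.≤-trans (ℕ.≤-reflexive
      (trans (cong (λ x → N c * (binom Λ (suc J) * x)) (binom-> P (suc J) (s≤s (ℕ.≮⇒≥ J≥P))))
      (trans (cong (N c *_) (ℕ.*-zeroʳ (binom Λ (suc J)))) (ℕ.*-zeroʳ (N c))))) z≤n
  ... | yes J<Λ | yes J<P = ℕ.*-cancelʳ-≤ _ _ (4 * (suc J * suc J)) (begin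
    X * (b⁺ * b′⁺) * (4 * (suc J * suc J))      ≡⟨ lem₁ X b⁺ b′⁺ (suc J) ⟩
    X * ((b⁺ * suc J) * (b′⁺ * suc J)) * 4      ≡⟨ cong₂ (λ x y → X * (x * y) * 4) (binom-step Λ J) (binom-step P J) ⟩
    X * ((b * (Λ ∸ J)) * (b′ * (P ∸ J))) * 4    ≡⟨ lem₂ X b b′ (Λ ∸ J) (P ∸ J) ⟩
    X * (b * b′) * (I * O)                      ≤⟨ ℕ.*-monoˡ-≤ (I * O) (chain Λ P c hΛ hP J) ⟩
    Y * (k * k) * (I * O)                       ≡⟨ lem₃ Y (k * k) (I * O) ⟩
    Y * (I * O) * (k * k)                       ≤⟨ ℕ.*-monoˡ-≤ (k * k) (switching cJ I O hI hO) ⟩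
    Y⁺ * ((2 + cJ) * (2 + cJ)) * (k * k)        ≤⟨ ℕ.*-monoˡ-≤ (k * k) (ℕ.*-monoʳ-≤ Y⁺ (ℕ.*-mono-≤ c≤ c≤)) ⟩
    Y⁺ * ((2 * (suc J + c)) * (2 * (suc J + c))) * (k * k) ≡⟨ lem₄ Y⁺ (suc J + c) k ⟩
    Y⁺ * (((suc J + c) * k) * ((suc J + c) * k)) * 4 ≡⟨ cong (λ x → Y⁺ * (x * x) * 4) (sym (binom-absorb (J + c) J)) ⟩
    Y⁺ * ((k⁺ * suc J) * (k⁺ * suc J)) * 4      ≡⟨ sym (lem₁ Y⁺ k⁺ k⁺ (suc J)) ⟩
    Y⁺ * (k⁺ * k⁺) * (4 * (suc J * suc J))      ∎)
    where
    open ℕ.≤-Reasoning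
    X = N c
    b = binom Λ J
    b′ = binom P J
    b⁺ = binom Λ (suc J)
    b′⁺ = binom P (suc J)
    k = binom (J + c) J
    k⁺ = binom (suc J + c) (suc J)
    cJ = idx c J
    Y = N cJ
    Y⁺ = N (2 + cJ)
    I = 2 * (Λ ∸ J)
    O = 2 * (P ∸ J)
    lem₁ : ∀ x a b j → x * (a * b) * (4 * (j * j)) ≡ x * ((a * j) * (b * j)) * 4
    lem₁ = ℕ-Solver.solve-∀
    lem₂ : ∀ x a b i o → x * ((a * i) * (b * o)) * 4 ≡ x * (a * b) * ((2 * i) * (2 * o))
    lem₂ = ℕ-Solver.solve-∀
    lem₃ : ∀ a b c → a * b * c ≡ a * c * b
    lem₃ = ℕ-Solver.solve-∀
    lem₄ : ∀ y a k → y * ((2 * a) * (2 * a)) * (k * k) ≡ y * ((a * k) * (a * k)) * 4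
    lem₄ = ℕ-Solver.solve-∀
    shift : ∀ Λ → J < Λ → 2 * (Λ ∸ J) + cJ ≡ 2 * Λ + c
    shift Λ J<Λ = trans (cong (2 * (Λ ∸ J) +_) (idx-eq c J))
        (trans (lem (Λ ∸ J) J c) (cong (λ x → 2 * x + c) (ℕ.m∸n+n≡m (ℕ.<⇒≤ J<Λ))))
      where
      lem : ∀ a j c → 2 * a + (2 * j + c) ≡ 2 * (a + j) + c
      lem = ℕ-Solver.solve-∀
    hI : I + cJ ≤ d * s
    hI = ℕ.≤-trans (ℕ.≤-reflexive (shift Λ J<Λ)) hΛ
    hO : O + cJ + (d * d + d * d) ≤ d * m
    hO = ℕ.≤-trans (ℕ.≤-reflexive (cong (_+ (d * d + d * d)) (shift P J<P))) hP
    c≤ : 2 + cJ ≤ 2 * (suc J + c)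
    c≤ = ℕ.≤-trans (ℕ.≤-reflexive (cong (2 +_) (idx-eq c J))) (ℕ.≤-trans (ℕ.m≤m+n _ c) (ℕ.≤-reflexive (lem J c)))
      where
      lem : ∀ j c → 2 + (2 * j + c) + c ≡ 2 * (suc j + c)
      lem = ℕ-Solver.solve-∀

  -- The i-th term of Vandermonde's sum for binom n s is bounded by `chain` with J = i + t, Λ = s +
  -- t and P = m + p: `binom-superadd` absorbs 1 = binom t t on one side and binom p t on the other.
  per-set : ∀ t p c → 2 * (s + t) + c ≤ d * s → 2 * (m + p) + c + (d * d + d * d) ≤ d * m →
            N c * (binom n s * binom p t) ≤ length R * (suc s * (suc (s + t) ^ c * suc (s + t) ^ c))
  per-set t p c h₁ h₂ = begin
    N c * (binom n s * binom p t) ≡⟨ cong (λ x → N c * (x * binom p t)) (sym vdm) ⟩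
    N c * (sumTo (suc s) f * binom p t) ≡⟨ trans (lem (N c) (sumTo (suc s) f) (binom p t))
        (sym (sumTo-* (suc s) (N c * binom p t) f)) ⟩
    sumTo (suc s) (λ i → N c * binom p t * f i) ≤⟨ sumTo-mono (suc s) term ⟩
    sumTo (suc s) (λ _ → length R * (z ^ c * z ^ c)) ≡⟨ sumTo-const (suc s) _ ⟩
    suc s * (length R * (z ^ c * z ^ c)) ≡⟨ lem₂ (suc s) (length R) (z ^ c * z ^ c) ⟩
    length R * (suc s * (z ^ c * z ^ c)) ∎
    where
    open ℕ.≤-Reasoning
    z = suc (s + t)
    f : ℕ → ℕ
    f i = binom s i * binom m (i + 0)
    lem : ∀ a b c → a * (b * c) ≡ a * c * b
    lem = ℕ-Solver.solve-∀
    lem₂ : ∀ a b c → a * (b * c) ≡ b * (a * c)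
    lem₂ = ℕ-Solver.solve-∀
    vdm : sumTo (suc s) f ≡ binom n s
    vdm = trans (vandermonde s m 0) (cong₂ binom (∑-not B) (ℕ.+-identityʳ s))
    term : ∀ i → i < suc s → N c * binom p t * f i ≤ length R * (z ^ c * z ^ c)
    term i (s≤s i≤s) = begin
      N c * binom p t * (binom s i * binom m (i + 0)) ≡⟨ trans
          (cong (λ x → N c * binom p t * (binom s i * binom m x)) (ℕ.+-identityʳ i))
          (lem₃ (N c) (binom p t) (binom s i) (binom m i)) ⟩
      N c * (binom s i * 1 * (binom m i * binom p t)) ≤⟨ ℕ.*-monoʳ-≤ (N c)
          (ℕ.*-mono-≤ (ℕ.≤-trans (ℕ.≤-reflexive (cong (binom s i *_) (sym (binom-nn t)))) (binom-superadd s t i t))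
          (binom-superadd m p i t)) ⟩
      N c * (binom (s + t) (i + t) * binom (m + p) (i + t)) ≤⟨ chain (s + t) (m + p) c h₁ h₂ (i + t) ⟩
      N (idx c (i + t)) * (binom (i + t + c) (i + t) * binom (i + t + c) (i + t)) ≤⟨ ℕ.*-mono-≤
          (count≤length (Pc (idx c (i + t))) R) (ℕ.*-mono-≤ up up) ⟩
      length R * (z ^ c * z ^ c) ∎
      where
      lem₃ : ∀ a b c d → a * b * (c * d) ≡ a * (c * 1 * (d * b))
      lem₃ = ℕ-Solver.solve-∀
      up : binom (i + t + c) (i + t) ≤ z ^ c
      up = ℕ.≤-trans (binom-upper c (i + t)) (ℕ.^-monoˡ-≤ c (s≤s (ℕ.+-monoˡ-≤ t i≤s)))

sumS : ∀ {n} → (Subset n → ℕ) → ℕ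
sumS {zero}  f = f []
sumS {suc n} f = sumS (f ∘ (true ∷_)) + sumS (f ∘ (false ∷_))

sumS-mono : ∀ {n} {f g : Subset n → ℕ} → (∀ A → f A ≤ g A) → sumS f ≤ sumS g
sumS-mono {zero}  le = le []
sumS-mono {suc n} le = ℕ.+-mono-≤ (sumS-mono (le ∘ (true ∷_))) (sumS-mono (le ∘ (false ∷_)))

sumS-member : ∀ {n} (f : Subset n → ℕ) A → f A ≤ sumS f
sumS-member f []          = ℕ.≤-refl
sumS-member f (true ∷ A)  = ℕ.≤-trans (sumS-member (f ∘ (true ∷_)) A) (ℕ.m≤m+n _ _)
sumS-member f (false ∷ A) = ℕ.≤-trans (sumS-member (f ∘ (false ∷_)) A) (ℕ.m≤n+m _ _)

sumS-*ʳ : ∀ {n} (f : Subset n → ℕ) c → sumS (λ A → f A * c) ≡ sumS f * c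
sumS-*ʳ {zero}  f c = refl
sumS-*ʳ {suc n} f c = trans (cong₂ _+_ (sumS-*ʳ (f ∘ (true ∷_)) c) (sumS-*ʳ (f ∘ (false ∷_)) c))
    (sym (ℕ.*-distribʳ-+ c (sumS (f ∘ (true ∷_))) _))

sumS-cong : ∀ {n} {f g : Subset n → ℕ} → (∀ A → f A ≡ g A) → sumS f ≡ sumS g
sumS-cong eq = ℕ.≤-antisym (sumS-mono λ A → ℕ.≤-reflexive (eq A)) (sumS-mono λ A → ℕ.≤-reflexive (sym (eq A)))

sumS-sumL : ∀ {X : Set} {n} (f : X → Subset n → ℕ) xs →
    sumL (λ x → sumS (f x)) xs ≡ sumS (λ A → sumL (λ x → f x A) xs)
sumS-sumL {n = zero}  f xs = refl
sumS-sumL {n = suc n} f xs = trans (sumL-+ (λ x → sumS (f x ∘ (true ∷_))) _ xs)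
    (cong₂ _+_ (sumS-sumL (λ x → f x ∘ (true ∷_)) xs) (sumS-sumL (λ x → f x ∘ (false ∷_)) xs))

sumTo-sumL : ∀ {X : Set} k (f : X → ℕ → ℕ) xs → sumL (λ x → sumTo k (f x)) xs ≡ sumTo k (λ i → sumL (λ x → f x i) xs)
sumTo-sumL zero    f xs = sumL-zero xs
sumTo-sumL (suc k) f xs = trans (sumL-+ (λ x → f x 0) _ xs)
    (cong (sumL (λ x → f x 0) xs +_) (sumTo-sumL k (λ x → f x ∘ suc) xs))

sized : ∀ {n} → ℕ → Subset n → Bool
sized s A = ⌊ ∑ (bit ∘ lookup A) ℕ.≟ s ⌋

sumS-sized : ∀ n s → sumS {n} (λ A → bit (sized s A)) ≡ binom n s
sumS-sized zero    zero    = refl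
sumS-sized zero    (suc s) = refl
sumS-sized (suc n) zero    = cong₂ _+_ (none n) (sumS-sized n zero)
  where
  none : ∀ n → sumS {n} (λ _ → 0) ≡ 0
  none zero    = refl
  none (suc n) = cong₂ _+_ (none n) (none n)
sumS-sized (suc n) (suc s) = cong₂ _+_ (trans (sumS-cong {n} λ A → cong bit (suc-≟ (∑ (bit ∘ lookup A)) s))
    (sumS-sized n s)) (sumS-sized n (suc s))
  where
  suc-≟ : ∀ a b → ⌊ suc a ℕ.≟ suc b ⌋ ≡ ⌊ a ℕ.≟ b ⌋
  suc-≟ a b with a ℕ.≟ b
  ... | yes refl = true-⌊⌋ (suc a ℕ.≟ suc a) refl
  ... | no ne = ¬true⇒false λ eq → ne (ℕ.suc-injective (⌊⌋-true (suc a ℕ.≟ suc b) eq))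

-- `W` bounds (s + 1) (s + t + 1)^(2c) for c ≤ 2d. `t₀` exceeds its exponent by 2, which leaves a
-- factor μ² for large sets. From size `s₁` on there is room for t₀ additional switchings, and `κ`
-- is such that n + t₀ < κ μ for μ = n / (8 t₀).
module Constants (d : ℕ) where
  W : ℕ → ℕ → ℕ
  W s t = suc (s + t) ^ suc (4 * d)

  t₀ s₁ κ C₁ C₂ C : ℕ
  t₀ = 2 + suc (4 * d)
  s₁ = 2 * t₀ + 2 * d
  κ  = 18 * t₀
  C₁ = 2 * d * W s₁ 1
  C₂ = 2 * d * κ ^ suc (4 * d)
  C  = s₁ * C₁ + κ * C₂

module UnionBound (n d : ℕ) where
  open Constants d

  R = regularGraphs n d
  r = length R

  -- Equal to K when d = 2k + 1 and larger than K for larger d.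
  γ : ℕ
  γ = 2 * d ∸ 4

  bads : ℕ → Digraph n → ℕ
  bads s G = sumS λ A → sumTo γ λ c → bit (sized s A) * bit ⌊ cutM (toM G) (lookup A) ℕ.≟ c ⌋

  T : ℕ → ℕ
  T s = sumL (bads s) R

  T-eq : ∀ s → T s ≡ sumS λ A → bit (sized s A) * sumTo γ λ c → SwitchCount.N {n} {d} (lookup A) c
  T-eq s = trans (sumS-sumL (λ G A → sumTo γ λ c → bit (sized s A) * bit ⌊ cutM (toM G) (lookup A) ℕ.≟ c ⌋) R)
      (sumS-cong {n} λ A →
    trans (sumTo-sumL γ (λ G c → bit (sized s A) * bit ⌊ cutM (toM G) (lookup A) ℕ.≟ c ⌋) R)
    (trans (sumTo-cong γ λ c → sumL-*ˡ (bit (sized s A)) (λ G → bit ⌊ cutM (toM G) (lookup A) ℕ.≟ c ⌋) R)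
           (sumTo-* γ (bit (sized s A)) (λ c → SwitchCount.N {n} {d} (lookup A) c))))

  -- `per-set` is summed over the binom n s sets of size s and at most 2d cut sizes, and binom n s
  -- cancels. The `suc` in the first hypothesis exploits c < γ.
  T-bound : ∀ s m t p → s + m ≡ n → 2 * (s + t) + γ ≤ suc (d * s) → 2 * (m + p) + γ + (d * d + d * d) ≤ d * m →
            T s * binom p t ≤ r * (2 * d * W s t)
  T-bound s m t p s+m h₁ h₂ = ℕ.*-cancelˡ-≤ (binom n s) {{>-nonZero (binom>0 n s (subst (s ≤_) s+m (ℕ.m≤m+n s m)))}}
      (begin
    binom n s * (T s * binom p t)                     ≡⟨ lem (binom n s) (T s) (binom p t) ⟩
    T s * (binom n s * binom p t)                     ≡⟨ cong (_* b) (T-eq s) ⟩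
    sumS (λ A → bit (sized s A) * sumTo γ (λ c → N A c)) * b ≡⟨ sym
        (sumS-*ʳ {n} (λ A → bit (sized s A) * sumTo γ (λ c → N A c)) b) ⟩
    sumS (λ A → bit (sized s A) * sumTo γ (λ c → N A c) * b) ≤⟨ sumS-mono {n} each ⟩
    sumS {n} (λ A → bit (sized s A) * (r * (2 * d * W s t))) ≡⟨ sumS-*ʳ {n} (λ A → bit (sized s A)) _ ⟩
    sumS {n} (λ A → bit (sized s A)) * (r * (2 * d * W s t)) ≡⟨ cong (_* (r * (2 * d * W s t))) (sumS-sized n s) ⟩
    binom n s * (r * (2 * d * W s t)) ∎)
    where
    open ℕ.≤-Reasoning
    N : Subset n → ℕ → ℕ
    N A = SwitchCount.N {n} {d} (lookup A)
    b = binom n s * binom p t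
    lem : ∀ a b c → a * (b * c) ≡ b * (a * c)
    lem = ℕ-Solver.solve-∀
    each : ∀ A → bit (sized s A) * sumTo γ (λ c → N A c) * b ≤ bit (sized s A) * (r * (2 * d * W s t))
    each A = go (∑ (bit ∘ lookup A) ℕ.≟ s)
      where
      go : (D : Dec (∑ (bit ∘ lookup A) ≡ s)) → bit ⌊ D ⌋ * sumTo γ (λ c →
          N A c) * b ≤ bit ⌊ D ⌋ * (r * (2 * d * W s t))
      go (no _) = z≤n
      go (yes refl) = ℕ.≤-trans (ℕ.≤-reflexive (trans (cong (_* b) (ℕ.+-identityʳ (sumTo γ (N A))))
          (trans (ℕ.*-comm (sumTo γ (N A)) b) (sym (sumTo-* γ b (N A))))))
          (ℕ.≤-trans (sumTo-mono γ perc) (ℕ.≤-trans (ℕ.≤-reflexive (sumTo-const γ (r * W s t)))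
          (ℕ.≤-trans (ℕ.*-monoˡ-≤ (r * W s t) (ℕ.m∸n≤m (2 * d) 4))
          (ℕ.≤-reflexive (trans (lem (2 * d) r (W s t)) (sym (ℕ.+-identityʳ _)))))))
        where
        m≡ : ∑ (bit ∘ not ∘ lookup A) ≡ m
        m≡ = ℕ.+-cancelˡ-≡ s _ _ (trans (∑-not (lookup A)) (sym s+m))
        z = suc (s + t)
        perc : ∀ c → c < γ → b * N A c ≤ r * W s t
        perc c c<γ = ℕ.≤-trans (ℕ.≤-reflexive (ℕ.*-comm b (N A c))) (ℕ.≤-trans
          (Chain.per-set (lookup A) t p c (ℕ.≤-pred (ℕ.≤-trans (ℕ.+-monoʳ-< (2 * (s + t)) c<γ) h₁))
            (subst (λ m → 2 * (m + p) + c + (d * d + d * d) ≤ d * m) (sym m≡)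
                (ℕ.≤-trans (ℕ.+-monoˡ-≤ (d * d + d * d) (ℕ.+-monoʳ-≤ (2 * (m + p)) (ℕ.<⇒≤ c<γ))) h₂)))
          (ℕ.*-monoʳ-≤ r (begin
            suc s * (z ^ c * z ^ c)       ≤⟨ ℕ.*-mono-≤ (s≤s (ℕ.m≤m+n s t)) (ℕ.*-mono-≤ c≤ c≤) ⟩
            z * (z ^ (2 * d) * z ^ (2 * d)) ≡⟨ cong (z *_)
                (trans (sym (ℕ.^-distribˡ-+-* z (2 * d) (2 * d))) (cong (z ^_) (lem₄ d))) ⟩
            W s t ∎)))
          where
          c≤ : z ^ c ≤ z ^ (2 * d)
          c≤ = ℕ.^-monoʳ-≤ z (ℕ.≤-trans (ℕ.<⇒≤ c<γ) (ℕ.m∸n≤m (2 * d) 4))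
          lem₄ : ∀ d → 2 * d + 2 * d ≡ 4 * d
          lem₄ = ℕ-Solver.solve-∀

  -- Sizes start at 3 because `cutM-≥` gives every pair of vertices a cut of at least 2d - 2; sets
  -- larger than n / 2 are replaced by their complements.
  Bad : Digraph n → Set
  Bad G = ∃ λ A → 3 ≤ ∑ (bit ∘ lookup A) × 2 * ∑ (bit ∘ lookup A) ≤ n × cutM (toM G) (lookup A) < γ

  bad? : ∀ G → Dec (Bad G)
  bad? G = anySubset? λ A → (3 ≤? ∑ (bit ∘ lookup A)) ×-dec
      ((2 * ∑ (bit ∘ lookup A) ≤? n) ×-dec (cutM (toM G) (lookup A) <? γ))

  bad : Digraph n → Bool
  bad G = ⌊ bad? G ⌋

  relevant : ℕ → Bool
  relevant s = ⌊ (3 ≤? s) ×-dec (2 * s ≤? n) ⌋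

  sumTo-member : ∀ k f i → i < k → f i ≤ sumTo k f
  sumTo-member (suc k) f zero    _        = ℕ.m≤m+n _ _
  sumTo-member (suc k) f (suc i) (s≤s lt) = ℕ.≤-trans (sumTo-member k (f ∘ suc) i lt) (ℕ.m≤n+m _ (f 0))

  bad≤bads : ∀ G → bit (bad G) ≤ sumTo (suc n) λ s → bit (relevant s) * bads s G
  bad≤bads G with bad? G
  ... | no _ = z≤n
  ... | yes (A , 3≤ , 2s≤n , lt) = ℕ.≤-trans (ℕ.≤-trans (ℕ.≤-reflexive (sym one))
      (ℕ.≤-trans (sumTo-member γ (λ c → bit (sized s A) * bit ⌊ x ℕ.≟ c ⌋) x lt)
      (sumS-member (λ A → sumTo γ λ c → bit (sized s A) * bit ⌊ cutM (toM G) (lookup A) ℕ.≟ c ⌋) A)))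
        (ℕ.≤-trans (ℕ.≤-reflexive rel) (sumTo-member (suc n) (λ s → bit (relevant s) * bads s G) s
            (s≤s (ℕ.≤-trans (ℕ.m≤m+n s _) 2s≤n))))
    where
    s = ∑ (bit ∘ lookup A)
    x = cutM (toM G) (lookup A)
    one : bit (sized s A) * bit ⌊ x ℕ.≟ x ⌋ ≡ 1
    one = cong₂ (λ a b → bit a * bit b) (true-⌊⌋ (s ℕ.≟ s) refl) (true-⌊⌋ (x ℕ.≟ x) refl)
    rel : bads s G ≡ bit (relevant s) * bads s G
    rel = trans (sym (ℕ.+-identityʳ _)) (cong (λ b → bit b * bads s G)
        (sym (true-⌊⌋ ((3 ≤? s) ×-dec (2 * s ≤? n)) (3≤ , 2s≤n))))

  count-bad : count bad R ≤ sumTo (suc n) λ s → bit (relevant s) * T s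
  count-bad = ℕ.≤-trans (sumL-mono R (λ G _ → bad≤bads G))
      (ℕ.≤-reflexive (trans (sumTo-sumL (suc n) (λ G s → bit (relevant s) * bads s G) R)
      (sumTo-cong (suc n) λ s → sumL-*ˡ (bit (relevant s)) (bads s) R)))

  module _ (3≤d : 3 ≤ d) (μ : ℕ) (1≤μ : 1 ≤ μ) (μ≤ : 8 * t₀ * μ ≤ n) (n< : n < 8 * t₀ * suc μ)
      (n-large : 8 * d + 8 * (d * d) ≤ n) where
    γ≤2d : γ ≤ 2 * d
    γ≤2d = ℕ.m∸n≤m (2 * d) 4

    -- n ≤ 2m, and 2 t₀ μ as well as 2d + 2d² is at most n / 4, hence at most m / 2; together they
    -- use the third m that d ≥ 3 provides.
    h-out : ∀ s m → s + m ≡ n → 2 * s ≤ n → 2 * (m + t₀ * μ) + γ + (d * d + d * d) ≤ d * m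
    h-out s m s+m 2s≤n = begin
      2 * (m + t₀ * μ) + γ + (d * d + d * d) ≤⟨ ℕ.+-monoˡ-≤ (d * d + d * d) (ℕ.+-monoʳ-≤ (2 * (m + t₀ * μ)) γ≤2d) ⟩
      2 * (m + t₀ * μ) + 2 * d + (d * d + d * d) ≡⟨ lem m (t₀ * μ) d ⟩
      2 * m + (2 * (t₀ * μ) + (2 * d + 2 * (d * d))) ≤⟨ ℕ.+-monoʳ-≤ (2 * m) (ℕ.*-cancelˡ-≤ 4 (begin
        4 * (2 * (t₀ * μ) + (2 * d + 2 * (d * d))) ≡⟨ lem₂ t₀ μ d ⟩
        8 * t₀ * μ + (8 * d + 8 * (d * d)) ≤⟨ ℕ.+-mono-≤ μ≤ n-large ⟩
        n + n ≤⟨ ℕ.+-mono-≤ n≤2m n≤2m ⟩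
        2 * m + 2 * m ≡⟨ lem₃ m ⟩
        4 * m ∎)) ⟩
      2 * m + m ≡⟨ lem₄ m ⟩
      3 * m ≤⟨ ℕ.*-monoˡ-≤ m 3≤d ⟩
      d * m ∎
      where
      open ℕ.≤-Reasoning
      lem : ∀ m p d → 2 * (m + p) + 2 * d + (d * d + d * d) ≡ 2 * m + (2 * p + (2 * d + 2 * (d * d)))
      lem = ℕ-Solver.solve-∀
      lem₂ : ∀ t u d → 4 * (2 * (t * u) + (2 * d + 2 * (d * d))) ≡ 8 * t * u + (8 * d + 8 * (d * d))
      lem₂ = ℕ-Solver.solve-∀
      lem₃ : ∀ m → 2 * m + 2 * m ≡ 4 * m
      lem₃ = ℕ-Solver.solve-∀
      lem₄ : ∀ m → 2 * m + m ≡ 3 * m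
      lem₄ = ℕ-Solver.solve-∀
      n≤2m : n ≤ 2 * m
      n≤2m = ℕ.+-cancelˡ-≤ n n (2 * m) (subst (λ x → x + x ≤ x + 2 * m) s+m (begin
        (s + m) + (s + m) ≡⟨ lem₅ s m ⟩
        2 * s + 2 * m ≤⟨ ℕ.+-monoˡ-≤ (2 * m) (subst (2 * s ≤_) (sym s+m) 2s≤n) ⟩
        (s + m) + 2 * m ∎))
        where
        lem₅ : ∀ s m → (s + m) + (s + m) ≡ 2 * s + 2 * m
        lem₅ = ℕ-Solver.solve-∀

    -- Equality holds for d = s = 3, so one additional switching is all that the smallest sets
    -- allow.
    h-small : ∀ s → 3 ≤ s → 2 * (s + 1) + γ ≤ suc (d * s)
    h-small s 3≤s = subst (λ d → 2 * (s + 1) + (2 * d ∸ 4) ≤ suc (d * s)) (ℕ.m+[n∸m]≡n 3≤d)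
      (subst (λ s → 2 * (s + 1) + (2 * (3 + e) ∸ 4) ≤ suc ((3 + e) * s)) (ℕ.m+[n∸m]≡n 3≤s)
          (ℕ.≤-trans (ℕ.≤-reflexive (cong (2 * (3 + f + 1) +_)
          (trans (cong (_∸ 4) (lem₀ e)) (ℕ.m+n∸m≡n 4 (2 + 2 * e)))))
        (ℕ.≤-trans (ℕ.m≤m+n _ (e + f + e * f)) (ℕ.≤-reflexive (lem e f)))))
      where
      e = d ∸ 3
      f = s ∸ 3
      lem₀ : ∀ e → 2 * (3 + e) ≡ 4 + (2 + 2 * e)
      lem₀ = ℕ-Solver.solve-∀
      lem : ∀ e f → 2 * (3 + f + 1) + (2 + 2 * e) + (e + f + e * f) ≡ suc ((3 + e) * (3 + f))
      lem = ℕ-Solver.solve-∀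

    h-large : ∀ s → s₁ ≤ s → 2 * (s + t₀) + γ ≤ suc (d * s)
    h-large s s₁≤s = ℕ.m≤n⇒m≤1+n (begin
      2 * (s + t₀) + γ ≤⟨ ℕ.+-monoʳ-≤ (2 * (s + t₀)) γ≤2d ⟩
      2 * (s + t₀) + 2 * d ≡⟨ lem s t₀ d ⟩
      2 * s + (2 * t₀ + 2 * d) ≤⟨ ℕ.+-monoʳ-≤ (2 * s) s₁≤s ⟩
      2 * s + s ≡⟨ lem₂ s ⟩
      3 * s ≤⟨ ℕ.*-monoˡ-≤ s 3≤d ⟩
      d * s ∎)
      where
      open ℕ.≤-Reasoning
      lem : ∀ s t d → 2 * (s + t) + 2 * d ≡ 2 * s + (2 * t + 2 * d)
      lem = ℕ-Solver.solve-∀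
      lem₂ : ∀ s → 2 * s + s ≡ 3 * s
      lem₂ = ℕ-Solver.solve-∀

    n+t₀≤ : suc (n + t₀) ≤ κ * μ
    n+t₀≤ = begin
      suc n + t₀ ≤⟨ ℕ.+-mono-≤ n< (ℕ.m≤m*n t₀ μ {{>-nonZero 1≤μ}}) ⟩
      8 * t₀ * suc μ + t₀ * μ ≤⟨ ℕ.+-monoˡ-≤ (t₀ * μ) (ℕ.*-monoʳ-≤ (8 * t₀) (ℕ.+-monoˡ-≤ μ 1≤μ)) ⟩
      8 * t₀ * (μ + μ) + t₀ * μ ≤⟨ ℕ.m≤m+n _ (t₀ * μ) ⟩
      8 * t₀ * (μ + μ) + t₀ * μ + t₀ * μ ≡⟨ lem t₀ μ ⟩
      κ * μ ∎
      where
      open ℕ.≤-Reasoning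
      lem : ∀ t u → 8 * t * (u + u) + t * u + t * u ≡ 18 * t * u
      lem = ℕ-Solver.solve-∀

    small-term : ∀ s → 3 ≤ s → 2 * s ≤ n → s < s₁ → T s * μ ≤ r * C₁
    small-term s 3≤s 2s≤n s<s₁ = begin
      T s * μ ≤⟨ ℕ.*-monoʳ-≤ (T s) (ℕ.≤-trans (ℕ.m≤n*m μ t₀) (ℕ.≤-reflexive (sym (binom-1 (t₀ * μ))))) ⟩
      T s * binom (t₀ * μ) 1 ≤⟨ T-bound s (n ∸ s) 1 (t₀ * μ) s+m (h-small s 3≤s) (h-out s (n ∸ s) s+m 2s≤n) ⟩
      r * (2 * d * W s 1) ≤⟨ ℕ.*-monoʳ-≤ r (ℕ.*-monoʳ-≤ (2 * d)
          (ℕ.^-monoˡ-≤ (suc (4 * d)) (s≤s (ℕ.+-monoˡ-≤ 1 (ℕ.<⇒≤ s<s₁))))) ⟩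
      r * C₁ ∎
      where
      open ℕ.≤-Reasoning
      s+m = ℕ.m+[n∸m]≡n (ℕ.≤-trans (ℕ.m≤m+n s _) 2s≤n)

    large-term : ∀ s → 2 * s ≤ n → s₁ ≤ s → T s * (μ * μ) ≤ r * C₂
    large-term s 2s≤n s₁≤s = ℕ.*-cancelʳ-≤ _ _ (μ ^ D) {{ℕ.m^n≢0 μ D {{>-nonZero 1≤μ}}}} (begin
      T s * (μ * μ) * μ ^ D ≡⟨ lem (T s) μ (μ ^ D) ⟩
      T s * μ ^ t₀ ≤⟨ ℕ.*-monoʳ-≤ (T s) (binom-lower t₀ μ) ⟩
      T s * binom (t₀ * μ) t₀ ≤⟨ T-bound s (n ∸ s) t₀ (t₀ * μ) s+m (h-large s s₁≤s) (h-out s (n ∸ s) s+m 2s≤n) ⟩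
      r * (2 * d * W s t₀) ≤⟨ ℕ.*-monoʳ-≤ r (ℕ.*-monoʳ-≤ (2 * d)
          (ℕ.^-monoˡ-≤ D (ℕ.≤-trans (s≤s (ℕ.+-monoˡ-≤ t₀ s≤n)) n+t₀≤))) ⟩
      r * (2 * d * (κ * μ) ^ D) ≡⟨ cong (λ x → r * (2 * d * x)) (*-^ κ μ D) ⟩
      r * (2 * d * (κ ^ D * μ ^ D)) ≡⟨ lem₂ r (2 * d) (κ ^ D) (μ ^ D) ⟩
      r * C₂ * μ ^ D ∎)
      where
      open ℕ.≤-Reasoning
      D = suc (4 * d)
      s≤n = ℕ.≤-trans (ℕ.m≤m+n s _) 2s≤n
      s+m = ℕ.m+[n∸m]≡n s≤n
      lem : ∀ t u e → t * (u * u) * e ≡ t * (u * (u * e))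
      lem = ℕ-Solver.solve-∀
      lem₂ : ∀ a b c e → a * (b * (c * e)) ≡ a * (b * c) * e
      lem₂ = ℕ-Solver.solve-∀

    -- At most s₁ small sizes contribute r C₁ / μ each, and at most n + 1 ≤ κ μ large ones
    -- contribute r C₂ / μ² each.
    few-bad : count bad R * μ ≤ r * C
    few-bad = ℕ.*-cancelʳ-≤ _ _ μ {{>-nonZero 1≤μ}} (begin
      count bad R * μ * μ ≡⟨ ℕ.*-assoc (count bad R) μ μ ⟩
      count bad R * (μ * μ) ≤⟨ ℕ.*-monoˡ-≤ (μ * μ) count-bad ⟩
      sumTo (suc n) (λ s → bit (relevant s) * T s) * (μ * μ) ≡⟨ trans (ℕ.*-comm _ (μ * μ))
          (sym (sumTo-* (suc n) (μ * μ) (λ s → bit (relevant s) * T s))) ⟩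
      sumTo (suc n) (λ s → μ * μ * (bit (relevant s) * T s)) ≤⟨ sumTo-mono (suc n) (λ s _ → term s) ⟩
      sumTo (suc n) (λ s → r * C₁ * μ * bit ⌊ s <? s₁ ⌋ + r * C₂) ≡⟨ trans
          (sumTo-+ (suc n) (λ s → r * C₁ * μ * bit ⌊ s <? s₁ ⌋) (λ _ → r * C₂))
          (cong₂ _+_ (sumTo-* (suc n) (r * C₁ * μ) (λ s → bit ⌊ s <? s₁ ⌋)) (sumTo-const (suc n) (r * C₂))) ⟩
      r * C₁ * μ * sumTo (suc n) (λ s → bit ⌊ s <? s₁ ⌋) + suc n * (r * C₂) ≤⟨ ℕ.+-mono-≤
          (ℕ.*-monoʳ-≤ (r * C₁ * μ) (indicator (suc n) s₁))
          (ℕ.*-monoˡ-≤ (r * C₂) (ℕ.≤-trans (s≤s (ℕ.m≤m+n n t₀)) n+t₀≤)) ⟩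
      r * C₁ * μ * s₁ + κ * μ * (r * C₂) ≡⟨ lem r C₁ C₂ μ s₁ κ ⟩
      r * C * μ ∎)
      where
      open ℕ.≤-Reasoning
      lem : ∀ r a b m s k → r * a * m * s + k * m * (r * b) ≡ r * (s * a + k * b) * m
      lem = ℕ-Solver.solve-∀
      indicator : ∀ k s → sumTo k (λ i → bit ⌊ i <? s ⌋) ≤ s
      indicator zero    s       = z≤n
      indicator (suc k) zero    = ℕ.≤-trans (ℕ.≤-reflexive (zeros k)) z≤n
        where
        zeros : ∀ k → sumTo k (λ i → bit ⌊ suc i <? 0 ⌋) ≡ 0
        zeros zero    = refl
        zeros (suc k) = trans (sumTo-const k 0) (ℕ.*-zeroʳ k)
      indicator (suc k) (suc s) = s≤s (ℕ.≤-trans (sumTo-mono k λ i _ → step i) (indicator k s))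
        where
        step : ∀ i → bit ⌊ suc i <? suc s ⌋ ≤ bit ⌊ i <? s ⌋
        step i with i <? s
        ... | yes _ = bit≤1 _
        ... | no ¬lt = ℕ.≤-reflexive (cong bit (¬true⇒false λ eq → ¬lt (ℕ.≤-pred (⌊⌋-true (suc i <? suc s) eq))))
      term : ∀ s → μ * μ * (bit (relevant s) * T s) ≤ r * C₁ * μ * bit ⌊ s <? s₁ ⌋ + r * C₂
      term s with 3 ≤? s | 2 * s ≤? n
      ... | no _ | _ = ℕ.≤-trans (ℕ.≤-reflexive (ℕ.*-zeroʳ (μ * μ))) z≤n
      ... | yes _ | no _ = ℕ.≤-trans (ℕ.≤-reflexive (ℕ.*-zeroʳ (μ * μ))) z≤n
      ... | yes 3≤s | yes 2s≤n with s <? s₁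
      ... | yes s<s₁ = ℕ.≤-trans (ℕ.≤-trans (ℕ.≤-reflexive (lem₁ μ (T s)))
          (ℕ.≤-trans (ℕ.*-monoˡ-≤ μ (small-term s 3≤s 2s≤n s<s₁)) (ℕ.≤-reflexive (sym (ℕ.*-identityʳ _)))))
          (ℕ.m≤m+n _ _)
        where
        lem₁ : ∀ m t → m * m * (t + 0) ≡ t * m * m
        lem₁ = ℕ-Solver.solve-∀
      ... | no s≮s₁ = ℕ.≤-trans (ℕ.≤-trans (ℕ.≤-reflexive (lem₁ μ (T s))) (large-term s 2s≤n (ℕ.≮⇒≥ s≮s₁)))
          (ℕ.m≤n+m _ _)
        where
        lem₁ : ∀ m t → m * m * (t + 0) ≡ t * (m * m)
        lem₁ = ℕ-Solver.solve-∀

¬Bad⇒half : ∀ {n d} {G : Digraph n} → IsRegularGraph d G → ¬ UnionBound.Bad n d G →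
             ∀ B → 2 ≤ ∑ (bit ∘ B) → 2 * ∑ (bit ∘ B) ≤ n → 2 * d ∸ 4 ≤ cutM (toM G) B
¬Bad⇒half {n} {d} {G} rg ¬bad B 2≤s 2s≤n with ∑ (bit ∘ B) ℕ.≟ 2
... | yes s≡2 = ℕ.m≤n+o⇒m∸n≤o (2 * d) 4 (ℕ.≤-trans
    (ℕ.≤-trans (ℕ.≤-trans (ℕ.≤-reflexive (ℕ.*-comm 2 d)) (ℕ.m≤m+n (d * 2) 2))
    (subst (λ s → d * s + s ≤ cutM (toM G) B + s * s) s≡2 (cutM-≥ (toM-regular {G = G} rg) B)))
    (ℕ.≤-reflexive (ℕ.+-comm (cutM (toM G) B) 4)))
... | no s≢2 = ℕ.≮⇒≥ λ lt → ¬bad (tabulate B , subst (3 ≤_) (sym sz) (ℕ.≤∧≢⇒< 2≤s (s≢2 ∘ sym)) , subst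
    (λ x → 2 * x ≤ n) (sym sz) 2s≤n ,
    subst (_< 2 * d ∸ 4) (cutM-ext (toM G) (λ i → sym (lookup∘tabulate B i))) lt)
  where
  sz : ∑ (bit ∘ lookup (tabulate B)) ≡ ∑ (bit ∘ B)
  sz = ∑-cong λ i → cong bit (lookup∘tabulate B i)

¬Bad⇒CutBound : ∀ {n d} {G : Digraph n} → IsRegularGraph d G → ¬ UnionBound.Bad n d G → CutBound (2 * d ∸ 4) (toM G)
¬Bad⇒CutBound {n} {d} {G} rg ¬bad A 2≤s 2≤t with ℕ.≤-total (∑ (bit ∘ A)) (∑ (bit ∘ not ∘ A))
... | inj₁ s≤t = ¬Bad⇒half rg ¬bad A 2≤s (ℕ.≤-trans (ℕ.+-monoʳ-≤ s (ℕ.≤-trans (ℕ.≤-reflexive (ℕ.+-identityʳ s)) s≤t))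
    (ℕ.≤-reflexive (∑-not A)))
  where s = ∑ (bit ∘ A)
... | inj₂ t≤s = ℕ.≤-trans (¬Bad⇒half rg ¬bad (not ∘ A) 2≤t
    (ℕ.≤-trans (ℕ.+-mono-≤ t≤s (ℕ.≤-reflexive (ℕ.+-identityʳ t))) (ℕ.≤-reflexive (∑-not A))))
                   (ℕ.≤-reflexive (cutM-not (toM G) (RegularM.symm (toM-regular {G = G} rg)) A))
  where t = ∑ (bit ∘ not ∘ A)

-- Circulant graphs: the neighbourhood of 0 is a palindromic subset of {1, …, n ∸ 1}.
module Circulant (k : ℕ) (g : ℕ → Bool) (g0 : g 0 ≡ false) (palin : ∀ x → x < k → g (suc x) ≡ g (k ∸ x)) where

  F : ℕ → ℕ
  F i = sumTo (suc k) λ j → bit (g ∣ i - j ∣)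

  -- Row i + 1 is row i shifted by one place: the value at distance i + 1 enters and that at
  -- distance k - i leaves. They agree by `palin`.
  F-step : ∀ i → i < k → F (suc i) ≡ F i
  F-step i i<k = begin
    bit (g (suc i)) + sumTo k (λ j → bit (g ∣ i - j ∣)) ≡⟨ ℕ.+-comm (bit (g (suc i))) _ ⟩
    sumTo k (λ j → bit (g ∣ i - j ∣)) + bit (g (suc i)) ≡⟨ cong (λ b → sumTo k (λ j → bit (g ∣ i - j ∣)) + bit b)
        (trans (palin i i<k) (cong g (sym (ℕ.m≤n⇒∣m-n∣≡n∸m (ℕ.<⇒≤ i<k))))) ⟩
    sumTo k (λ j → bit (g ∣ i - j ∣)) + bit (g ∣ i - k ∣) ≡⟨ sym (sumTo-last k (λ j → bit (g ∣ i - j ∣))) ⟩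
    F i ∎
    where open ≡-Reasoning

  F-const : ∀ i → i ≤ k → F i ≡ sumTo k (bit ∘ g ∘ suc)
  F-const zero    _   = cong (λ b → bit b + sumTo k (bit ∘ g ∘ suc)) g0
  F-const (suc i) i<k = trans (F-step i i<k) (F-const i (ℕ.<⇒≤ i<k))

  ∑-toℕ : ∀ n (f : ℕ → ℕ) → ∑ {n} (f ∘ toℕ) ≡ sumTo n f
  ∑-toℕ zero    f = refl
  ∑-toℕ (suc n) f = cong (f 0 +_) (∑-toℕ n (f ∘ suc))

  M : Matrix (suc k)
  M i j = g ∣ toℕ i - toℕ j ∣

  circulant : RegularM (sumTo k (bit ∘ g ∘ suc)) M
  circulant = record
    { symm = λ i j → cong g (ℕ.∣-∣-comm (toℕ i) (toℕ j))
    ; irr  = λ i → trans (cong g (ℕ.∣n-n∣≡0 (toℕ i))) g0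
    ; reg  = λ i → trans (∑-toℕ (suc k) (λ j → bit (g ∣ toℕ i - j ∣))) (F-const (toℕ i) (ℕ.≤-pred (Fin.toℕ<n i))) }

-- The first and last h of k positions. For even d they form the neighbourhood, with 2h = d; for odd
-- d their complement does, with 2h = k - d, which is even because n = k + 1 is.
module Ends (k h : ℕ) (2h≤k : 2 * h ≤ k) where

  ends : ℕ → Bool
  ends y = ⌊ y <? h ⌋ ∨ ⌊ k ∸ suc y <? h ⌋

  ends-palin : ∀ y → y < k → ends y ≡ ends (k ∸ suc y)
  ends-palin y y<k = trans (∨-comm ⌊ y <? h ⌋ _) (cong (λ z → ⌊ k ∸ suc y <? h ⌋ ∨ ⌊ z <? h ⌋) (sym back))
    where
    back : k ∸ suc (k ∸ suc y) ≡ y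
    back = trans (cong (k ∸_) (sym (ℕ.+-∸-assoc 1 y<k))) (ℕ.m∸[m∸n]≡n (ℕ.<⇒≤ y<k))

  sumTo-reverse : ∀ k f → sumTo k (λ y → f (k ∸ suc y)) ≡ sumTo k f
  sumTo-reverse zero    f = refl
  sumTo-reverse (suc k) f = trans (cong (f k +_) (sumTo-reverse k f))
      (trans (ℕ.+-comm (f k) _) (sym (sumTo-last k f)))

  sumTo-below : ∀ k h → h ≤ k → sumTo k (λ y → bit ⌊ y <? h ⌋) ≡ h
  sumTo-below k zero _ = trans (sumTo-cong k λ y → refl) (trans (sumTo-const k 0) (ℕ.*-zeroʳ k))
  sumTo-below (suc k) (suc h) (s≤s le) = cong suc (trans (sumTo-cong k λ y → cong bit (shift y)) (sumTo-below k h le))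
    where
    shift : ∀ y → ⌊ suc y <? suc h ⌋ ≡ ⌊ y <? h ⌋
    shift y with y <? h
    ... | yes lt = true-⌊⌋ (suc y <? suc h) (s≤s lt)
    ... | no ¬lt = ¬true⇒false λ eq → ¬lt (ℕ.≤-pred (⌊⌋-true (suc y <? suc h) eq))

  count-ends : sumTo k (bit ∘ ends) ≡ 2 * h
  count-ends = begin
    sumTo k (bit ∘ ends) ≡⟨ ℕ.≤-antisym (sumTo-mono k λ y y<k → ℕ.≤-reflexive (disj y y<k))
        (sumTo-mono k λ y y<k → ℕ.≤-reflexive (sym (disj y y<k))) ⟩
    sumTo k (λ y → bit ⌊ y <? h ⌋ + bit ⌊ k ∸ suc y <? h ⌋) ≡⟨ sumTo-+ k (λ y → bit ⌊ y <? h ⌋) _ ⟩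
    sumTo k (λ y → bit ⌊ y <? h ⌋) + sumTo k (λ y → bit ⌊ k ∸ suc y <? h ⌋) ≡⟨ cong₂ _+_ below
        (trans (sumTo-reverse k (λ y → bit ⌊ y <? h ⌋)) below) ⟩
    h + h ≡⟨ cong (h +_) (sym (ℕ.+-identityʳ h)) ⟩
    2 * h ∎
    where
    open ≡-Reasoning
    below = sumTo-below k h (ℕ.≤-trans (ℕ.m≤m+n h _) 2h≤k)
    disj : ∀ y → y < k → bit (ends y) ≡ bit ⌊ y <? h ⌋ + bit ⌊ k ∸ suc y <? h ⌋
    disj y y<k with y <? h | k ∸ suc y <? h
    ... | no _   | _     = refl
    ... | yes _  | no _  = refl
    ... | yes p  | yes q = ⊥-elim (ℕ.<⇒≱ (ℕ.≤-trans (ℕ.≤-reflexive lem) (ℕ.+-mono-≤ p q))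
        (ℕ.≤-trans (ℕ.≤-reflexive (cong (h +_) (sym (ℕ.+-identityʳ h)))) 2h≤k))
      where
      lem : suc k ≡ suc y + suc (k ∸ suc y)
      lem = sym (trans (ℕ.+-suc (suc y) _) (cong suc (ℕ.m+[n∸m]≡n y<k)))

regular-exists : ∀ n d → d < n → 2 ∣ d * n → ∃ λ G → G ∈ᴸ regularGraphs n d
regular-exists (suc k) d (s≤s d≤k) 2∣dn with 2 ∣? d
... | yes (divides h d≡) = fromM M , ∈-regularGraphs⁺ {suc k} {d}
    (fromM-regular (subst (λ x → RegularM x M) (trans count-ends 2h≡) circulant))
  where
  2h≡ : 2 * h ≡ d
  2h≡ = trans (ℕ.*-comm 2 h) (sym d≡)
  open Ends k h (subst (_≤ k) (sym 2h≡) d≤k)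
  g : ℕ → Bool
  g zero    = false
  g (suc y) = ends y
  open Circulant k g refl (λ x x<k → trans (ends-palin x x<k) (cong g (sym (ℕ.+-∸-assoc 1 x<k))))
... | no d-odd with euclidsLemma d (suc k) prime[2] 2∣dn
... | inj₁ 2∣d = ⊥-elim (d-odd 2∣d)
... | inj₂ 2∣n = fromM M , ∈-regularGraphs⁺ {suc k} {d}
    (fromM-regular (subst (λ x → RegularM x M) count-mid circulant))
  where
  even-rest : 2 ∣ k ∸ d
  even-rest = ∣m+n∣m⇒∣n (subst (2 ∣_) (trans (cong suc (sym (ℕ.m+[n∸m]≡n d≤k))) refl) 2∣n) (odd⇒ d d-odd)
  h = _∣_.quotient even-rest
  2h≡ : 2 * h ≡ k ∸ d
  2h≡ = trans (ℕ.*-comm 2 h) (sym (_∣_.equality even-rest))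
  open Ends k h (subst (_≤ k) (sym 2h≡) (ℕ.m∸n≤m k d))
  g : ℕ → Bool
  g zero    = false
  g (suc y) = not (ends y)
  open Circulant k g refl (λ x x<k → trans (cong not (ends-palin x x<k)) (cong g (sym (ℕ.+-∸-assoc 1 x<k))))
  count-mid : sumTo k (bit ∘ not ∘ ends) ≡ d
  count-mid = ℕ.+-cancelˡ-≡ (2 * h) _ _ (begin
    2 * h + sumTo k (bit ∘ not ∘ ends) ≡⟨ cong (_+ sumTo k (bit ∘ not ∘ ends)) (sym count-ends) ⟩
    sumTo k (bit ∘ ends) + sumTo k (bit ∘ not ∘ ends) ≡⟨ sym (sumTo-+ k (bit ∘ ends) (bit ∘ not ∘ ends)) ⟩
    sumTo k (λ y → bit (ends y) + bit (not (ends y))) ≡⟨ trans (sumTo-cong k λ y → bit-not (ends y))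
        (trans (sumTo-const k 1) (ℕ.*-identityʳ k)) ⟩
    k ≡⟨ sym (ℕ.m∸n+n≡m d≤k) ⟩
    k ∸ d + d ≡⟨ cong (_+ d) (sym 2h≡) ⟩
    2 * h + d ∎)
    where open ≡-Reasoning

-- The limit

-- A positive ε is at least the reciprocal of its denominator; the `suc` makes the inequality
-- strict.
ratio-near-1 : ∀ a b ε → 0ℚ ℚ.< ε → a ≤ b → 0 < b → suc (ℚ.denominatorℕ ε) * (b ∸ a) ≤ b →
    ℚ.∣ ratio a b ℚ.- 1ℚ ∣ ℚ.< ε
ratio-near-1 a (suc b-1) ε@(mkℚ (pos zero)  δ-1 _) (ℚ.*<* 0<0) a≤b 0<b near = ⊥-elim (ℤ.<-irrefl refl 0<0)
ratio-near-1 a (suc b-1) ε@(mkℚ ℤ.-[1+ ν ]  δ-1 _) (ℚ.*<* ()) a≤b 0<b near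
ratio-near-1 a b@(suc b-1) ε@(mkℚ (pos (suc ν)) δ-1 _) 0<ε a≤b 0<b near = ℚ.toℚᵘ-cancel-<
    (ℚᵘ.<-respˡ-≃ (ℚᵘ.≃-sym x-1) main)
  where
  y : ℚᵘ
  y = ℚᵘ.∣ mkℚᵘ (pos a) b-1 ℚᵘ.+ mkℚᵘ ℤ.-[1+ 0 ] 0 ∣
  x-1 : toℚᵘ ℚ.∣ ratio a b ℚ.- 1ℚ ∣ ℚᵘ.≃ y
  x-1 = ℚᵘ.≃-trans (ℚ.toℚᵘ-homo-∣-∣ (ratio a b ℚ.- 1ℚ))
      (ℚᵘ.∣-∣-cong (ℚᵘ.≃-trans (ℚ.toℚᵘ-homo-+ (ratio a b) (ℚ.- 1ℚ))
      (ℚᵘ.+-congˡ (mkℚᵘ ℤ.-[1+ 0 ] 0) (ℚ.toℚᵘ-fromℚᵘ (mkℚᵘ (pos a) b-1)))))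
  c = b ∸ a
  num : ℤ.∣ pos a *ᶻ pos 1 +ᶻ ℤ.-[1+ 0 ] *ᶻ pos b ∣ ≡ c
  num = trans (cong ℤ.∣_∣ (trans (cong₂ _+ᶻ_ (ℤ.*-identityʳ (pos a)) (ℤ.-1*i≡-i (pos b))) (ℤ.m-n≡m⊖n a b)))
      (ℤ.∣⊖∣-≤ a≤b)
  below : c * suc δ-1 < suc ν * (b * 1)
  below = ℕ.<-≤-trans (lt c near) (ℕ.≤-trans (ℕ.≤-reflexive (sym (ℕ.*-identityʳ b))) (ℕ.m≤m+n (b * 1) _))
    where
    lt : ∀ c → suc (suc δ-1) * c ≤ b → c * suc δ-1 < b
    lt zero    _  = s≤s z≤n
    lt (suc c) le = ℕ.<-≤-trans (ℕ.≤-trans (ℕ.m<n+m (suc c * suc δ-1) (s≤s (z≤n {c})))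
        (ℕ.≤-reflexive (cong (λ x → suc c + x) (ℕ.*-comm (suc c) (suc δ-1))))) le
  main : y ℚᵘ.< toℚᵘ ε
  main = *<* (subst₂ ℤ._<_ (trans (ℤ.pos-* c (suc δ-1)) (cong (λ x → pos x *ᶻ pos (suc δ-1)) (sym num)))
      (ℤ.pos-* (suc ν) (b * 1)) (ℤ.+<+ below))

filter-≥ : ∀ {X : Set} {p} {P : Pred X p} (P? : Decidable P) (bad : X → Bool) xs →
    (∀ x → x ∈ᴸ xs → bad x ≡ false → P x) →
           length xs ≤ length (filter P? xs) + count bad xs
filter-≥ P? bad []       imp = z≤n
filter-≥ P? bad (x ∷ xs) imp with P? x | filter-≥ P? bad xs (λ y y∈ → imp y (there y∈))
... | yes _ | ih = s≤s (ℕ.≤-trans ih (ℕ.+-monoʳ-≤ (length (filter P? xs)) (ℕ.m≤n+m _ (bit (bad x)))))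
... | no ¬p | ih with bad x in eq
... | false = ⊥-elim (¬p (imp x (here refl) eq))
... | true  = ℕ.≤-trans (s≤s ih) (ℕ.≤-reflexive (sym (ℕ.+-suc _ _)))

aas-from : ∀ d k .{{_ : NonZero k}} →
  (∀ M → ∃ λ n₀ → ∀ n → n₀ ≤ n → Admissible d k n → ∃ λ (bad : Digraph n → Bool) →
     (∀ G → G ∈ᴸ regularGraphs n d → bad G ≡ false → HasStarDecomposition k G) × M * count bad
         (regularGraphs n d) ≤ length (regularGraphs n d)) →
  AasStarDecomposition d k
-- The summand suc d gives d < n, so that a circulant graph exists and the sample space is nonempty.
aas-from d k few ε 0<ε = n₀ + suc d , near
  where
  δ = suc (ℚ.denominatorℕ ε)
  n₀ = proj₁ (few δ)
  ∈⇒0<length : ∀ {X : Set} {x : X} {xs} → x ∈ᴸ xs → 0 < length xs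
  ∈⇒0<length (here _)  = s≤s z≤n
  ∈⇒0<length (there _) = s≤s z≤n
  near : ∀ n → n₀ + suc d ≤ n → Admissible d k n → ℚ.∣ probStarDecomposition n d k ℚ.- 1ℚ ∣ ℚ.< ε
  near n n≥ adm = ratio-near-1 a b ε 0<ε (length-filter (hasStarDecomposition? k) R)
      (∈⇒0<length (proj₂ (regular-exists n d (ℕ.≤-trans (ℕ.m≤n+m (suc d) n₀) n≥) (∣-trans (m∣m*n k) (proj₂ adm)))))
      (ℕ.≤-trans (ℕ.*-monoʳ-≤ δ (ℕ.m≤n+o⇒m∸n≤o b a
          (filter-≥ (hasStarDecomposition? k) (proj₁ bound) R (proj₁ (proj₂ bound))))) (proj₂ (proj₂ bound)))
    where
    bound = proj₂ (few δ) n (ℕ.≤-trans (ℕ.m≤m+n n₀ _) n≥) adm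
    R = regularGraphs n d
    a = length (filter (hasStarDecomposition? k) R)
    b = length R

aas-all : ∀ d k .{{_ : NonZero k}} → (∀ n (G : Digraph n) → IsRegularGraph d G → HasStarDecomposition k G) →
    AasStarDecomposition d k
aas-all d k all = aas-from d k λ M → 0 , λ n _ _ → (λ _ → false) ,
    (λ G G∈ _ → all n G (∈-regularGraphs⁻ {G = G} G∈)) ,
  ℕ.≤-trans (ℕ.≤-reflexive (trans (cong (M *_) (sumL-zero (regularGraphs n d))) (ℕ.*-zeroʳ M))) z≤n

aas-cut : ∀ d k .{{_ : NonZero k}} → 3 ≤ d →
  (∀ n (G : Digraph n) → IsRegularGraph d G → Admissible d k n → CutBound (2 * d ∸ 4) (toM G) →
      HasStarDecomposition k G) → AasStarDecomposition d k
aas-cut d k 3≤d dec = aas-from d k λ M → n₀ M , λ n n≥ adm → UnionBound.bad n d ,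
    (λ G G∈ ok → let rg = ∈-regularGraphs⁻ {G = G} G∈ in
      dec n G rg adm (¬Bad⇒CutBound rg λ b → clash ok (true-⌊⌋ (UnionBound.bad? n d G) b))) ,
    few M n n≥
  where
  open Constants d using (t₀; C)
  n₀ : ℕ → ℕ
  -- The first summand forces μ = n / (8 t₀) above M (C + 1); the second is the hypothesis `n-large`
  -- of the union bound.
  n₀ M = 8 * t₀ * suc (M * suc C) + (8 * d + 8 * (d * d))
  few : ∀ M n → n₀ M ≤ n → M * count (UnionBound.bad n d) (regularGraphs n d) ≤ length (regularGraphs n d)
  few M n n≥ = ℕ.*-cancelʳ-≤ _ _ (suc C) (begin
    M * β * suc C     ≡⟨ lem M β (suc C) ⟩
    β * (M * suc C)   ≤⟨ ℕ.*-monoʳ-≤ β (ℕ.<⇒≤ μ>) ⟩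
    β * μ             ≤⟨ UnionBound.few-bad n d 3≤d μ (ℕ.≤-trans (s≤s z≤n) μ>)
        (ℕ.≤-trans (ℕ.≤-reflexive (ℕ.*-comm e μ)) (m/n*n≤m n e))
                          (ℕ.<-≤-trans (ℕ.≤-<-trans (ℕ.≤-reflexive (m≡m%n+[m/n]*n n e))
                              (ℕ.+-monoˡ-< (μ * e) (m%n<n n e))) (ℕ.≤-reflexive (lem₂ e μ)))
                          (ℕ.≤-trans (ℕ.m≤n+m (8 * d + 8 * (d * d)) (8 * t₀ * suc (M * suc C))) n≥) ⟩
    r * C             ≤⟨ ℕ.*-monoʳ-≤ r (ℕ.n≤1+n C) ⟩
    r * suc C ∎)
    where
    open ℕ.≤-Reasoning
    e = 8 * t₀
    μ = n / e
    β = count (UnionBound.bad n d) (regularGraphs n d)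
    r = length (regularGraphs n d)
    lem : ∀ a b c → a * b * c ≡ b * (a * c)
    lem = ℕ-Solver.solve-∀
    lem₂ : ∀ e m → e + m * e ≡ e * suc m
    lem₂ = ℕ-Solver.solve-∀
    μ> : M * suc C < μ
    μ> = ℕ.≮⇒≥ λ lt → ℕ.<⇒≱ (ℕ.≤-<-trans (ℕ.≤-reflexive (m≡m%n+[m/n]*n n e))
        (ℕ.<-≤-trans (ℕ.+-monoˡ-< (μ * e) (m%n<n n e)) (ℕ.≤-trans (ℕ.≤-reflexive (lem₂ e μ)) (ℕ.*-monoʳ-≤ e lt))))
        (ℕ.≤-trans (ℕ.m≤m+n (8 * t₀ * suc (M * suc C)) (8 * d + 8 * (d * d))) n≥)

-- The cases of the theorem.

aas-main : ∀ h d → 2 * suc h < d → AasStarDecomposition d (suc h)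
aas-main h d lt = aas-cut d (suc h) 3≤d λ n G (simple , regular) (0<n , dvd) bound →
    Cases.star-main G simple regular h lt 0<n dvd (λ A p q → ℕ.≤-trans K≤ (bound A p q))
  where
  3≤d : 3 ≤ d
  3≤d = ℕ.≤-trans (s≤s (ℕ.*-monoʳ-≤ 2 (s≤s (z≤n {h})))) lt
  -- Equality at d = 2k + 1.
  K≤ : Mod.K h ≤ 2 * d ∸ 4
  K≤ = ℕ.≤-trans (ℕ.≤-reflexive (sym (trans (cong (_∸ 4) (eq h)) (ℕ.m+n∸m≡n 4 (Mod.K h)))))
      (ℕ.∸-monoˡ-≤ 4 (ℕ.*-monoʳ-≤ 2 lt))
    where
    eq : ∀ h → 2 * suc (2 * suc h) ≡ 4 + (suc (h + h) + suc (h + h))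
    eq = ℕ-Solver.solve-∀

aas-double : ∀ h d → d ≡ 2 * suc h → 1 ≤ h → AasStarDecomposition d (suc h)
aas-double h d d≡ 1≤h = aas-cut d (suc h) (ℕ.≤-trans (ℕ.n≤1+n 3) 4≤d) λ n G (simple , regular) _ bound →
    Cases.star-euler G simple regular (suc h) d≡
        (λ A p q → ℕ.≤-trans (ℕ.≤-trans (s≤s (s≤s z≤n)) (ℕ.∸-monoˡ-≤ 4 (ℕ.*-monoʳ-≤ 2 4≤d))) (bound A p q))
  where
  4≤d : 4 ≤ d
  4≤d = subst (4 ≤_) (sym d≡) (ℕ.*-monoʳ-≤ 2 (s≤s 1≤h))

aas-32 : AasStarDecomposition 3 2
aas-32 = aas-cut 3 2 ℕ.≤-refl λ n G (simple , regular) (_ , dvd) bound →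
    Cases.star-32 G simple regular refl dvd (λ A p q → ℕ.≤-trans (s≤s z≤n) (bound A p q))

aas-1 : ∀ d → AasStarDecomposition d 1
aas-1 d = aas-all d 1 λ n G (simple , regular) → Cases.star-k≡1 G simple regular

aas-≥2k : ∀ k d .{{_ : NonZero k}} → 2 * k ≤ d → AasStarDecomposition d k
aas-≥2k (suc zero)    d le = aas-1 d
aas-≥2k (suc (suc h)) d le = Sum.[ (λ lt → aas-main (suc h) d lt) ,
    (λ eq → aas-double (suc h) d (sym eq) (s≤s z≤n)) ] (ℕ.m≤n⇒m<n∨m≡n le)

-- Only d = 3 lies strictly between k and 2k when k = 2.
aas-k≡2 : ∀ d → 2 < d → Dec (d ≡ 3) → AasStarDecomposition d 2
aas-k≡2 d 2<d (yes refl) = aas-32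
aas-k≡2 d 2<d (no d≢3)   = aas-≥2k 2 d (ℕ.≤∧≢⇒< 2<d (d≢3 ∘ sym))

theorem1 : (k d : ℕ) .{{_ : NonZero k}} .{{_ : NonZero d}} → k < d →
    ((k ≡ 2 ⊎ (∃ λ m → 2 ∣ m × d ≡ m * k)) → AasStarDecomposition d k) ×
    (2 * k ^ 2 + k ≤ d → AasStarDecomposition d k) ×
    ((¬ (2 ∣ k)) × 3 ≤ k × 2 * k < d → AasStarDecomposition d k)
theorem1 k d k<d = part-i , part-ii , λ (_ , _ , lt) → aas-≥2k k d (ℕ.<⇒≤ lt)
  where
  part-i : (k ≡ 2 ⊎ (∃ λ m → 2 ∣ m × d ≡ m * k)) → AasStarDecomposition d k
  part-i (inj₁ refl) = aas-k≡2 d k<d (d ℕ.≟ 3)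
  part-i (inj₂ (m , divides zero refl , refl)) = ⊥-elim (ℕ.n≮0 k<d)
  part-i (inj₂ (m , divides (suc q) refl , d≡)) = aas-≥2k k d
      (ℕ.≤-trans (ℕ.*-monoˡ-≤ k (s≤s (s≤s (z≤n {q * 2})))) (ℕ.≤-reflexive (sym d≡)))
  part-ii : 2 * k ^ 2 + k ≤ d → AasStarDecomposition d k
  part-ii le = aas-≥2k k d (ℕ.≤-trans (ℕ.≤-trans (ℕ.*-monoʳ-≤ 2 (ℕ.m≤m*n k (k * 1) {{ℕ.m*n≢0 k 1}}))
      (ℕ.m≤m+n _ k)) le)
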